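{- Let $k,l$ be positive integers. For $\operatorname{Re}s>1$, $$\sum_{n_{l+1}\mid n_l^k\mid\cdots\mid n_1^k}(n_1^k\cdots n_l^k\,n_{l+1})^{ -s}=F_{k,l}(s)\prod_{j=2}^{l+1}\zeta(jks).$$
   Context: The sum is over all $(l+1)$-tuples of positive integers with $n_{l+1}\mid n_l^k\mid n_{l-1}^k\mid\cdots\mid n_1^k$. A positive integer $n$ is an $l$-step $k$-powerful number if for every prime $p$, $\operatorname{ord}_pn\in\{0,k,2k,\dots,(l-1)k\}$ or $\operatorname{ord}_pn\ge lk$ (here $\operatorname{ord}_pn$ is the exponent of $p$ in $n$). $F_{k,l}(s):=\sum_{n}n^{ -s}$, summed over all $l$-step $k$-powerful numbers $n$. $\zeta$ is the Riemann zeta function. -}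

module Defs where

open import Data.Nat as ℕ using (ℕ; zero; suc; z≤n; s≤s)
import Data.Nat.Properties as ℕ
import Data.Nat.Solver as ℕ
import Data.Nat.Divisibility as ℕ
open import Data.Nat.ListAction using (product)
open import Data.Nat.Primality using (Prime)
open import Data.Integer as ℤ using (+_; -[1+_])
import Data.Integer.Properties as ℤ
open import Data.Rational as ℚ using (ℚ; 0ℚ; 1ℚ; ½; mkℚ; _/_; ∣_∣)
import Data.Rational.Properties as ℚ
import Data.Rational.Solver as ℚ
import Data.Rational.Unnormalised as ℚᵘ
import Data.Rational.Unnormalised.Properties as ℚᵘ
open import Data.List as List using (List)
open import Data.List.Relation.Binary.Subset.Propositional using (_⊆_)
open import Data.List.Relation.Unary.All using (All)
open import Data.List.Relation.Unary.Unique.Propositional using (Unique)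
open import Data.Product using (_×_; _,_; ∃; ∃-syntax; proj₁; proj₂)
open import Data.Sum using (_⊎_; inj₁; inj₂)
open import Data.Vec as Vec using (Vec; _∷ʳ_; toList)
open import Data.Vec.Relation.Unary.All using () renaming (All to VecAll)
open import Data.Vec.Relation.Unary.Linked using (Linked)
open import Relation.Binary.PropositionalEquality using (_≡_; refl; sym; trans; cong; cong₂; subst)
open import Relation.Nullary using (¬_)

open ℚ.+-*-Solver using (solve; _:+_; _:*_; _:-_; :-_; _:=_; con)

recip : ℕ → ℚ
recip n = + 1 / suc n

∑< : ℕ → (ℕ → ℚ) → ℚ
∑< zero    f = 0ℚ
∑< (suc n) f = ∑< n f ℚ.+ f n

module Rationals where
  open import Data.Rational using (_+_; _*_; _-_; -_; _≤_; _<_)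
  open ℚ.≤-Reasoning

  abstract

    ∣-∣-sym : ∀ p q → ∣ p - q ∣ ≡ ∣ q - p ∣
    ∣-∣-sym p q = trans (sym (ℚ.∣-p∣≡∣p∣ (p - q))) (cong ∣_∣ (solve 2 (λ p q → :- (p :- q) := q :- p) refl p q))

    p≤q⇒0≤q-p : ∀ {p q} → p ≤ q → 0ℚ ≤ q - p
    p≤q⇒0≤q-p {p} {q} h = begin
      0ℚ     ≡⟨ ℚ.+-inverseʳ p ⟨
      p - p  ≤⟨ ℚ.+-monoˡ-≤ (- p) h ⟩
      q - p  ∎

    p≤p+q : ∀ {p q} → 0ℚ ≤ q → p ≤ p + q
    p≤p+q {p} {q} h = begin
      p       ≡⟨ ℚ.+-identityʳ p ⟨
      p + 0ℚ  ≤⟨ ℚ.+-monoʳ-≤ p h ⟩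
      p + q   ∎

    p≤q+p : ∀ {p q} → 0ℚ ≤ q → p ≤ q + p
    p≤q+p {p} {q} h = ℚ.≤-trans (p≤p+q h) (ℚ.≤-reflexive (ℚ.+-comm p q))

    0≤p+q : ∀ {p q} → 0ℚ ≤ p → 0ℚ ≤ q → 0ℚ ≤ p + q
    0≤p+q hp hq = ℚ.≤-trans hp (p≤p+q hq)

    *-monoˡ : ∀ {r p q} → 0ℚ ≤ r → p ≤ q → r * p ≤ r * q
    *-monoˡ {r} h = ℚ.*-monoˡ-≤-nonNeg r {{ℚ.nonNegative h}}

    *-monoʳ : ∀ {r p q} → 0ℚ ≤ r → p ≤ q → p * r ≤ q * r
    *-monoʳ {r} h = ℚ.*-monoʳ-≤-nonNeg r {{ℚ.nonNegative h}}

    *-mono : ∀ {p q r s} → 0ℚ ≤ p → 0ℚ ≤ s → p ≤ q → r ≤ s → p * r ≤ q * s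
    *-mono hp hs p≤q r≤s = ℚ.≤-trans (*-monoˡ hp r≤s) (*-monoʳ hs p≤q)

    0≤p*q : ∀ {p q} → 0ℚ ≤ p → 0ℚ ≤ q → 0ℚ ≤ p * q
    0≤p*q {p} {q} hp hq = ℚ.≤-trans (ℚ.≤-reflexive (sym (ℚ.*-zeroʳ p))) (*-monoˡ hp hq)

    0≤1 : 0ℚ ≤ 1ℚ
    0≤1 = ℚ.nonNegative⁻¹ 1ℚ

    0<1 : 0ℚ < 1ℚ
    0<1 = ℚ.positive⁻¹ 1ℚ

    0≤½ : 0ℚ ≤ ½
    0≤½ = ℚ.nonNegative⁻¹ ½

    toℚᵘ-recip : ∀ n → ℚ.toℚᵘ (recip n) ℚᵘ.≃ ℚᵘ.mkℚᵘ (+ 1) n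
    toℚᵘ-recip n = ℚ.toℚᵘ-fromℚᵘ (ℚᵘ.mkℚᵘ (+ 1) n)

    0<recip : ∀ n → 0ℚ < recip n
    0<recip n = ℚ.positive⁻¹ (recip n) {{ℚ.normalize-pos 1 (suc n)}}

    0≤recip : ∀ n → 0ℚ ≤ recip n
    0≤recip n = ℚ.<⇒≤ (0<recip n)

    recip-antimono : ∀ {m n} → m ℕ.≤ n → recip n ≤ recip m
    recip-antimono {m} {n} h = ℚ.toℚᵘ-cancel-≤ (ℚᵘ.≤-trans (ℚᵘ.≤-reflexive (toℚᵘ-recip n)) (ℚᵘ.≤-trans le (ℚᵘ.≤-reflexive (ℚᵘ.≃-sym (toℚᵘ-recip m)))))
      where
      le : ℚᵘ.mkℚᵘ (+ 1) n ℚᵘ.≤ ℚᵘ.mkℚᵘ (+ 1) m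
      le = ℚᵘ.*≤* (ℤ.*-monoˡ-≤-nonNeg (+ 1) (ℤ.+≤+ (s≤s h)))

    archimedean : ∀ ε → 0ℚ < ε → ∃[ N ] recip N ≤ ε
    archimedean ε 0<ε = go ε {{ℚ.positive 0<ε}}
      where
      go : ∀ ε .{{_ : ℚ.Positive ε}} → ∃[ N ] recip N ≤ ε
      go (mkℚ (+ suc a) d c) = d , ℚ.toℚᵘ-cancel-≤ (ℚᵘ.≤-trans (ℚᵘ.≤-reflexive (toℚᵘ-recip d)) (ℚᵘ.*≤* (ℤ.*-monoʳ-≤-nonNeg (+ suc d) {+ 1} {+ suc a} (ℤ.+≤+ (s≤s z≤n)))))

    -- δ = ε / (K + 1)
    shrink : ∀ K → 0ℚ ≤ K → ∀ ε → 0ℚ < ε → ∃[ δ ] 0ℚ < δ × K * δ < ε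
    shrink K 0≤K ε 0<ε = δ , 0<δ , (begin-strict
        K * δ            ≡⟨ ℚ.+-identityʳ (K * δ) ⟨
        K * δ + 0ℚ       <⟨ ℚ.+-monoʳ-< (K * δ) 0<δ ⟩
        K * δ + δ        ≡⟨ solve 2 (λ K d → K :* d :+ d := (K :+ con 1ℚ) :* d) refl K δ ⟩
        (K + 1ℚ) * δ     ≡⟨ ℚ.*-comm (K + 1ℚ) δ ⟩
        ε * r * (K + 1ℚ) ≡⟨ ℚ.*-assoc ε r (K + 1ℚ) ⟩
        ε * (r * (K + 1ℚ)) ≡⟨ cong (ε *_) (ℚ.*-inverseˡ (K + 1ℚ)) ⟩
        ε * 1ℚ           ≡⟨ ℚ.*-identityʳ ε ⟩
        ε                ∎)
      where
      instance
        K+1-pos : ℚ.Positive (K + 1ℚ)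
        K+1-pos = ℚ.positive (ℚ.<-≤-trans 0<1 (p≤q+p 0≤K))
        K+1-nz : ℚ.NonZero (K + 1ℚ)
        K+1-nz = ℚ.pos⇒nonZero (K + 1ℚ)
        ε-pos : ℚ.Positive ε
        ε-pos = ℚ.positive 0<ε
      r : ℚ
      r = ℚ.1/ (K + 1ℚ)
      δ : ℚ
      δ = ε * r
      instance
        r-pos : ℚ.Positive r
        r-pos = ℚ.1/pos⇒pos (K + 1ℚ)
      0<δ : 0ℚ < δ
      0<δ = ℚ.positive⁻¹ δ {{ℚ.pos*pos⇒pos ε r}}

    ∑<-mono : ∀ n {f g} → (∀ i → i ℕ.< n → f i ≤ g i) → ∑< n f ≤ ∑< n g
    ∑<-mono zero    h = ℚ.≤-refl
    ∑<-mono (suc n) h = ℚ.+-mono-≤ (∑<-mono n (λ i i<n → h i (ℕ.m<n⇒m<1+n i<n))) (h n ℕ.≤-refl)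

    ∑<-nonNeg : ∀ n {f} → (∀ i → 0ℚ ≤ f i) → 0ℚ ≤ ∑< n f
    ∑<-nonNeg zero    h = ℚ.≤-refl
    ∑<-nonNeg (suc n) h = 0≤p+q (∑<-nonNeg n h) (h n)

    term≤∑< : ∀ {n i f} → (∀ i → 0ℚ ≤ f i) → i ℕ.< n → f i ≤ ∑< n f
    term≤∑< {suc n} {i} {f} h (s≤s i≤n) with ℕ.m≤n⇒m<n∨m≡n i≤n
    ... | inj₁ i<n  = ℚ.≤-trans (term≤∑< h i<n) (p≤p+q (h n))
    ... | inj₂ refl = p≤q+p (∑<-nonNeg n h)

    ∑<-split : ∀ a b f → ∑< (a ℕ.+ b) f ≡ ∑< a f + ∑< b (λ i → f (a ℕ.+ i))
    ∑<-split a zero    f rewrite ℕ.+-identityʳ a = sym (ℚ.+-identityʳ _)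
    ∑<-split a (suc b) f rewrite ℕ.+-suc a b = trans (cong (_+ f (a ℕ.+ b)) (∑<-split a b f)) (ℚ.+-assoc (∑< a f) (∑< b (λ i → f (a ℕ.+ i))) (f (a ℕ.+ b)))

open Rationals

-- Real numbers: Cauchy sequences of rationals, with the setoid equality
-- _≈ᴿ_.  The Σ-type in Cauchy supplies the modulus of convergence.

Cauchy : (ℕ → ℚ) → Set
Cauchy x = ∀ ε → 0ℚ ℚ.< ε → ∃[ N ] (∀ m n → N ℕ.≤ m → N ℕ.≤ n → ∣ x m ℚ.- x n ∣ ℚ.< ε)

record ℝ : Set where
  constructor mkℝ
  field
    seq    : ℕ → ℚ
    cauchy : Cauchy seq
open ℝ public

module CauchyLemmas where
  open import Data.Rational using (_+_; _*_; _-_; -_; _≤_; _<_)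
  open ℚ.≤-Reasoning

  abstract

    fromScaled : ∀ {x} K → 0ℚ ≤ K →
      (∀ δ → 0ℚ < δ → ∃[ N ] (∀ m n → N ℕ.≤ m → N ℕ.≤ n → m ℕ.≤ n → ∣ x m - x n ∣ ≤ K * δ)) → Cauchy x
    fromScaled {x} K 0≤K h ε 0<ε with shrink K 0≤K ε 0<ε
    ... | δ , 0<δ , Kδ<ε with h δ 0<δ
    ... | N , est = N , λ m n N≤m N≤n → ℚ.≤-<-trans (wlog m n N≤m N≤n) Kδ<ε
      where
      wlog : ∀ m n → N ℕ.≤ m → N ℕ.≤ n → ∣ x m - x n ∣ ≤ K * δ
      wlog m n N≤m N≤n with ℕ.≤-total m n
      ... | inj₁ m≤n = est m n N≤m N≤n m≤n
      ... | inj₂ n≤m = ℚ.≤-trans (ℚ.≤-reflexive (∣-∣-sym (x m) (x n))) (est n m N≤n N≤m n≤m)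

    bounded : ∀ {x} → Cauchy x → ∃[ K ] 0ℚ ≤ K × (∀ n → ∣ x n ∣ ≤ K)
    bounded {x} cx with cx 1ℚ 0<1
    ... | N , close = S + 1ℚ , 0≤p+q 0≤S 0≤1 , bound
      where
      S : ℚ
      S = ∑< (suc N) (λ i → ∣ x i ∣)
      0≤S : 0ℚ ≤ S
      0≤S = ∑<-nonNeg (suc N) (λ i → ℚ.0≤∣p∣ (x i))
      bound : ∀ n → ∣ x n ∣ ≤ S + 1ℚ
      bound n with ℕ.≤-total n N
      ... | inj₁ n≤N = ℚ.≤-trans (term≤∑< (λ i → ℚ.0≤∣p∣ (x i)) (s≤s n≤N)) (p≤p+q 0≤1)
      ... | inj₂ N≤n = begin
        ∣ x n ∣                   ≡⟨ cong ∣_∣ (solve 2 (λ a b → a := b :+ (a :- b)) refl (x n) (x N)) ⟩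
        ∣ x N + (x n - x N) ∣     ≤⟨ ℚ.∣p+q∣≤∣p∣+∣q∣ (x N) (x n - x N) ⟩
        ∣ x N ∣ + ∣ x n - x N ∣   ≤⟨ ℚ.+-mono-≤ (term≤∑< {suc N} {N} (λ i → ℚ.0≤∣p∣ (x i)) ℕ.≤-refl) (ℚ.<⇒≤ (close n N N≤n ℕ.≤-refl)) ⟩
        S + 1ℚ                    ∎

    common : ∀ {x y} → Cauchy x → Cauchy y → ∀ ε → 0ℚ < ε →
      ∃[ N ] (∀ m n → N ℕ.≤ m → N ℕ.≤ n → ∣ x m - x n ∣ ≤ ε × ∣ y m - y n ∣ ≤ ε)
    common cx cy ε 0<ε with cx ε 0<ε | cy ε 0<ε
    ... | N₁ , h₁ | N₂ , h₂ = N₁ ℕ.⊔ N₂ , λ m n N≤m N≤n →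
        ℚ.<⇒≤ (h₁ m n (ℕ.m⊔n≤o⇒m≤o N₁ N₂ N≤m) (ℕ.m⊔n≤o⇒m≤o N₁ N₂ N≤n))
      , ℚ.<⇒≤ (h₂ m n (ℕ.m⊔n≤o⇒n≤o N₁ N₂ N≤m) (ℕ.m⊔n≤o⇒n≤o N₁ N₂ N≤n))

    const-cauchy : ∀ q → Cauchy (λ _ → q)
    const-cauchy q ε 0<ε = 0 , λ _ _ _ _ → subst (λ d → ∣ d ∣ < ε) (sym (ℚ.+-inverseʳ q)) 0<ε

    +-cauchy : ∀ {x y} → Cauchy x → Cauchy y → Cauchy (λ n → x n + y n)
    +-cauchy {x} {y} cx cy = fromScaled {λ n → x n + y n} (1ℚ + 1ℚ) (0≤p+q 0≤1 0≤1) λ δ 0<δ →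
      let N , h = common {x} {y} cx cy δ 0<δ in
      N , λ m n N≤m N≤n _ → begin
        ∣ (x m + y m) - (x n + y n) ∣      ≡⟨ cong ∣_∣ (solve 4 (λ a b c d → (a :+ b) :- (c :+ d) := (a :- c) :+ (b :- d)) refl (x m) (y m) (x n) (y n)) ⟩
        ∣ (x m - x n) + (y m - y n) ∣      ≤⟨ ℚ.∣p+q∣≤∣p∣+∣q∣ (x m - x n) (y m - y n) ⟩
        ∣ x m - x n ∣ + ∣ y m - y n ∣      ≤⟨ ℚ.+-mono-≤ (proj₁ (h m n N≤m N≤n)) (proj₂ (h m n N≤m N≤n)) ⟩
        δ + δ                              ≡⟨ solve 1 (λ d → d :+ d := (con 1ℚ :+ con 1ℚ) :* d) refl δ ⟩
        (1ℚ + 1ℚ) * δ                      ∎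

    neg-cauchy : ∀ {x} → Cauchy x → Cauchy (λ n → - x n)
    neg-cauchy {x} cx ε 0<ε with cx ε 0<ε
    ... | N , h = N , λ m n N≤m N≤n → ℚ.≤-<-trans
      (ℚ.≤-reflexive (trans (cong ∣_∣ (solve 2 (λ a b → (:- a) :- (:- b) := b :- a) refl (x m) (x n))) (∣-∣-sym (x n) (x m))))
      (h m n N≤m N≤n)

    *-cauchy : ∀ {x y} → Cauchy x → Cauchy y → Cauchy (λ n → x n * y n)
    *-cauchy {x} {y} cx cy with bounded {x} cx | bounded {y} cy
    ... | K , 0≤K , ∣x∣≤K | L , 0≤L , ∣y∣≤L = fromScaled {λ n → x n * y n} (K + L) (0≤p+q 0≤K 0≤L) λ δ 0<δ →
      let N , h = common {x} {y} cx cy δ 0<δ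
          0≤δ = ℚ.<⇒≤ 0<δ in
      N , λ m n N≤m N≤n _ → begin
        ∣ x m * y m - x n * y n ∣                          ≡⟨ cong ∣_∣ (solve 4 (λ a b c d → a :* b :- c :* d := a :* (b :- d) :+ (a :- c) :* d) refl (x m) (y m) (x n) (y n)) ⟩
        ∣ x m * (y m - y n) + (x m - x n) * y n ∣          ≤⟨ ℚ.∣p+q∣≤∣p∣+∣q∣ (x m * (y m - y n)) ((x m - x n) * y n) ⟩
        ∣ x m * (y m - y n) ∣ + ∣ (x m - x n) * y n ∣      ≡⟨ cong₂ _+_ (ℚ.∣p*q∣≡∣p∣*∣q∣ (x m) (y m - y n)) (ℚ.∣p*q∣≡∣p∣*∣q∣ (x m - x n) (y n)) ⟩
        ∣ x m ∣ * ∣ y m - y n ∣ + ∣ x m - x n ∣ * ∣ y n ∣  ≤⟨ ℚ.+-mono-≤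
                                                              (*-mono (ℚ.0≤∣p∣ (x m)) 0≤δ (∣x∣≤K m) (proj₂ (h m n N≤m N≤n)))
                                                              (*-mono (ℚ.0≤∣p∣ (x m - x n)) 0≤L (proj₁ (h m n N≤m N≤n)) (∣y∣≤L n)) ⟩
        K * δ + δ * L                                      ≡⟨ solve 3 (λ K L d → K :* d :+ d :* L := (K :+ L) :* d) refl K L δ ⟩
        (K + L) * δ                                        ∎

open CauchyLemmas

infix  8 -ᴿ_
infixl 7 _*ᴿ_
infixl 6 _+ᴿ_
infix  4 _≈ᴿ_ _<ᴿ_

fromℚ : ℚ → ℝ
fromℚ q = mkℝ (λ _ → q) (const-cauchy q)

_+ᴿ_ : ℝ → ℝ → ℝ
x +ᴿ y = mkℝ (λ n → seq x n ℚ.+ seq y n) (+-cauchy {seq x} {seq y} (cauchy x) (cauchy y))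

-ᴿ_ : ℝ → ℝ
-ᴿ x = mkℝ (λ n → ℚ.- seq x n) (neg-cauchy {seq x} (cauchy x))

_*ᴿ_ : ℝ → ℝ → ℝ
x *ᴿ y = mkℝ (λ n → seq x n ℚ.* seq y n) (*-cauchy {seq x} {seq y} (cauchy x) (cauchy y))

_≈ᴿ_ : ℝ → ℝ → Set
x ≈ᴿ y = ∀ ε → 0ℚ ℚ.< ε → ∃[ N ] (∀ n → N ℕ.≤ n → ∣ seq x n ℚ.- seq y n ∣ ℚ.< ε)

_<ᴿ_ : ℝ → ℝ → Set
x <ᴿ y = ∃[ ε ] 0ℚ ℚ.< ε × ∃[ N ] (∀ n → N ℕ.≤ n → seq x n ℚ.+ ε ℚ.≤ seq y n)

-- The logarithm of a positive integer, log n = ∫₁ⁿ dt/t, as the limit of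
-- the left Riemann sums with mesh 1/N, N = m + 1:
--   ∑_{i=N}^{nN-1} (1/N)·(1/(i/N)) = ∑_{i=N}^{nN-1} 1/i.
-- (log 0 takes the junk value 0.)

logSeq : ℕ → ℕ → ℚ
logSeq n m = ∑< ((n ℕ.∸ 1) ℕ.* suc m) (λ i → recip (m ℕ.+ i))

module LogLemmas where
  open import Data.Rational using (_+_; _*_; _-_; -_; _≤_; _<_)
  open ℚ.≤-Reasoning

  ι : ℕ → ℚ
  ι zero    = 0ℚ
  ι (suc n) = ι n + 1ℚ

  -- c a m + 1 = (a + 1)(m + 1)
  c : ℕ → ℕ → ℕ
  c a m = m ℕ.+ a ℕ.* suc m

  H : ℕ → ℚ
  H n = ∑< n recip

  U : ℕ → ℕ → ℚ
  U a m = ∑< (a ℕ.* suc m) (λ i → recip (m ℕ.+ i))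

  -- the terms gained in passing from mesh 1/(m+1) to 1/(m+2)
  G : ℕ → ℕ → ℚ
  G a m = ∑< (suc a) (λ i → recip (c a m ℕ.+ i))

  abstract
    ι-+ : ∀ m n → ι (m ℕ.+ n) ≡ ι m + ι n
    ι-+ zero    n = sym (ℚ.+-identityˡ (ι n))
    ι-+ (suc m) n = trans (cong (_+ 1ℚ) (ι-+ m n)) (solve 2 (λ a b → (a :+ b) :+ con 1ℚ := (a :+ con 1ℚ) :+ b) refl (ι m) (ι n))

    ι-* : ∀ m n → ι (m ℕ.* n) ≡ ι m * ι n
    ι-* zero    n = sym (ℚ.*-zeroˡ (ι n))
    ι-* (suc m) n = trans (ι-+ n (m ℕ.* n)) (trans (cong (λ t → ι n + t) (ι-* m n)) (solve 2 (λ a b → b :+ a :* b := (a :+ con 1ℚ) :* b) refl (ι m) (ι n)))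

    toℚᵘ-ι : ∀ n → ℚ.toℚᵘ (ι n) ℚᵘ.≃ ℚᵘ.mkℚᵘ (+ n) 0
    toℚᵘ-ι zero    = ℚᵘ.≃-refl
    toℚᵘ-ι (suc n) = ℚᵘ.≃-trans (ℚ.toℚᵘ-homo-+ (ι n) 1ℚ) (ℚᵘ.≃-trans (ℚᵘ.+-congˡ (ℚ.toℚᵘ 1ℚ) (toℚᵘ-ι n))
      (ℚᵘ.*≡* (trans (ℤ.*-identityʳ (+ n ℤ.* + 1 ℤ.+ + 1)) (trans eq (sym (ℤ.*-identityʳ (+ suc n)))))))
      where
      eq : + n ℤ.* + 1 ℤ.+ + 1 ≡ + suc n
      eq = trans (cong (ℤ._+ + 1) (ℤ.*-identityʳ (+ n))) (cong +_ (ℕ.+-comm n 1))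

    recip*ι : ∀ n → recip n * ι (suc n) ≡ 1ℚ
    recip*ι n = ℚ.toℚᵘ-injective (ℚᵘ.≃-trans (ℚ.toℚᵘ-homo-* (recip n) (ι (suc n)))
      (ℚᵘ.≃-trans (ℚᵘ.*-cong (toℚᵘ-recip n) (toℚᵘ-ι (suc n))) (ℚᵘ.*≡* (cong +_ eq))))
      where
      eq : (suc n ℕ.+ 0) ℕ.* 1 ≡ suc (n ℕ.* 1) ℕ.+ 0
      eq = trans (ℕ.*-identityʳ (suc n ℕ.+ 0)) (cong (λ k → suc k ℕ.+ 0) (sym (ℕ.*-identityʳ n)))

    ∑<-const : ∀ n r → ∑< n (λ _ → r) ≡ ι n * r
    ∑<-const zero    r = sym (ℚ.*-zeroˡ r)
    ∑<-const (suc n) r = trans (cong (_+ r) (∑<-const n r)) (solve 2 (λ a r → a :* r :+ r := (a :+ con 1ℚ) :* r) refl (ι n) r)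

    ι-recip-c : ∀ a m → ι (suc a) * recip (c a m) ≡ recip m
    ι-recip-c a m = begin-equality
      ι (suc a) * r                          ≡⟨ ℚ.*-identityˡ _ ⟨
      1ℚ * (ι (suc a) * r)                   ≡⟨ cong (_* (ι (suc a) * r)) (recip*ι m) ⟨
      recip m * ι (suc m) * (ι (suc a) * r)  ≡⟨ solve 4 (λ p q u v → p :* q :* (u :* v) := p :* (v :* (u :* q))) refl (recip m) (ι (suc m)) (ι (suc a)) r ⟩
      recip m * (r * (ι (suc a) * ι (suc m)))  ≡⟨ cong (λ t → recip m * (r * t)) (ι-* (suc a) (suc m)) ⟨
      recip m * (r * ι (suc (c a m)))        ≡⟨ cong (recip m *_) (recip*ι (c a m)) ⟩
      recip m * 1ℚ                           ≡⟨ ℚ.*-identityʳ (recip m) ⟩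
      recip m                                ∎
      where
      r : ℚ
      r = recip (c a m)

    c-suc : ∀ a m → c a m ℕ.+ suc a ≡ c a (suc m)
    c-suc = ℕ.+-*-Solver.solve 2 (λ a m → (m N+ a N* (Ncon 1 N+ m)) N+ (Ncon 1 N+ a) N= (Ncon 1 N+ m) N+ a N* (Ncon 2 N+ m)) refl
      where open ℕ.+-*-Solver renaming (_:+_ to _N+_; _:*_ to _N*_; _:=_ to _N=_; con to Ncon)

    U-step : ∀ a m → U a (suc m) + recip m ≡ U a m + G a m
    U-step a m = begin-equality
      U a (suc m) + recip m                ≡⟨ solve 3 (λ u h r → u :+ r := ((h :+ r) :+ u) :- h) refl (U a (suc m)) (H m) (recip m) ⟩
      (H (suc m) + U a (suc m)) - H m      ≡⟨ cong (_- H m) (∑<-split (suc m) (a ℕ.* suc (suc m)) recip) ⟨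
      H (c a (suc m)) - H m                ≡⟨ cong (λ t → H t - H m) (c-suc a m) ⟨
      H (c a m ℕ.+ suc a) - H m            ≡⟨ cong (_- H m) (∑<-split (c a m) (suc a) recip) ⟩
      (H (c a m) + G a m) - H m            ≡⟨ cong (λ t → (t + G a m) - H m) (∑<-split m (a ℕ.* suc m) recip) ⟩
      ((H m + U a m) + G a m) - H m        ≡⟨ solve 3 (λ h u g → ((h :+ u) :+ g) :- h := u :+ g) refl (H m) (U a m) (G a m) ⟩
      U a m + G a m                        ∎

    G-upper : ∀ a m → G a m ≤ recip m
    G-upper a m = begin
      G a m                                ≤⟨ ∑<-mono (suc a) (λ i _ → recip-antimono (ℕ.m≤m+n (c a m) i)) ⟩
      ∑< (suc a) (λ _ → recip (c a m))     ≡⟨ ∑<-const (suc a) (recip (c a m)) ⟩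
      ι (suc a) * recip (c a m)            ≡⟨ ι-recip-c a m ⟩
      recip m                              ∎

    G-lower : ∀ a m → recip (suc m) ≤ G a m
    G-lower a m = begin
      recip (suc m)                            ≡⟨ ι-recip-c a (suc m) ⟨
      ι (suc a) * recip (c a (suc m))          ≡⟨ ∑<-const (suc a) (recip (c a (suc m))) ⟨
      ∑< (suc a) (λ _ → recip (c a (suc m)))   ≤⟨ ∑<-mono (suc a) (λ i i<a → recip-antimono (ℕ.≤-trans (ℕ.+-monoʳ-≤ (c a m) (ℕ.<⇒≤ i<a)) (ℕ.≤-reflexive (c-suc a m)))) ⟩
      G a m                                    ∎

    U-anti : ∀ a m → U a (suc m) ≤ U a m
    U-anti a m = begin
      U a (suc m)                        ≡⟨ solve 2 (λ u r → u := (u :+ r) :- r) refl (U a (suc m)) (recip m) ⟩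
      (U a (suc m) + recip m) - recip m  ≡⟨ cong (_- recip m) (U-step a m) ⟩
      (U a m + G a m) - recip m          ≤⟨ ℚ.+-monoˡ-≤ (- recip m) (ℚ.+-monoʳ-≤ (U a m) (G-upper a m)) ⟩
      (U a m + recip m) - recip m        ≡⟨ solve 2 (λ u r → (u :+ r) :- r := u) refl (U a m) (recip m) ⟩
      U a m                              ∎

    V-mono : ∀ a m → U a m - recip m ≤ U a (suc m) - recip (suc m)
    V-mono a m = begin
      U a m - recip m                              ≡⟨ solve 3 (λ u r t → u :- r := ((u :+ t) :- r) :- t) refl (U a m) (recip m) (recip (suc m)) ⟩
      ((U a m + recip (suc m)) - recip m) - recip (suc m)   ≤⟨ ℚ.+-monoˡ-≤ (- recip (suc m)) (ℚ.+-monoˡ-≤ (- recip m) (ℚ.+-monoʳ-≤ (U a m) (G-lower a m))) ⟩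
      ((U a m + G a m) - recip m) - recip (suc m)  ≡⟨ cong (λ t → (t - recip m) - recip (suc m)) (U-step a m) ⟨
      ((U a (suc m) + recip m) - recip m) - recip (suc m)   ≡⟨ solve 3 (λ u r t → ((u :+ r) :- r) :- t := u :- t) refl (U a (suc m)) (recip m) (recip (suc m)) ⟩
      U a (suc m) - recip (suc m)                  ∎

    U-anti′ : ∀ a m k → U a (m ℕ.+ k) ≤ U a m
    U-anti′ a m zero    rewrite ℕ.+-identityʳ m = ℚ.≤-refl
    U-anti′ a m (suc k) rewrite ℕ.+-suc m k = ℚ.≤-trans (U-anti a (m ℕ.+ k)) (U-anti′ a m k)

    V-mono′ : ∀ a m k → U a m - recip m ≤ U a (m ℕ.+ k) - recip (m ℕ.+ k)
    V-mono′ a m zero    rewrite ℕ.+-identityʳ m = ℚ.≤-refl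
    V-mono′ a m (suc k) rewrite ℕ.+-suc m k = ℚ.≤-trans (V-mono′ a m k) (V-mono a (m ℕ.+ k))

    U-close : ∀ a m k → ∣ U a m - U a (m ℕ.+ k) ∣ ≤ recip m
    U-close a m k = begin
      ∣ x - y ∣                        ≡⟨ ℚ.0≤p⇒∣p∣≡p (p≤q⇒0≤q-p (U-anti′ a m k)) ⟩
      x - y                            ≡⟨ solve 3 (λ x y r → x :- y := (x :- r) :+ (r :- y)) refl x y (recip m) ⟩
      (x - recip m) + (recip m - y)    ≤⟨ ℚ.+-monoˡ-≤ (recip m - y) (V-mono′ a m k) ⟩
      (y - r) + (recip m - y)          ≡⟨ solve 3 (λ y r t → (y :- r) :+ (t :- y) := t :- r) refl y r (recip m) ⟩
      recip m - r                      ≤⟨ ℚ.+-monoʳ-≤ (recip m) (ℚ.neg-antimono-≤ (0≤recip (m ℕ.+ k))) ⟩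
      recip m - 0ℚ                     ≡⟨ ℚ.+-identityʳ (recip m) ⟩
      recip m                          ∎
      where
      x y r : ℚ
      x = U a m
      y = U a (m ℕ.+ k)
      r = recip (m ℕ.+ k)

    log-cauchy : ∀ n → Cauchy (logSeq n)
    log-cauchy n = fromScaled {logSeq n} 1ℚ 0≤1 λ δ 0<δ →
      let N , recipN≤δ = archimedean δ 0<δ in
      N , λ m p N≤m _ m≤p → begin
        ∣ U a m - U a p ∣                       ≡⟨ cong (λ t → ∣ U a m - U a t ∣) (ℕ.m+[n∸m]≡n m≤p) ⟨
        ∣ U a m - U a (m ℕ.+ (p ℕ.∸ m)) ∣       ≤⟨ U-close a m (p ℕ.∸ m) ⟩
        recip m                                 ≤⟨ recip-antimono N≤m ⟩
        recip N                                 ≤⟨ recipN≤δ ⟩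
        δ                                       ≡⟨ ℚ.*-identityˡ δ ⟨
        1ℚ * δ                                  ∎
      where
      a : ℕ
      a = n ℕ.∸ 1

log : ℕ → ℝ
log n = mkℝ (logSeq n) (LogLemmas.log-cauchy n)

infix  8 -ᶜ_
infixl 7 _*ᶜ_ _·ᶜ_
infixl 6 _+ᶜ_
infix  4 _≈ᶜ_

record ℂ : Set where
  constructor mkℂ
  field
    re im : ℝ
open ℂ public

fromℝ : ℝ → ℂ
fromℝ x = mkℂ x (fromℚ 0ℚ)

0ᶜ 1ᶜ : ℂ
0ᶜ = fromℝ (fromℚ 0ℚ)
1ᶜ = fromℝ (fromℚ 1ℚ)

_+ᶜ_ : ℂ → ℂ → ℂ
z +ᶜ w = mkℂ (re z +ᴿ re w) (im z +ᴿ im w)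

-ᶜ_ : ℂ → ℂ
-ᶜ z = mkℂ (-ᴿ re z) (-ᴿ im z)

_*ᶜ_ : ℂ → ℂ → ℂ
z *ᶜ w = mkℂ (re z *ᴿ re w +ᴿ -ᴿ (im z *ᴿ im w)) (re z *ᴿ im w +ᴿ im z *ᴿ re w)

_·ᶜ_ : ℕ → ℂ → ℂ
n ·ᶜ z = fromℝ (fromℚ (+ n / 1)) *ᶜ z

_≈ᶜ_ : ℂ → ℂ → Set
z ≈ᶜ w = re z ≈ᴿ re w × im z ≈ᴿ im w

∣_∣² : ℂ → ℝ
∣ z ∣² = re z *ᴿ re z +ᴿ im z *ᴿ im z

-- The complex exponential, exp z = ∑ zʲ/j!.  If z is the limit of the
-- Gaussian rationals zₙ, exp z is the limit of ∑_{j<n} zₙʲ/j!.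

ℚ[i] : Set
ℚ[i] = ℚ × ℚ

infixl 7 _⊗_ _⊙_
infixl 6 _⊕_ _⊖_

_⊕_ _⊖_ _⊗_ : ℚ[i] → ℚ[i] → ℚ[i]
(a , b) ⊕ (c , d) = a ℚ.+ c , b ℚ.+ d
(a , b) ⊖ (c , d) = a ℚ.- c , b ℚ.- d
(a , b) ⊗ (c , d) = a ℚ.* c ℚ.- b ℚ.* d , a ℚ.* d ℚ.+ b ℚ.* c

_⊙_ : ℚ → ℚ[i] → ℚ[i]
r ⊙ (a , b) = r ℚ.* a , r ℚ.* b

-- expTerm z j = zʲ/j!
expTerm : ℚ[i] → ℕ → ℚ[i]
expTerm z zero    = 1ℚ , 0ℚ
expTerm z (suc j) = recip j ⊙ (expTerm z j ⊗ z)

expSum : ℚ[i] → ℕ → ℚ[i]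
expSum z zero    = 0ℚ , 0ℚ
expSum z (suc n) = expSum z n ⊕ expTerm z n

expSeq : ℂ → ℕ → ℚ[i]
expSeq z n = expSum (seq (re z) n , seq (im z) n) n

module ExpLemmas where
  open import Data.Rational using (_+_; _*_; _-_; -_; _≤_; _<_)
  open ℚ.≤-Reasoning

  ‖_‖ : ℚ[i] → ℚ
  ‖ (a , b) ‖ = ∣ a ∣ + ∣ b ∣

  half^ : ℕ → ℚ
  half^ zero    = 1ℚ
  half^ (suc n) = ½ * half^ n

  two^ : ℕ → ℚ
  two^ zero    = 1ℚ
  two^ (suc n) = (1ℚ + 1ℚ) * two^ n

  -- b L j = Lʲ/j!
  b : ℚ → ℕ → ℚ
  b L zero    = 1ℚ
  b L (suc j) = recip j * (b L j * L)

  abstract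
    0≤‖‖ : ∀ z → 0ℚ ≤ ‖ z ‖
    0≤‖‖ (x , y) = 0≤p+q (ℚ.0≤∣p∣ x) (ℚ.0≤∣p∣ y)

    ‖⊕‖ : ∀ z w → ‖ z ⊕ w ‖ ≤ ‖ z ‖ + ‖ w ‖
    ‖⊕‖ (x , y) (u , v) = begin
      ∣ x + u ∣ + ∣ y + v ∣                  ≤⟨ ℚ.+-mono-≤ (ℚ.∣p+q∣≤∣p∣+∣q∣ x u) (ℚ.∣p+q∣≤∣p∣+∣q∣ y v) ⟩
      (∣ x ∣ + ∣ u ∣) + (∣ y ∣ + ∣ v ∣)      ≡⟨ solve 4 (λ x u y v → (x :+ u) :+ (y :+ v) := (x :+ y) :+ (u :+ v)) refl (∣ x ∣) (∣ u ∣) (∣ y ∣) (∣ v ∣) ⟩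
      (∣ x ∣ + ∣ y ∣) + (∣ u ∣ + ∣ v ∣)      ∎

    ‖⊗‖ : ∀ z w → ‖ z ⊗ w ‖ ≤ ‖ z ‖ * ‖ w ‖
    ‖⊗‖ (x , y) (u , v) = begin
      ∣ x * u - y * v ∣ + ∣ x * v + y * u ∣
        ≤⟨ ℚ.+-mono-≤ (ℚ.∣p-q∣≤∣p∣+∣q∣ (x * u) (y * v)) (ℚ.∣p+q∣≤∣p∣+∣q∣ (x * v) (y * u)) ⟩
      (∣ x * u ∣ + ∣ y * v ∣) + (∣ x * v ∣ + ∣ y * u ∣)
        ≡⟨ cong₂ _+_ (cong₂ _+_ (ℚ.∣p*q∣≡∣p∣*∣q∣ x u) (ℚ.∣p*q∣≡∣p∣*∣q∣ y v)) (cong₂ _+_ (ℚ.∣p*q∣≡∣p∣*∣q∣ x v) (ℚ.∣p*q∣≡∣p∣*∣q∣ y u)) ⟩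
      (∣ x ∣ * ∣ u ∣ + ∣ y ∣ * ∣ v ∣) + (∣ x ∣ * ∣ v ∣ + ∣ y ∣ * ∣ u ∣)
        ≡⟨ solve 4 (λ x y u v → (x :* u :+ y :* v) :+ (x :* v :+ y :* u) := (x :+ y) :* (u :+ v)) refl (∣ x ∣) (∣ y ∣) (∣ u ∣) (∣ v ∣) ⟩
      (∣ x ∣ + ∣ y ∣) * (∣ u ∣ + ∣ v ∣)  ∎

    ‖⊙‖ : ∀ r z → 0ℚ ≤ r → ‖ r ⊙ z ‖ ≡ r * ‖ z ‖
    ‖⊙‖ r (x , y) 0≤r = begin-equality
      ∣ r * x ∣ + ∣ r * y ∣          ≡⟨ cong₂ _+_ (ℚ.∣p*q∣≡∣p∣*∣q∣ r x) (ℚ.∣p*q∣≡∣p∣*∣q∣ r y) ⟩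
      ∣ r ∣ * ∣ x ∣ + ∣ r ∣ * ∣ y ∣  ≡⟨ ℚ.*-distribˡ-+ (∣ r ∣) (∣ x ∣) (∣ y ∣) ⟨
      ∣ r ∣ * (∣ x ∣ + ∣ y ∣)        ≡⟨ cong (_* (∣ x ∣ + ∣ y ∣)) (ℚ.0≤p⇒∣p∣≡p 0≤r) ⟩
      r * (∣ x ∣ + ∣ y ∣)            ∎

    ‖⊖‖-sym : ∀ z w → ‖ z ⊖ w ‖ ≡ ‖ w ⊖ z ‖
    ‖⊖‖-sym (x , y) (u , v) = cong₂ _+_ (∣-∣-sym x u) (∣-∣-sym y v)

    ‖z⊖z‖ : ∀ z → ‖ z ⊖ z ‖ ≡ 0ℚ
    ‖z⊖z‖ (x , y) = trans (cong₂ (λ p q → ∣ p ∣ + ∣ q ∣) (ℚ.+-inverseʳ x) (ℚ.+-inverseʳ y)) (ℚ.+-identityʳ 0ℚ)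

    triangle : ∀ z v w → ‖ z ⊖ w ‖ ≤ ‖ z ⊖ v ‖ + ‖ v ⊖ w ‖
    triangle z@(x , y) v@(p , q) w@(s , t) = ℚ.≤-trans
      (ℚ.≤-reflexive (cong ‖_‖ (cong₂ _,_ (eq x p s) (eq y q t)))) (‖⊕‖ (z ⊖ v) (v ⊖ w))
      where
      eq : ∀ x p s → x - s ≡ (x - p) + (p - s)
      eq = solve 3 (λ x p s → x :- s := (x :- p) :+ (p :- s)) refl

    ⊕⊖ : ∀ z v w t → (z ⊕ v) ⊖ (w ⊕ t) ≡ (z ⊖ w) ⊕ (v ⊖ t)
    ⊕⊖ (z , z′) (v , v′) (w , w′) (t , t′) = cong₂ _,_ (eq z v w t) (eq z′ v′ w′ t′)
      where
      eq : ∀ z v w t → (z + v) - (w + t) ≡ (z - w) + (v - t)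
      eq = solve 4 (λ z v w t → (z :+ v) :- (w :+ t) := (z :- w) :+ (v :- t)) refl

    ⊕⊖′ : ∀ z v w → (z ⊕ v) ⊖ w ≡ (z ⊖ w) ⊕ v
    ⊕⊖′ (z , z′) (v , v′) (w , w′) = cong₂ _,_ (eq z v w) (eq z′ v′ w′)
      where
      eq : ∀ z v w → (z + v) - w ≡ (z - w) + v
      eq = solve 3 (λ z v w → (z :+ v) :- w := (z :- w) :+ v) refl

    ⊗⊖ : ∀ r t z u w → r ⊙ (t ⊗ z) ⊖ r ⊙ (u ⊗ w) ≡ r ⊙ ((t ⊖ u) ⊗ z ⊕ u ⊗ (z ⊖ w))
    ⊗⊖ r (t , t′) (z , z′) (u , u′) (w , w′) = cong₂ _,_
      (solve 9 (λ r t t′ z z′ u u′ w w′ → r :* (t :* z :- t′ :* z′) :- r :* (u :* w :- u′ :* w′)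
        := r :* (((t :- u) :* z :- (t′ :- u′) :* z′) :+ (u :* (z :- w) :- u′ :* (z′ :- w′)))) refl r t t′ z z′ u u′ w w′)
      (solve 9 (λ r t t′ z z′ u u′ w w′ → r :* (t :* z′ :+ t′ :* z) :- r :* (u :* w′ :+ u′ :* w)
        := r :* (((t :- u) :* z′ :+ (t′ :- u′) :* z) :+ (u :* (z′ :- w′) :+ u′ :* (z :- w)))) refl r t t′ z z′ u u′ w w′)

    0≤half^ : ∀ n → 0ℚ ≤ half^ n
    0≤half^ zero    = 0≤1
    0≤half^ (suc n) = 0≤p*q 0≤½ (0≤half^ n)

    0≤two^ : ∀ n → 0ℚ ≤ two^ n
    0≤two^ zero    = 0≤1
    0≤two^ (suc n) = 0≤p*q (0≤p+q 0≤1 0≤1) (0≤two^ n)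

    two^*half^ : ∀ n → two^ n * half^ n ≡ 1ℚ
    two^*half^ zero    = refl
    two^*half^ (suc n) = trans
      (solve 2 (λ x y → ((con 1ℚ :+ con 1ℚ) :* x) :* (con ½ :* y) := x :* y) refl (two^ n) (half^ n)) (two^*half^ n)

    half*recip : ∀ n → ½ * recip n ≤ recip (suc n)
    half*recip n = ℚ.toℚᵘ-cancel-≤
      (ℚᵘ.≤-trans (ℚᵘ.≤-reflexive (ℚᵘ.≃-trans (ℚ.toℚᵘ-homo-* ½ (recip n)) (ℚᵘ.*-congˡ {ℚ.toℚᵘ ½} (toℚᵘ-recip n))))
      (ℚᵘ.≤-trans (ℚᵘ.*≤* (ℤ.+≤+ le)) (ℚᵘ.≤-reflexive (ℚᵘ.≃-sym (toℚᵘ-recip (suc n))))))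
      where
      le : 1 ℕ.* suc (suc n) ℕ.≤ 1 ℕ.* (2 ℕ.* suc n)
      le = ℕ.*-monoʳ-≤ 1 (s≤s (ℕ.≤-trans (ℕ.≤-reflexive (cong suc (sym (ℕ.+-identityʳ n)))) (ℕ.m≤n+m (suc (n ℕ.+ 0)) n)))

    half^≤recip : ∀ n → half^ n ≤ recip n
    half^≤recip zero    = ℚ.≤-refl
    half^≤recip (suc n) = ℚ.≤-trans (*-monoˡ 0≤½ (half^≤recip n)) (half*recip n)

    0≤b : ∀ {L} → 0ℚ ≤ L → ∀ j → 0ℚ ≤ b L j
    0≤b 0≤L zero    = 0≤1
    0≤b 0≤L (suc j) = 0≤p*q (0≤recip j) (0≤p*q (0≤b 0≤L j) 0≤L)

    term-bound : ∀ {L} z → 0ℚ ≤ L → ‖ z ‖ ≤ L → ∀ j → ‖ expTerm z j ‖ ≤ b L j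
    term-bound z 0≤L h zero    = ℚ.≤-refl
    term-bound {L} z 0≤L h (suc j) = begin
      ‖ recip j ⊙ (expTerm z j ⊗ z) ‖    ≡⟨ ‖⊙‖ (recip j) (expTerm z j ⊗ z) (0≤recip j) ⟩
      recip j * ‖ expTerm z j ⊗ z ‖      ≤⟨ *-monoˡ (0≤recip j) (‖⊗‖ (expTerm z j) z) ⟩
      recip j * (‖ expTerm z j ‖ * ‖ z ‖) ≤⟨ *-monoˡ (0≤recip j) (*-mono (0≤‖‖ (expTerm z j)) 0≤L (term-bound z 0≤L h j) h) ⟩
      recip j * (b L j * L)              ∎

    term-lipschitz : ∀ {L} z w → 0ℚ ≤ L → ‖ z ‖ + 1ℚ ≤ L → ‖ w ‖ ≤ L → ∀ j →
      ‖ expTerm z j ⊖ expTerm w j ‖ ≤ ‖ z ⊖ w ‖ * b L j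
    term-lipschitz z w 0≤L hz hw zero = ℚ.≤-trans (0≤‖‖ (z ⊖ w)) (ℚ.≤-reflexive (sym (ℚ.*-identityʳ (‖ z ⊖ w ‖))))
    term-lipschitz {L} z w 0≤L hz hw (suc j) = begin
      ‖ recip j ⊙ (tz ⊗ z) ⊖ recip j ⊙ (tw ⊗ w) ‖           ≡⟨ cong ‖_‖ (⊗⊖ (recip j) tz z tw w) ⟩
      ‖ recip j ⊙ ((tz ⊖ tw) ⊗ z ⊕ tw ⊗ (z ⊖ w)) ‖          ≡⟨ ‖⊙‖ (recip j) ((tz ⊖ tw) ⊗ z ⊕ tw ⊗ (z ⊖ w)) (0≤recip j) ⟩
      recip j * ‖ (tz ⊖ tw) ⊗ z ⊕ tw ⊗ (z ⊖ w) ‖            ≤⟨ *-monoˡ (0≤recip j) (‖⊕‖ ((tz ⊖ tw) ⊗ z) (tw ⊗ (z ⊖ w))) ⟩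
      recip j * (‖ (tz ⊖ tw) ⊗ z ‖ + ‖ tw ⊗ (z ⊖ w) ‖)      ≤⟨ *-monoˡ (0≤recip j) (ℚ.+-mono-≤ (‖⊗‖ (tz ⊖ tw) z) (‖⊗‖ tw (z ⊖ w))) ⟩
      recip j * (‖ tz ⊖ tw ‖ * ‖ z ‖ + ‖ tw ‖ * d)          ≤⟨ *-monoˡ (0≤recip j) (ℚ.+-mono-≤
                                                                  (*-monoʳ (0≤‖‖ z) (term-lipschitz z w 0≤L hz hw j))
                                                                  (*-monoʳ (0≤‖‖ (z ⊖ w)) (term-bound w 0≤L hw j))) ⟩
      recip j * (d * b L j * ‖ z ‖ + b L j * d)             ≡⟨ cong (recip j *_) (solve 3 (λ d c n → d :* c :* n :+ c :* d := (d :* c) :* (n :+ con 1ℚ)) refl d (b L j) (‖ z ‖)) ⟩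
      recip j * ((d * b L j) * (‖ z ‖ + 1ℚ))                ≤⟨ *-monoˡ (0≤recip j) (*-monoˡ (0≤p*q (0≤‖‖ (z ⊖ w)) (0≤b 0≤L j)) hz) ⟩
      recip j * ((d * b L j) * L)                           ≡⟨ solve 4 (λ r d c L → r :* ((d :* c) :* L) := d :* (r :* (c :* L))) refl (recip j) d (b L j) L ⟩
      d * (recip j * (b L j * L))                           ∎
      where
      tz tw : ℚ[i]
      tz = expTerm z j
      tw = expTerm w j
      d : ℚ
      d = ‖ z ⊖ w ‖

    geometric : ∀ L → 0ℚ ≤ L → ∃[ C ] 0ℚ ≤ C × (∀ j → b L j ≤ C * half^ j)
    geometric L 0≤L = C , ∑<-nonNeg (suc N) 0≤f , bound
      where
      δ : ℚ
      δ = proj₁ (shrink L 0≤L ½ (ℚ.positive⁻¹ ½))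
      N : ℕ
      N = proj₁ (archimedean δ (proj₁ (proj₂ (shrink L 0≤L ½ (ℚ.positive⁻¹ ½)))))
      Lδ≤½ : L * δ ≤ ½
      Lδ≤½ = ℚ.<⇒≤ (proj₂ (proj₂ (shrink L 0≤L ½ (ℚ.positive⁻¹ ½))))
      recipN≤δ : recip N ≤ δ
      recipN≤δ = proj₂ (archimedean δ (proj₁ (proj₂ (shrink L 0≤L ½ (ℚ.positive⁻¹ ½)))))
      f : ℕ → ℚ
      f j = b L j * two^ j
      0≤f : ∀ j → 0ℚ ≤ f j
      0≤f j = 0≤p*q (0≤b 0≤L j) (0≤two^ j)
      C : ℚ
      C = ∑< (suc N) f
      small : ∀ j → j ℕ.≤ N → b L j ≤ C * half^ j
      small j j≤N = begin
        b L j                          ≡⟨ ℚ.*-identityʳ (b L j) ⟨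
        b L j * 1ℚ                     ≡⟨ cong (b L j *_) (two^*half^ j) ⟨
        b L j * (two^ j * half^ j)     ≡⟨ ℚ.*-assoc (b L j) (two^ j) (half^ j) ⟨
        f j * half^ j                  ≤⟨ *-monoʳ (0≤half^ j) (term≤∑< {suc N} {j} {f} 0≤f (s≤s j≤N)) ⟩
        C * half^ j                    ∎
      halving : ∀ j → N ℕ.≤ j → b L (suc j) ≤ ½ * b L j
      halving j N≤j = begin
        recip j * (b L j * L)          ≡⟨ solve 3 (λ r c L → r :* (c :* L) := (L :* r) :* c) refl (recip j) (b L j) L ⟩
        (L * recip j) * b L j          ≤⟨ *-monoʳ (0≤b 0≤L j) (ℚ.≤-trans (*-monoˡ 0≤L (ℚ.≤-trans (recip-antimono N≤j) recipN≤δ)) Lδ≤½) ⟩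
        ½ * b L j                      ∎
      large : ∀ k → b L (N ℕ.+ k) ≤ C * half^ (N ℕ.+ k)
      large zero    = small (N ℕ.+ 0) (ℕ.≤-reflexive (ℕ.+-identityʳ N))
      large (suc k) rewrite ℕ.+-suc N k = begin
        b L (suc (N ℕ.+ k))            ≤⟨ halving (N ℕ.+ k) (ℕ.m≤m+n N k) ⟩
        ½ * b L (N ℕ.+ k)              ≤⟨ *-monoˡ 0≤½ (large k) ⟩
        ½ * (C * half^ (N ℕ.+ k))      ≡⟨ solve 3 (λ a c h → a :* (c :* h) := c :* (a :* h)) refl ½ C (half^ (N ℕ.+ k)) ⟩
        C * (½ * half^ (N ℕ.+ k))      ∎
      bound : ∀ j → b L j ≤ C * half^ j
      bound j with ℕ.≤-total j N
      ... | inj₁ j≤N = small j j≤N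
      ... | inj₂ N≤j = subst (λ j → b L j ≤ C * half^ j) (ℕ.m+[n∸m]≡n N≤j) (large (j ℕ.∸ N))

    telescope : ∀ C h → C * h ≡ (1ℚ + 1ℚ) * C * h - (1ℚ + 1ℚ) * C * (½ * h)
    telescope = solve 2 (λ C h → C :* h := (con 1ℚ :+ con 1ℚ) :* C :* h :- (con 1ℚ :+ con 1ℚ) :* C :* (con ½ :* h)) refl

    sum-tail : ∀ {L C} z → 0ℚ ≤ L → ‖ z ‖ ≤ L → (∀ j → b L j ≤ C * half^ j) → ∀ n k →
      ‖ expSum z (n ℕ.+ k) ⊖ expSum z n ‖ ≤ (1ℚ + 1ℚ) * C * half^ n - (1ℚ + 1ℚ) * C * half^ (n ℕ.+ k)
    sum-tail {L} {C} z 0≤L hz hC n zero rewrite ℕ.+-identityʳ n =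
      ℚ.≤-reflexive (trans (‖z⊖z‖ (expSum z n)) (sym (ℚ.+-inverseʳ ((1ℚ + 1ℚ) * C * half^ n))))
    sum-tail {L} {C} z 0≤L hz hC n (suc k) rewrite ℕ.+-suc n k = begin
      ‖ (S ⊕ T) ⊖ expSum z n ‖                  ≡⟨ cong ‖_‖ (⊕⊖′ S T (expSum z n)) ⟩
      ‖ (S ⊖ expSum z n) ⊕ T ‖                  ≤⟨ ‖⊕‖ (S ⊖ expSum z n) T ⟩
      ‖ S ⊖ expSum z n ‖ + ‖ T ‖                ≤⟨ ℚ.+-mono-≤ (sum-tail {L} {C} z 0≤L hz hC n k) (ℚ.≤-trans (term-bound z 0≤L hz m) (hC m)) ⟩
      (D * half^ n - D * half^ m) + C * half^ m ≡⟨ cong (λ t → (D * half^ n - D * half^ m) + t) (telescope C (half^ m)) ⟩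
      (D * half^ n - D * half^ m) + (D * half^ m - D * (½ * half^ m)) ≡⟨ solve 3 (λ x y z → (x :- y) :+ (y :- z) := x :- z) refl (D * half^ n) (D * half^ m) (D * (½ * half^ m)) ⟩
      D * half^ n - D * (½ * half^ m)           ∎
      where
      m : ℕ
      m = n ℕ.+ k
      D : ℚ
      D = (1ℚ + 1ℚ) * C
      S T : ℚ[i]
      S = expSum z m
      T = expTerm z m

    sum-lipschitz : ∀ {L C} z w → 0ℚ ≤ L → ‖ z ‖ + 1ℚ ≤ L → ‖ w ‖ ≤ L → (∀ j → b L j ≤ C * half^ j) → ∀ n →
      ‖ expSum z n ⊖ expSum w n ‖ ≤ ‖ z ⊖ w ‖ * ((1ℚ + 1ℚ) * C - (1ℚ + 1ℚ) * C * half^ n)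
    sum-lipschitz {L} {C} z w 0≤L hz hw hC zero = ℚ.≤-reflexive
      (sym (solve 2 (λ d C → d :* ((con 1ℚ :+ con 1ℚ) :* C :- (con 1ℚ :+ con 1ℚ) :* C :* con 1ℚ) := con 0ℚ) refl (‖ z ⊖ w ‖) C))
    sum-lipschitz {L} {C} z w 0≤L hz hw hC (suc n) = begin
      ‖ (expSum z n ⊕ expTerm z n) ⊖ (expSum w n ⊕ expTerm w n) ‖     ≡⟨ cong ‖_‖ (⊕⊖ (expSum z n) (expTerm z n) (expSum w n) (expTerm w n)) ⟩
      ‖ (expSum z n ⊖ expSum w n) ⊕ (expTerm z n ⊖ expTerm w n) ‖     ≤⟨ ‖⊕‖ (expSum z n ⊖ expSum w n) (expTerm z n ⊖ expTerm w n) ⟩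
      ‖ expSum z n ⊖ expSum w n ‖ + ‖ expTerm z n ⊖ expTerm w n ‖     ≤⟨ ℚ.+-mono-≤ (sum-lipschitz {L} {C} z w 0≤L hz hw hC n)
                                                                          (ℚ.≤-trans (term-lipschitz z w 0≤L hz hw n) (*-monoˡ (0≤‖‖ (z ⊖ w)) (hC n))) ⟩
      d * (D - D * half^ n) + d * (C * half^ n)                       ≡⟨ cong (λ t → d * (D - D * half^ n) + d * t) (telescope C (half^ n)) ⟩
      d * (D - D * half^ n) + d * (D * half^ n - D * (½ * half^ n))   ≡⟨ solve 4 (λ d D x y → d :* (D :- x) :+ d :* (x :- y) := d :* (D :- y)) refl d D (D * half^ n) (D * (½ * half^ n)) ⟩
      d * (D - D * (½ * half^ n))                                     ∎
      where
      d D : ℚ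
      d = ‖ z ⊖ w ‖
      D = (1ℚ + 1ℚ) * C

    drop-nonNeg : ∀ {p q} → 0ℚ ≤ q → p - q ≤ p
    drop-nonNeg {p} {q} h = ℚ.≤-trans (ℚ.+-monoʳ-≤ p (ℚ.neg-antimono-≤ h)) (ℚ.≤-reflexive (ℚ.+-identityʳ p))

    expSeq-close : ∀ z → ∃[ K ] 0ℚ ≤ K × (∀ δ → 0ℚ < δ → ∃[ N ] (∀ m n → N ℕ.≤ m → N ℕ.≤ n → m ℕ.≤ n →
      ‖ expSeq z m ⊖ expSeq z n ‖ ≤ K * δ))
    expSeq-close z with bounded {seq (re z)} (cauchy (re z)) | bounded {seq (im z)} (cauchy (im z))
    ... | A , 0≤A , hA | B , 0≤B , hB with geometric ((A + B) + 1ℚ) (0≤p+q (0≤p+q 0≤A 0≤B) 0≤1)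
    ... | C , 0≤C , hC = D * three , 0≤p*q 0≤D (0≤p+q (0≤p+q 0≤1 0≤1) 0≤1) , close
      where
      three D L : ℚ
      three = (1ℚ + 1ℚ) + 1ℚ
      D = (1ℚ + 1ℚ) * C
      L = (A + B) + 1ℚ
      0≤D : 0ℚ ≤ D
      0≤D = 0≤p*q (0≤p+q 0≤1 0≤1) 0≤C
      0≤L : 0ℚ ≤ L
      0≤L = 0≤p+q (0≤p+q 0≤A 0≤B) 0≤1
      s : ℕ → ℚ[i]
      s n = seq (re z) n , seq (im z) n
      hs+1 : ∀ n → ‖ s n ‖ + 1ℚ ≤ L
      hs+1 n = ℚ.+-monoˡ-≤ 1ℚ (ℚ.+-mono-≤ (hA n) (hB n))
      hs : ∀ n → ‖ s n ‖ ≤ L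
      hs n = ℚ.≤-trans (p≤p+q 0≤1) (hs+1 n)
      close : ∀ δ → 0ℚ < δ → ∃[ N ] (∀ m n → N ℕ.≤ m → N ℕ.≤ n → m ℕ.≤ n → ‖ expSeq z m ⊖ expSeq z n ‖ ≤ D * three * δ)
      close δ 0<δ with common {seq (re z)} {seq (im z)} (cauchy (re z)) (cauchy (im z)) δ 0<δ | archimedean δ 0<δ
      ... | N₁ , h₁ | N₂ , h₂ = N₁ ℕ.⊔ N₂ , λ m n N≤m N≤n m≤n →
        let N₁≤m = ℕ.m⊔n≤o⇒m≤o N₁ N₂ N≤m
            N₂≤m = ℕ.m⊔n≤o⇒n≤o N₁ N₂ N≤m
            N₁≤n = ℕ.m⊔n≤o⇒m≤o N₁ N₂ N≤n
            dx , dy = h₁ m n N₁≤m N₁≤n in begin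
        ‖ expSum (s m) m ⊖ expSum (s n) n ‖
          ≤⟨ triangle (expSum (s m) m) (expSum (s n) m) (expSum (s n) n) ⟩
        ‖ expSum (s m) m ⊖ expSum (s n) m ‖ + ‖ expSum (s n) m ⊖ expSum (s n) n ‖
          ≤⟨ ℚ.+-mono-≤
               (ℚ.≤-trans (sum-lipschitz {L} {C} (s m) (s n) 0≤L (hs+1 m) (hs n) hC m)
                 (*-mono {‖ s m ⊖ s n ‖} {δ + δ} (0≤‖‖ (s m ⊖ s n)) 0≤D (ℚ.+-mono-≤ dx dy) (drop-nonNeg (0≤p*q 0≤D (0≤half^ m)))))
               (tail-bound m n m≤n N₂≤m) ⟩
        (δ + δ) * D + D * δ
          ≡⟨ solve 2 (λ d D → (d :+ d) :* D :+ D :* d := D :* ((con 1ℚ :+ con 1ℚ) :+ con 1ℚ) :* d) refl δ D ⟩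
        D * three * δ ∎
        where
        tail-bound : ∀ m n → m ℕ.≤ n → N₂ ℕ.≤ m → ‖ expSum (s n) m ⊖ expSum (s n) n ‖ ≤ D * δ
        tail-bound m n m≤n N₂≤m = begin
          ‖ expSum (s n) m ⊖ expSum (s n) n ‖                  ≡⟨ ‖⊖‖-sym (expSum (s n) m) (expSum (s n) n) ⟩
          ‖ expSum (s n) n ⊖ expSum (s n) m ‖                  ≡⟨ cong (λ t → ‖ expSum (s n) t ⊖ expSum (s n) m ‖) (ℕ.m+[n∸m]≡n m≤n) ⟨
          ‖ expSum (s n) (m ℕ.+ (n ℕ.∸ m)) ⊖ expSum (s n) m ‖  ≤⟨ sum-tail {L} {C} (s n) 0≤L (hs n) hC m (n ℕ.∸ m) ⟩
          D * half^ m - D * half^ (m ℕ.+ (n ℕ.∸ m))            ≤⟨ drop-nonNeg (0≤p*q 0≤D (0≤half^ (m ℕ.+ (n ℕ.∸ m)))) ⟩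
          D * half^ m                                          ≤⟨ *-monoˡ 0≤D (ℚ.≤-trans (half^≤recip m) (ℚ.≤-trans (recip-antimono N₂≤m) h₂)) ⟩
          D * δ                                                ∎

    exp-re-cauchy : ∀ z → Cauchy (λ n → proj₁ (expSeq z n))
    exp-re-cauchy z = let K , 0≤K , h = expSeq-close z in
      fromScaled {λ n → proj₁ (expSeq z n)} K 0≤K λ δ 0<δ → let N , est = h δ 0<δ in
      N , λ m n N≤m N≤n m≤n → ℚ.≤-trans (p≤p+q (ℚ.0≤∣p∣ (proj₂ (expSeq z m) - proj₂ (expSeq z n)))) (est m n N≤m N≤n m≤n)

    exp-im-cauchy : ∀ z → Cauchy (λ n → proj₂ (expSeq z n))
    exp-im-cauchy z = let K , 0≤K , h = expSeq-close z in
      fromScaled {λ n → proj₂ (expSeq z n)} K 0≤K λ δ 0<δ → let N , est = h δ 0<δ in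
      N , λ m n N≤m N≤n m≤n → ℚ.≤-trans (p≤q+p (ℚ.0≤∣p∣ (proj₁ (expSeq z m) - proj₁ (expSeq z n)))) (est m n N≤m N≤n m≤n)

exp : ℂ → ℂ
exp z = mkℂ (mkℝ (λ n → proj₁ (expSeq z n)) (ExpLemmas.exp-re-cauchy z))
            (mkℝ (λ n → proj₂ (expSeq z n)) (ExpLemmas.exp-im-cauchy z))

-- n ^- s is n⁻ˢ for a positive integer n
infix 9 _^-_

_^-_ : ℕ → ℂ → ℂ
n ^- s = exp (-ᶜ (s *ᶜ fromℝ (log n)))

∑ᶜ : List ℂ → ℂ
∑ᶜ = List.foldr _+ᶜ_ 0ᶜ

-- ∏ᶜ l f = f 0 * ⋯ * f (l - 1)
∏ᶜ : ℕ → (ℕ → ℂ) → ℂ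
∏ᶜ zero    f = 1ᶜ
∏ᶜ (suc l) f = ∏ᶜ l f *ᶜ f l

-- The sum of f over the set {a | P a} converges unconditionally to z: the
-- finite partial sums converge along the finite subsets of {a | P a},
-- here given by duplicate-free lists.  The limit is unique up to _≈ᶜ_.
-- |∑ - z| < ε is stated through squares, as |∑ - z|² < ε².
HasSum : {A : Set} → (A → Set) → (A → ℂ) → ℂ → Set
HasSum {A} P f z = ∀ ε → 0ℚ ℚ.< ε →
  ∃[ xs ] Unique xs × All P xs ×
    (∀ (ys : List A) → Unique ys → All P ys → xs ⊆ ys →
      ∣ ∑ᶜ (List.map f ys) +ᶜ -ᶜ z ∣² <ᴿ fromℚ (ε ℚ.* ε))

Positive : ℕ → Set
Positive n = 0 ℕ.< n

-- ζ(s) = z, for Re s > 1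
Isζ : ℂ → ℂ → Set
Isζ s = HasSum Positive (λ n → n ^- s)

-- ord_p n = e
Ord : ℕ → ℕ → ℕ → Set
Ord p n e = p ℕ.^ e ℕ.∣ n × ¬ (p ℕ.^ suc e ℕ.∣ n)

StepPowerful : (k l : ℕ) → ℕ → Set
StepPowerful k l n = Positive n ×
  (∀ p → Prime p → ∀ e → Ord p n e → (∃[ i ] i ℕ.< l × e ≡ i ℕ.* k) ⊎ l ℕ.* k ℕ.≤ e)

-- F_{k,l}(s) = z
IsF : (k l : ℕ) → ℂ → ℂ → Set
IsF k l s = HasSum (StepPowerful k l) (λ n → n ^- s)

-- The tuple (n₁,…,n_l,n_{l+1}) is represented by ((n₁,…,n_l) , n_{l+1}).
Tuple : ℕ → Set
Tuple l = Vec ℕ l × ℕ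

-- (n₁ᵏ,…,n_lᵏ,n_{l+1})
entries : ∀ k {l} → Tuple l → Vec ℕ (suc l)
entries k (ns , n) = Vec.map (ℕ._^ k) ns ∷ʳ n

DivisorChain : ∀ k {l} → Tuple l → Set
DivisorChain k t@(ns , n) = VecAll Positive ns × Positive n × Linked (λ a b → b ℕ.∣ a) (entries k t)

-- ∑ (n₁ᵏ⋯n_lᵏ n_{l+1})⁻ˢ = z over the chains n_{l+1} ∣ n_lᵏ ∣ ⋯ ∣ n₁ᵏ
IsChainSum : (k l : ℕ) → ℂ → ℂ → Set
IsChainSum k l s = HasSum (DivisorChain k {l}) (λ t → product (toList (entries k t)) ^- s)

{-# OPTIONS --safe #-}
module Submission where

-- For a chain put C = ∏ p^⌈ord_p n_{l+1} / k⌉, the least number whose k-th power n_{l+1} divides. Then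
-- n_l = m_l C and n_i = m_i n_{i+1} with arbitrary quotients m_i ≥ 1, and the product of the chain is
-- m₁ᵏ m₂²ᵏ ⋯ m_lˡᵏ · Cˡᵏ n_{l+1}. Prime by prime, the pairs (m₁ , n_{l+1}) are in bijection with the
-- pairs (g , M) of an l-step k-powerful g and an M ≥ 1, such that m₁ᵏ Cˡᵏ n_{l+1} = g M^{(l+1)k}. So the
-- chains correspond to the tuples (g , m₂ , … , m_l , M), and the series is the product of the series
-- over the single coordinates, by multiplicativity of n⁻ˢ and absolute convergence.
--
-- Absolute convergence is obtained with rational majorants. As e^x ≥ 1 + x and log (n+1) - log n ≥
-- 1/(n+1), |n⁻ˢ| is at most a constant times β_n = ∏_{i=2}^n (1 + q/i)⁻¹ if Re s ≥ q = 1 + ε; and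
-- (n+1) β_n - (n+2) β_{n+1} = ε β_{n+1}, so the sum of the β_n telescopes. Its tails tend to 0 because
-- the harmonic series diverges.

open import Defs
open import Data.Nat as ℕ using (ℕ; zero; suc; z≤n; s≤s; NonZero)
import Data.Nat.Properties as ℕ
open import Data.Nat.ListAction using (product)
open import Data.Nat.Primality
open import Data.Nat.Primality.Factorisation using (factorise; module PrimeFactorisation)
open import Data.Nat.Tactic.RingSolver using (solve-∀)
import Data.Integer as ℤ
open import Data.Rational as ℚ using (ℚ; 0ℚ; 1ℚ; ½; ∣_∣)
import Data.Rational.Properties as ℚ
import Data.Rational.Solver as ℚ
import Data.Rational.Unnormalised as ℚᵘ
import Data.Rational.Unnormalised.Properties as ℚᵘ
open import Data.Empty using (⊥-elim)
open import Data.List using (List; []; _∷_; _++_; map; filter; deduplicate; cartesianProduct; upTo; applyDownFrom)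
open import Data.List.Membership.Propositional using (_∈_; _∉_)
open import Data.List.Membership.Propositional.Properties
import Data.List.Membership.DecPropositional as DecMembership
open import Data.List.Relation.Binary.Permutation.Propositional as ↭ using (_↭_; prep; swap; ↭-refl; ↭-sym; ↭-trans; ↭-prep; ↭⇒↭ₛ)
open import Data.List.Relation.Binary.Permutation.Propositional.Properties using (shift; ∈-resp-↭)
import Data.List.Relation.Binary.Permutation.Setoid.Properties as Permutationₛ
open import Data.List.Relation.Binary.Subset.Propositional using (_⊆_)
open import Data.List.Relation.Unary.All as All using (All; []; _∷_)
import Data.List.Relation.Unary.All.Properties as All
open import Data.List.Relation.Unary.AllPairs using ([]; _∷_)
open import Data.List.Relation.Unary.Any using (here; there)
open import Data.List.Relation.Unary.Unique.Propositional using (Unique)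
import Data.List.Relation.Unary.Unique.Propositional.Properties as Unique
import Data.List.Relation.Unary.Unique.DecPropositional.Properties as DecUnique
open import Data.Product using (_×_; _,_; ∃-syntax; Σ-syntax; proj₁; proj₂)
open import Data.Product.Properties using (≡-dec)
open import Data.Sum using (_⊎_; inj₁; inj₂)
open import Data.Unit using (⊤; tt)
import Data.Unit.Properties as Unit
open import Data.Vec using (Vec; []; _∷_; toList)
open import Data.Vec.Properties using (∷-injective)
open import Data.Vec.Relation.Unary.All using ([]; _∷_) renaming (All to VecAll)
open import Data.Vec.Relation.Unary.Linked using (Linked; [-]; _∷_)
open import Relation.Binary.PropositionalEquality
open import Algebra.Bundles using (CommutativeRing)
open import Algebra.Structures {A = ℚ[i]} _≡_ using (IsCommutativeRing)
import Algebra.Solver.Ring.Simple as Solver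
import Algebra.Solver.Ring.AlmostCommutativeRing as ACR
open import Function using (_∘_; id)
open import Relation.Binary using (DecidableEquality)
open import Relation.Binary.Definitions using (tri<; tri≈; tri>)
open import Relation.Nullary
import Relation.Unary as Unary

-- The limits belong to the conclusion, so they have to be constructed. Bounded partial sums have no
-- limit constructively; hence `SmallTail` names, for each tolerance, a finite list outside which
-- the majorant adds little, and the divergence of the harmonic series is used with its rate H(2^j)
-- ≥ j/2. Listing the support requires a decidable index set, whence `stepPowerful?`.
--
-- A real is a Cauchy sequence of rationals with a setoid equality. Estimates are made on the `m`-th
-- approximants, for all `m` from some index on (`Eventually`), and equality of limits becomes
-- `_≋_`, a null difference of sequences.
--
-- A product of series needs majorants (`AbsSum`), a change of index only unconditional convergence
-- (`Converges`). So the products are formed first, over nested pairs, and the bijection with the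
-- chains is applied once, at the end.
--
-- In the product of a chain the quotients m₂, ... , m_l already carry the exponents 2k, ... , lk of
-- the wanted zeta factors and stay as they are. Only m₁, with exponent k, and the last entry with
-- its power of C have to be regrouped, into g and M.

module Valuation where

  -- Prime exponents, and numbers with prescribed exponents

  open import Data.Nat
  open import Data.Nat.Properties
  open import Data.Nat.Divisibility
  positive⇒nonZero : ∀ {n} → Positive n → NonZero n
  positive⇒nonZero = >-nonZero

  prime>1 : ∀ {p} → Prime p → 1 < p
  prime>1 pr = nonTrivial⇒n>1 _ {{prime⇒nonTrivial pr}}

  *-positive : ∀ {a b} → Positive a → Positive b → Positive (a * b)
  *-positive = *-mono-≤

  ^-positive : ∀ {a} e → Positive a → Positive (a ^ e)
  ^-positive {a} e 0<a = m^n>0 a {{positive⇒nonZero 0<a}} e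

  factor-positiveˡ : ∀ {a b} → Positive (a * b) → Positive a
  factor-positiveˡ {suc a} h = z<s

  factor-positiveʳ : ∀ {a b} → Positive (a * b) → Positive b
  factor-positiveʳ {a} {b} h = factor-positiveˡ {b} {a} (subst Positive (*-comm a b) h)

  n<p^n : ∀ {p} → 1 < p → ∀ n → n < p ^ n
  n<p^n 1<p zero = z<s
  n<p^n {p} 1<p (suc n) = <-≤-trans (s<s (n<p^n 1<p n)) (begin
    1 + p ^ n      ≤⟨ +-monoˡ-≤ (p ^ n) (≤-<-trans z≤n (n<p^n 1<p n)) ⟩
    p ^ n + p ^ n  ≡⟨ cong (p ^ n +_) (+-identityʳ (p ^ n)) ⟨
    2 * p ^ n      ≤⟨ *-monoˡ-≤ (p ^ n) 1<p ⟩
    p * p ^ n      ∎)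
    where open ≤-Reasoning

  maxExponent : ℕ → ℕ → ℕ → ℕ
  maxExponent p n zero = 0
  maxExponent p n (suc b) with p ^ suc b ∣? n
  ... | yes _ = suc b
  ... | no  _ = maxExponent p n b

  maxExponent-Ord : ∀ p n b → ¬ (p ^ suc b ∣ n) → Ord p n (maxExponent p n b)
  maxExponent-Ord p n zero    h = 1∣ n , h
  maxExponent-Ord p n (suc b) h with p ^ suc b ∣? n
  ... | yes d = d , h
  ... | no ¬d = maxExponent-Ord p n b ¬d

  -- The search may start at the exponent `n`: for a prime `p`, `p ^ suc n` exceeds the positive
  -- number `n` and cannot divide it.
  ord : ℕ → ℕ → ℕ
  ord p n = maxExponent p n n

  ord-Ord : ∀ {p n} → Prime p → Positive n → Ord p n (ord p n)
  ord-Ord {p} {n} pr 0<n = maxExponent-Ord p n n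
    (>⇒∤ {{positive⇒nonZero 0<n}} (<-trans (n<1+n n) (n<p^n (prime>1 pr) (suc n))))

  ^-mono-∣ : ∀ p {e f} → e ≤ f → p ^ e ∣ p ^ f
  ^-mono-∣ p {e} {f} e≤f = subst (p ^ e ∣_)
    (trans (sym (^-distribˡ-+-* p e (f ∸ e))) (cong (p ^_) (m+[n∸m]≡n e≤f))) (m∣m*n (p ^ (f ∸ e)))

  Ord-unique : ∀ {p n e f} → Ord p n e → Ord p n f → e ≡ f
  Ord-unique {p} {n} {e} {f} (d , ¬d) (d′ , ¬d′) with <-cmp e f
  ... | tri< e<f _ _ = contradiction (∣-trans (^-mono-∣ p e<f) d′) ¬d
  ... | tri≈ _ e≡f _ = e≡f
  ... | tri> _ _ f<e = contradiction (∣-trans (^-mono-∣ p f<e) d) ¬d′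

  Ord⇒≡ord : ∀ {p n e} → Prime p → Positive n → Ord p n e → ord p n ≡ e
  Ord⇒≡ord {p} {n} {e} pr 0<n = Ord-unique {p} {n} {ord p n} {e} (ord-Ord pr 0<n)

  -- If `p` occurred once more, cancelling `p ^ (e + f)` would leave `p` dividing the product of the
  -- two cofactors, and by Euclid's lemma one of them.
  Ord-* : ∀ {p a b e f} → Prime p → Ord p a e → Ord p b f → Ord p (a * b) (e + f)
  Ord-* {p} {a} {b} {e} {f} pr (divides x refl , ¬d) (divides y refl , ¬d′) = divides (x * y) eq , ¬div
    where
    instance
      _ : NonZero p
      _ = prime⇒nonZero pr
      _ : NonZero (p ^ (e + f))
      _ = m^n≢0 p (e + f)
    eq : x * p ^ e * (y * p ^ f) ≡ x * y * p ^ (e + f)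
    eq = trans ([m*n]*[o*p]≡[m*o]*[n*p] x (p ^ e) y (p ^ f)) (cong (x * y *_) (sym (^-distribˡ-+-* p e f)))
    ¬div : ¬ (p ^ suc (e + f) ∣ x * p ^ e * (y * p ^ f))
    ¬div d″ with euclidsLemma x y pr (*-cancelʳ-∣ (p ^ (e + f)) (subst (p * p ^ (e + f) ∣_) eq d″))
    ... | inj₁ p∣x = ¬d (*-monoˡ-∣ (p ^ e) p∣x)
    ... | inj₂ p∣y = ¬d′ (*-monoˡ-∣ (p ^ f) p∣y)

  ord-* : ∀ {p a b} → Prime p → Positive a → Positive b → ord p (a * b) ≡ ord p a + ord p b
  ord-* {p} {a} {b} pr 0<a 0<b = Ord⇒≡ord pr (*-positive 0<a 0<b) (Ord-* {p} {a} {b} {ord p a} {ord p b} pr (ord-Ord pr 0<a) (ord-Ord pr 0<b))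

  ∤⇒ord≡0 : ∀ {p n} → Prime p → Positive n → ¬ (p ∣ n) → ord p n ≡ 0
  ∤⇒ord≡0 {p} {n} pr 0<n p∤n = Ord⇒≡ord pr 0<n (1∣ n , p∤n ∘ subst (_∣ n) (*-identityʳ p))

  ord-1 : ∀ {p} → Prime p → ord p 1 ≡ 0
  ord-1 pr = ∤⇒ord≡0 pr z<s (>⇒∤ (prime>1 pr))

  ord-^ : ∀ {p a} → Prime p → Positive a → ∀ e → ord p (a ^ e) ≡ e * ord p a
  ord-^ pr 0<a zero    = ord-1 pr
  ord-^ {p} {a} pr 0<a (suc e) = trans (ord-* pr 0<a (^-positive e 0<a)) (cong (ord p a +_) (ord-^ pr 0<a e))

  prime⇒positive : ∀ {p} → Prime p → Positive p
  prime⇒positive = <-trans z<s ∘ prime>1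

  ord-self : ∀ {p} → Prime p → ord p p ≡ 1
  ord-self {p} pr = Ord⇒≡ord pr (prime⇒positive pr)
    (∣-reflexive (*-identityʳ p) , >⇒∤ {{prime⇒nonZero pr}} (begin-strict
      p            ≡⟨ ^-identityʳ p ⟨
      p ^ 1        <⟨ ^-monoʳ-< p (prime>1 pr) (n<1+n 1) ⟩
      p ^ 2        ∎))
    where open ≤-Reasoning

  ord-other : ∀ {p q} → Prime p → Prime q → q ≢ p → ord q p ≡ 0
  ord-other pp pq q≢p = ∤⇒ord≡0 pq (prime⇒positive pp) λ q∣p → case (prime⇒irreducible pp q∣p)
    where
    case : _ → _
    case (inj₁ refl) = ¬prime[1] pq
    case (inj₂ q≡p)  = q≢p q≡p

  ∣⇒ord≤ : ∀ {p a b} → Prime p → Positive b → a ∣ b → ord p a ≤ ord p b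
  ∣⇒ord≤ {p} {a} pr 0<b (divides q refl) = subst (ord p a ≤_)
    (sym (ord-* pr (factor-positiveˡ {q} 0<b) (factor-positiveʳ {q} 0<b))) (m≤n+m (ord p a) (ord p q))

  -- The head `p` has exponent at least 1 in `b`, so `b = q * p`. Removing `p` from both sides
  -- lowers the exponents at each prime by the same amount, and induction applies to `q`.
  product-∣ : ∀ {ps b} → All Prime ps → Positive b → (∀ {p} → Prime p → ord p (product ps) ≤ ord p b) → product ps ∣ b
  product-∣ [] 0<b h = 1∣ _
  product-∣ {p ∷ ps} {b} (pr ∷ prs) 0<b h = helper p∣b
    where
    0<ps : Positive (product ps)
    0<ps = productOfPrimes≥1 prs
    1≤ord : 1 ≤ ord p b
    1≤ord = ≤-trans (≤-trans (≤-reflexive (sym (ord-self pr))) (≤-trans (m≤m+n (ord p p) (ord p (product ps)))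
      (≤-reflexive (sym (ord-* pr (prime⇒positive pr) 0<ps))))) (h pr)
    p∣b : p ∣ b
    p∣b = ∣-trans (∣-reflexive (sym (^-identityʳ p))) (∣-trans (^-mono-∣ p 1≤ord) (proj₁ (ord-Ord pr 0<b)))
    helper : p ∣ b → p * product ps ∣ b
    helper (divides q refl) = subst (p * product ps ∣_) (*-comm p q) (*-monoʳ-∣ p (product-∣ prs 0<q λ {r} pr′ →
      +-cancelˡ-≤ (ord r p) _ _ (begin
        ord r p + ord r (product ps) ≡⟨ ord-* pr′ (prime⇒positive pr) 0<ps ⟨
        ord r (p * product ps)       ≤⟨ h pr′ ⟩
        ord r (q * p)                ≡⟨ cong (ord r) (*-comm q p) ⟩
        ord r (p * q)                ≡⟨ ord-* pr′ (prime⇒positive pr) 0<q ⟩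
        ord r p + ord r q            ∎)))
      where
      open ≤-Reasoning
      0<q : Positive q
      0<q = factor-positiveˡ {q} 0<b

  ord≤⇒∣ : ∀ {a b} → Positive a → Positive b → (∀ {p} → Prime p → ord p a ≤ ord p b) → a ∣ b
  ord≤⇒∣ {a} {b} 0<a 0<b h = subst (_∣ b) (sym isFactorisation)
    (product-∣ factorsPrime 0<b (λ {p} pr → subst (λ t → ord p t ≤ ord p b) isFactorisation (h pr)))
    where open PrimeFactorisation (factorise a {{positive⇒nonZero 0<a}})

  ord-injective : ∀ {a b} → Positive a → Positive b → (∀ {p} → Prime p → ord p a ≡ ord p b) → a ≡ b
  ord-injective 0<a 0<b h = ∣-antisym (ord≤⇒∣ 0<a 0<b (≤-reflexive ∘ h)) (ord≤⇒∣ 0<b 0<a (≤-reflexive ∘ sym ∘ h))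

  primePower : (ℕ → ℕ) → ℕ → ℕ
  primePower f p with prime? p
  ... | yes _ = p ^ f p
  ... | no  _ = 1

  fromOrds : (ℕ → ℕ) → ℕ → ℕ
  fromOrds f zero    = 1
  fromOrds f (suc N) = primePower f N * fromOrds f N

  primePower-positive : ∀ f p → Positive (primePower f p)
  primePower-positive f p with prime? p
  ... | yes pr = ^-positive (f p) (prime⇒positive pr)
  ... | no  _  = z<s

  fromOrds-positive : ∀ f N → Positive (fromOrds f N)
  fromOrds-positive f zero    = z<s
  fromOrds-positive f (suc N) = *-positive (primePower-positive f N) (fromOrds-positive f N)

  ord-primePower-self : ∀ {q} f → Prime q → ord q (primePower f q) ≡ f q
  ord-primePower-self {q} f pq with prime? q
  ... | yes _  = trans (ord-^ pq (prime⇒positive pq) (f q)) (trans (cong (f q *_) (ord-self pq)) (*-identityʳ (f q)))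
  ... | no ¬pq = contradiction pq ¬pq

  ord-primePower-other : ∀ {q} f p → Prime q → q ≢ p → ord q (primePower f p) ≡ 0
  ord-primePower-other f p pq q≢p with prime? p
  ... | yes pp = trans (ord-^ pq (prime⇒positive pp) (f p)) (trans (cong (f p *_) (ord-other pp pq q≢p)) (*-zeroʳ (f p)))
  ... | no  _  = ord-1 pq

  ord-fromOrds-≥ : ∀ {q} f N → Prime q → N ≤ q → ord q (fromOrds f N) ≡ 0
  ord-fromOrds-≥ f zero    pq h = ord-1 pq
  ord-fromOrds-≥ f (suc N) pq h = trans (ord-* pq (primePower-positive f N) (fromOrds-positive f N))
    (cong₂ _+_ (ord-primePower-other f N pq (>⇒≢ h)) (ord-fromOrds-≥ f N pq (<⇒≤ h)))

  ord-fromOrds-< : ∀ {q} f N → Prime q → q < N → ord q (fromOrds f N) ≡ f q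
  ord-fromOrds-< {q} f (suc N) pq (s≤s q≤N) = trans (ord-* pq (primePower-positive f N) (fromOrds-positive f N)) (case (m≤n⇒m<n∨m≡n q≤N))
    where
    case : q < N ⊎ q ≡ N → ord q (primePower f N) + ord q (fromOrds f N) ≡ f q
    case (inj₁ q<N)  = cong₂ _+_ (ord-primePower-other f N pq (<⇒≢ q<N)) (ord-fromOrds-< f N pq q<N)
    case (inj₂ refl) = trans (cong₂ _+_ (ord-primePower-self f pq) (ord-fromOrds-≥ f N pq ≤-refl)) (+-identityʳ (f q))

  -- The product stops at p = a + b, so its exponent at p is φ (ord p a) (ord p b) for all p only if φ 0 0 = 0.
  primewise : (ℕ → ℕ → ℕ) → ℕ → ℕ → ℕ
  primewise φ a b = fromOrds (λ p → φ (ord p a) (ord p b)) (suc (a + b))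

  primewise-positive : ∀ φ a b → Positive (primewise φ a b)
  primewise-positive φ a b = fromOrds-positive _ (suc (a + b))

  ord->≡0 : ∀ {p n} → Prime p → Positive n → n < p → ord p n ≡ 0
  ord->≡0 pr 0<n n<p = ∤⇒ord≡0 pr 0<n (>⇒∤ {{positive⇒nonZero 0<n}} n<p)

  ord-primewise : ∀ φ → φ 0 0 ≡ 0 → ∀ {a b p} → Positive a → Positive b → Prime p →
    ord p (primewise φ a b) ≡ φ (ord p a) (ord p b)
  ord-primewise φ φ00 {a} {b} {p} 0<a 0<b pr with p <? suc (a + b)
  ... | yes p<N = ord-fromOrds-< _ (suc (a + b)) pr p<N
  ... | no  p≮N = trans (ord-fromOrds-≥ _ (suc (a + b)) pr N≤p)
      (sym (trans (cong₂ φ (ord->≡0 pr 0<a (≤-trans (s≤s (m≤m+n a b)) N≤p)) (ord->≡0 pr 0<b (≤-trans (s≤s (m≤n+m b a)) N≤p))) φ00))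
    where
    N≤p : suc (a + b) ≤ p
    N≤p = ≮⇒≥ p≮N

-- The bijection between pairs (m₁ , n) and pairs (g , M), prime by prime

module Combinatorics where
  open import Data.Nat
  open import Data.Nat.Properties
  open import Data.Nat.Divisibility
  open import Data.Nat.DivMod
  open Valuation

  [r+q*n]%n≡r : ∀ {n r} q .{{_ : NonZero n}} → r < n → (r + q * n) % n ≡ r
  [r+q*n]%n≡r {n} {r} q r<n = trans ([m+kn]%n≡m%n r q n) (m<n⇒m%n≡m r<n)

  [r+q*n]/n≡q : ∀ {n r} q .{{_ : NonZero n}} → r < n → (r + q * n) / n ≡ q
  [r+q*n]/n≡q {n} {r} q r<n = trans (+-distrib-/-∣ʳ r (n∣m*n q)) (cong₂ _+_ (m<n⇒m/n≡0 r<n) (m*n/n≡m q n))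

  module Exponents (k L : ℕ) .{{_ : NonZero k}} where

    StepExponent : ℕ → Set
    StepExponent e = (∃[ i ] i < L × e ≡ i * k) ⊎ L * k ≤ e

    stepExponent? : ∀ e → Dec (StepExponent e)
    stepExponent? e with L * k ≤? e
    ... | yes h = yes (inj₂ h)
    ... | no ¬h with anyUpTo? (λ i → e ≟ i * k) L
    ... | yes h  = yes (inj₁ h)
    ... | no ¬h′ = no λ { (inj₁ h) → ¬h′ h ; (inj₂ h) → ¬h h }

    ⌈_/k⌉ : ℕ → ℕ
    ⌈ zero  /k⌉ = 0
    ⌈ suc f /k⌉ = suc (f / k)

    -- With its converse below, this makes `⌈_/k⌉` left adjoint to multiplication by `k`. Prime by
    -- prime it becomes: `n ∣ x ^ k` exactly when `root⌈ n ⌉ ∣ x`.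
    ≤*k⇒⌈/k⌉≤ : ∀ f {e} → f ≤ e * k → ⌈ f /k⌉ ≤ e
    ≤*k⇒⌈/k⌉≤ zero    h = z≤n
    ≤*k⇒⌈/k⌉≤ (suc f) {e} h = m<n*o⇒m/o<n {f} {e} {k} h

    ⌈/k⌉≤⇒≤*k : ∀ f {e} → ⌈ f /k⌉ ≤ e → f ≤ e * k
    ⌈/k⌉≤⇒≤*k zero    h = z≤n
    ⌈/k⌉≤⇒≤*k (suc f) {e} h = begin-strict
      f                    ≡⟨ m≡m%n+[m/n]*n f k ⟩
      f % k + f / k * k    <⟨ +-monoˡ-< (f / k * k) (m%n<n f k) ⟩
      suc (f / k) * k      ≤⟨ *-monoˡ-≤ k h ⟩
      e * k                ∎
      where open ≤-Reasoning

    -- At a prime p, the exponents d of m₁ and f of the last entry contribute d k + L k ⌈f/k⌉ + f to the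
    -- exponent of the product. For exactly one admissible (g , M) this is g + (L + 1) k M: f = 0 gives the
    -- multiples g ≤ L k of k, and f > 0 gives g > L k.
    split join : ℕ → ℕ → ℕ × ℕ
    split g M with g ≤? L * k
    ... | yes _ = g / k + M * suc L , 0
    ... | no  _ = (g ∸ suc (L * k)) / k , suc ((g ∸ suc (L * k)) % k + M * k)
    join d zero    = d % suc L * k , d / suc L
    join d (suc f) = suc (L * k + (f % k + d * k)) , f / k

    -- `ord-primewise` asks for this value, which occurs at the primes dividing neither argument.
    split-0 : split 0 0 ≡ (0 , 0)
    split-0 with 0 ≤? L * k
    ... | yes _ = cong (λ t → t + 0 , 0) (0/n≡0 k)
    ... | no ¬h = contradiction z≤n ¬h

    stepExponent-join : ∀ d f → StepExponent (proj₁ (join d f))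
    stepExponent-join d (suc f) = inj₂ (≤-trans (m≤m+n (L * k) _) (n≤1+n _))
    stepExponent-join d zero with m≤n⇒m<n∨m≡n (≤-pred (m%n<n d (suc L)))
    ... | inj₁ i<L = inj₁ (d % suc L , i<L , refl)
    ... | inj₂ i≡L = inj₂ (≤-reflexive (cong (_* k) (sym i≡L)))

    -- At `e = L * k` the two kinds of admissible exponents meet. Counting it, there are `L + 1`
    -- multiples of `k` up to `L * k`, which is why `split` and `join` work modulo `suc L`.
    stepExponent-≤ : ∀ {e} → StepExponent e → e ≤ L * k → ∃[ i ] i < suc L × e ≡ i * k
    stepExponent-≤ (inj₁ (i , i<L , eq)) _ = i , m<n⇒m<1+n i<L , eq
    stepExponent-≤ (inj₂ h) h′ = L , ≤-refl , ≤-antisym h′ h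

    -- Uniqueness of division with remainder. If `g = i * k` with `i ≤ L`, then `i` and `M` are
    -- remainder and quotient of `i + M * suc L` by `suc L`. Otherwise `M` and the remainder of
    -- `g - L k - 1` by `k` are read off from the exponent of the last entry, and the quotient from
    -- that of m₁.
    join-split : ∀ {g} M → StepExponent g → join (proj₁ (split g M)) (proj₂ (split g M)) ≡ (g , M)
    join-split {g} M step with g ≤? L * k
    ... | no g≰Lk = cong₂ _,_
        (begin
          suc (L * k + ((t % k + M * k) % k + t / k * k)) ≡⟨ cong (λ r → suc (L * k + (r + t / k * k))) ([r+q*n]%n≡r M (m%n<n t k)) ⟩
          suc (L * k + (t % k + t / k * k))               ≡⟨ cong (λ r → suc (L * k + r)) (m≡m%n+[m/n]*n t k) ⟨
          suc (L * k) + t                                 ≡⟨ m+[n∸m]≡n (≰⇒> g≰Lk) ⟩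
          g                                               ∎)
        ([r+q*n]/n≡q M (m%n<n t k))
      where
      open ≡-Reasoning
      t : ℕ
      t = g ∸ suc (L * k)
    ... | yes g≤Lk with stepExponent-≤ step g≤Lk
    ... | i , i≤L , refl = cong₂ _,_
        (cong (_* k) (trans (cong (λ t → (t + M * suc L) % suc L) (m*n/n≡m i k)) ([r+q*n]%n≡r M i≤L)))
        (trans (cong (λ t → (t + M * suc L) / suc L) (m*n/n≡m i k)) ([r+q*n]/n≡q M i≤L))

    split-join : ∀ d f → split (proj₁ (join d f)) (proj₂ (join d f)) ≡ (d , f)
    split-join d zero with d % suc L * k ≤? L * k
    ... | yes _ = cong (_, 0) (trans (cong (_+ d / suc L * suc L) (m*n/n≡m (d % suc L) k)) (sym (m≡m%n+[m/n]*n d (suc L))))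
    ... | no ¬h = contradiction (*-monoˡ-≤ k (≤-pred (m%n<n d (suc L)))) ¬h
    split-join d (suc f) with suc (L * k + (f % k + d * k)) ≤? L * k
    ... | yes h = contradiction (≤-trans (s≤s (m≤m+n (L * k) _)) h) 1+n≰n
    ... | no _ rewrite m+n∸m≡n (L * k) (f % k + d * k) | [r+q*n]/n≡q d (m%n<n f k) | [r+q*n]%n≡r d (m%n<n f k)
      = cong (λ t → d , suc t) (sym (m≡m%n+[m/n]*n f k))

    -- For exponent 0 at the last entry, write `d = i + (L + 1) M`. For exponent `suc f`, write
    -- `f = r + k M`: the ceiling is `M + 1`, so each unit of `M` counts `L k` through the root and
    -- `k` through `f`.
    join-weight : ∀ d f → k * d + (L * k * ⌈ f /k⌉ + f) ≡ proj₁ (join d f) + suc L * k * proj₂ (join d f)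
    join-weight d zero = begin
      k * d + (L * k * 0 + 0)                        ≡⟨ identity₁ k d L ⟩
      d * k                                          ≡⟨ cong (_* k) (m≡m%n+[m/n]*n d (suc L)) ⟩
      (d % suc L + d / suc L * suc L) * k            ≡⟨ identity₂ (d % suc L) (d / suc L) L k ⟩
      d % suc L * k + suc L * k * (d / suc L)        ∎
      where
      open ≡-Reasoning
      identity₁ : ∀ k d L → k * d + (L * k * 0 + 0) ≡ d * k
      identity₁ = solve-∀
      identity₂ : ∀ r q L k → (r + q * suc L) * k ≡ r * k + suc L * k * q
      identity₂ = solve-∀
    join-weight d (suc f) = begin
      k * d + (L * k * suc (f / k) + suc f)
        ≡⟨ cong (λ t → k * d + (L * k * suc (f / k) + suc t)) (m≡m%n+[m/n]*n f k) ⟩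
      k * d + (L * k * suc (f / k) + suc (f % k + f / k * k))
        ≡⟨ identity k d L (f % k) (f / k) ⟩
      suc (L * k + (f % k + d * k)) + suc L * k * (f / k)  ∎
      where
      open ≡-Reasoning
      identity : ∀ k d L r q → k * d + (L * k * suc q + suc (r + q * k)) ≡ suc (L * k + (r + d * k)) + suc L * k * q
      identity = solve-∀

    stepPowerful⇒ : ∀ {n} → StepPowerful k L n → ∀ {p} → Prime p → StepExponent (ord p n)
    stepPowerful⇒ {n} (0<n , h) {p} pr = h p pr (ord p n) (ord-Ord pr 0<n)

    ⇒stepPowerful : ∀ {n} → Positive n → (∀ {p} → Prime p → StepExponent (ord p n)) → StepPowerful k L n
    ⇒stepPowerful 0<n h = 0<n , λ p pr e o → subst StepExponent (Ord⇒≡ord pr 0<n o) (h pr)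

    stepPowerful? : 0 < L → ∀ n → Dec (StepPowerful k L n)
    stepPowerful? 0<L n with 0 <? n
    ... | no ¬0<n = no (¬0<n ∘ proj₁)
    ... | yes 0<n with allUpTo? check? (suc n)
      where
      check? : ∀ p → Dec (Prime p → StepExponent (ord p n))
      check? p with prime? p
      ... | no ¬pr = yes λ pr → contradiction pr ¬pr
      ... | yes pr with stepExponent? (ord p n)
      ... | yes h = yes λ _ → h
      ... | no ¬h = no λ f → ¬h (f pr)
    ... | no ¬h = no λ sp → ¬h λ _ pr → stepPowerful⇒ sp pr
    ... | yes h = yes (⇒stepPowerful 0<n all)
      where
      all : ∀ {p} → Prime p → StepExponent (ord p n)
      all {p} pr with p <? suc n
      ... | yes p≤n = h p≤n pr
      -- A prime above `n` has exponent `0 = 0 * k`, a multiple allowed because `L` is positive;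
      -- testing the primes up to `n` is therefore enough.
      ... | no  p≰n = inj₁ (0 , 0<L , ord->≡0 pr 0<n (≮⇒≥ p≰n))

    -- The number C of the overview; `n` is passed twice because `primewise` combines two numbers.
    root⌈_⌉ : ℕ → ℕ
    root⌈ n ⌉ = primewise (λ e _ → ⌈ e /k⌉) n n

    root-positive : ∀ n → Positive root⌈ n ⌉
    root-positive n = primewise-positive (λ e _ → ⌈ e /k⌉) n n

    ord-root : ∀ {n p} → Positive n → Prime p → ord p root⌈ n ⌉ ≡ ⌈ ord p n /k⌉
    ord-root 0<n = ord-primewise (λ e _ → ⌈ e /k⌉) refl 0<n 0<n

    ord-power : ∀ {x p} → Positive x → Prime p → ord p (x ^ k) ≡ ord p x * k
    ord-power {x} {p} 0<x pr = trans (ord-^ pr 0<x k) (*-comm k (ord p x))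

    root∣⇒∣^ : ∀ {n x} → Positive n → Positive x → root⌈ n ⌉ ∣ x → n ∣ x ^ k
    root∣⇒∣^ {n} 0<n 0<x d = ord≤⇒∣ 0<n (^-positive k 0<x) λ {p} pr →
      subst (ord p n ≤_) (sym (ord-power 0<x pr)) (⌈/k⌉≤⇒≤*k (ord p n) (subst (_≤ _) (ord-root 0<n pr) (∣⇒ord≤ pr 0<x d)))

    ∣^⇒root∣ : ∀ {n x} → Positive n → Positive x → n ∣ x ^ k → root⌈ n ⌉ ∣ x
    ∣^⇒root∣ {n} 0<n 0<x d = ord≤⇒∣ (root-positive n) 0<x λ {p} pr →
      subst (_≤ _) (sym (ord-root 0<n pr)) (≤*k⇒⌈/k⌉≤ (ord p n) (subst (ord p n ≤_) (ord-power 0<x pr) (∣⇒ord≤ pr (^-positive k 0<x) d)))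

    ^∣^⇒∣ : ∀ {x y} → Positive x → Positive y → y ^ k ∣ x ^ k → y ∣ x
    ^∣^⇒∣ {x} {y} 0<x 0<y d = ord≤⇒∣ 0<y 0<x λ {p} pr → *-cancelʳ-≤ _ _ k
      (subst₂ _≤_ (ord-power 0<y pr) (ord-power 0<x pr) (∣⇒ord≤ pr (^-positive k 0<x) d))

    ∣⇒^∣^ : ∀ {x y} → Positive x → Positive y → y ∣ x → y ^ k ∣ x ^ k
    ∣⇒^∣^ {x} {y} 0<x 0<y d = ord≤⇒∣ (^-positive k 0<y) (^-positive k 0<x) λ {p} pr →
      subst₂ _≤_ (sym (ord-power 0<y pr)) (sym (ord-power 0<x pr)) (*-monoˡ-≤ k (∣⇒ord≤ pr 0<x d))

    split₁ split₂ join₁ join₂ : ℕ → ℕ → ℕ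
    split₁ x y = proj₁ (split x y)
    split₂ x y = proj₂ (split x y)
    join₁ x y  = proj₁ (join x y)
    join₂ x y  = proj₂ (join x y)

    Split Join : ℕ × ℕ → ℕ × ℕ
    Split (g , M) = primewise split₁ g M , primewise split₂ g M
    Join (m , n)  = primewise join₁ m n , primewise join₂ m n

    Positive² : ℕ × ℕ → Set
    Positive² (a , b) = Positive a × Positive b

    ords : ℕ → ℕ × ℕ → ℕ × ℕ
    ords p (a , b) = ord p a , ord p b

    Split-positive : ∀ x → Positive² (Split x)
    Split-positive (g , M) = primewise-positive split₁ g M , primewise-positive split₂ g M

    Join-positive : ∀ x → Positive² (Join x)
    Join-positive (m , n) = primewise-positive join₁ m n , primewise-positive join₂ m n

    ords-Split : ∀ {x p} → Positive² x → Prime p → ords p (Split x) ≡ split (ord p (proj₁ x)) (ord p (proj₂ x))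
    ords-Split {x} {p} (0<g , 0<M) pr = cong₂ _,_ (ord-primewise split₁ (cong proj₁ split-0) 0<g 0<M pr) (ord-primewise split₂ (cong proj₂ split-0) 0<g 0<M pr)

    ords-Join : ∀ {x p} → Positive² x → Prime p → ords p (Join x) ≡ join (ord p (proj₁ x)) (ord p (proj₂ x))
    ords-Join {x} {p} (0<m , 0<n) pr = cong₂ _,_ (ord-primewise join₁ refl 0<m 0<n pr) (ord-primewise join₂ refl 0<m 0<n pr)

    ords-injective : ∀ {x y} → Positive² x → Positive² y → (∀ {p} → Prime p → ords p x ≡ ords p y) → x ≡ y
    ords-injective (0<a , 0<b) (0<c , 0<d) h = cong₂ _,_ (ord-injective 0<a 0<c (cong proj₁ ∘ h)) (ord-injective 0<b 0<d (cong proj₂ ∘ h))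

    Split-Join : ∀ {x} → Positive² x → Split (Join x) ≡ x
    Split-Join {x} 0<x = ords-injective (Split-positive (Join x)) 0<x λ {p} pr →
      trans (ords-Split (Join-positive x) pr)
        (trans (cong (λ y → split (proj₁ y) (proj₂ y)) (ords-Join 0<x pr)) (split-join (ord p (proj₁ x)) (ord p (proj₂ x))))

    Join-Split : ∀ {g M} → StepPowerful k L g → Positive M → Join (Split (g , M)) ≡ (g , M)
    Join-Split {g} {M} sp 0<M = ords-injective (Join-positive (Split (g , M))) 0<x λ {p} pr →
      trans (ords-Join (Split-positive (g , M)) pr)
        (trans (cong (λ y → join (proj₁ y) (proj₂ y)) (ords-Split 0<x pr)) (join-split (ord p M) (stepPowerful⇒ sp pr)))
      where
      0<x : Positive² (g , M)
      0<x = proj₁ sp , 0<M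

    Join-stepPowerful : ∀ {x} → Positive² x → StepPowerful k L (proj₁ (Join x))
    Join-stepPowerful {x} 0<x = ⇒stepPowerful (proj₁ (Join-positive x)) λ {p} pr →
      subst StepExponent (sym (cong proj₁ (ords-Join 0<x pr))) (stepExponent-join (ord p (proj₁ x)) (ord p (proj₂ x)))

    weight-Join : ∀ {m n} → Positive m → Positive n →
      m ^ k * (root⌈ n ⌉ ^ (L * k) * n) ≡ proj₁ (Join (m , n)) * proj₂ (Join (m , n)) ^ (suc L * k)
    weight-Join {m} {n} 0<m 0<n = ord-injective
      (*-positive 0<mᵏ (*-positive 0<rᴸᵏ 0<n)) (*-positive 0<g (^-positive (suc L * k) 0<M)) λ {p} pr → begin
        ord p (m ^ k * (root⌈ n ⌉ ^ (L * k) * n))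
          ≡⟨ ord-* pr 0<mᵏ (*-positive 0<rᴸᵏ 0<n) ⟩
        ord p (m ^ k) + ord p (root⌈ n ⌉ ^ (L * k) * n)
          ≡⟨ cong₂ _+_ (ord-^ pr 0<m k) (ord-* pr 0<rᴸᵏ 0<n) ⟩
        k * ord p m + (ord p (root⌈ n ⌉ ^ (L * k)) + ord p n)
          ≡⟨ cong (λ t → k * ord p m + (t + ord p n)) (trans (ord-^ pr (root-positive n) (L * k)) (cong (L * k *_) (ord-root 0<n pr))) ⟩
        k * ord p m + (L * k * ⌈ ord p n /k⌉ + ord p n)
          ≡⟨ join-weight (ord p m) (ord p n) ⟩
        proj₁ (join (ord p m) (ord p n)) + suc L * k * proj₂ (join (ord p m) (ord p n))
          ≡⟨ cong (λ y → proj₁ y + suc L * k * proj₂ y) (ords-Join (0<m , 0<n) pr) ⟨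
        ord p g + suc L * k * ord p M
          ≡⟨ cong (ord p g +_) (ord-^ pr 0<M (suc L * k)) ⟨
        ord p g + ord p (M ^ (suc L * k))
          ≡⟨ ord-* pr 0<g (^-positive (suc L * k) 0<M) ⟨
        ord p (g * M ^ (suc L * k)) ∎
      where
      open ≡-Reasoning
      g M : ℕ
      g = proj₁ (Join (m , n))
      M = proj₂ (Join (m , n))
      0<g : Positive g
      0<g = proj₁ (Join-positive (m , n))
      0<M : Positive M
      0<M = proj₂ (Join-positive (m , n))
      0<mᵏ : Positive (m ^ k)
      0<mᵏ = ^-positive k 0<m
      0<rᴸᵏ : Positive (root⌈ n ⌉ ^ (L * k))
      0<rᴸᵏ = ^-positive (L * k) (root-positive n)

    weight-Split : ∀ {g M} → StepPowerful k L g → Positive M →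
      let (m , n) = Split (g , M) in m ^ k * (root⌈ n ⌉ ^ (L * k) * n) ≡ g * M ^ (suc L * k)
    weight-Split {g} {M} sp 0<M = trans (weight-Join (proj₁ 0<s) (proj₂ 0<s))
      (cong (λ x → proj₁ x * proj₂ x ^ (suc L * k)) (Join-Split sp 0<M))
      where
      0<s : Positive² (Split (g , M))
      0<s = Split-positive (g , M)

  -- Nested pairs rather than a vector, so that the product of two series applies coordinate by
  -- coordinate.
  Quotients : ℕ → Set
  Quotients zero    = ⊤
  Quotients (suc l) = ℕ × Quotients l

  AllPositive : ∀ l → Quotients l → Set
  AllPositive zero    _        = ⊤
  AllPositive (suc l) (m , ms) = Positive m × AllPositive l ms

  -- Divisor chains as tuples of free quotients

  module Chains (k L : ℕ) .{{_ : NonZero k}} where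
    open Exponents k L

    -- What the next entry to the left has to be a multiple of. Taking C for the empty vector gives
    -- the link `n ∣ x ^ k` the same form as the links `y ^ k ∣ x ^ k`, that is, `y ∣ x`.
    top : ∀ {l} → Vec ℕ l → ℕ → ℕ
    top []      n = root⌈ n ⌉
    top (x ∷ _) n = x

    chain : ∀ l → Quotients l → ℕ → Vec ℕ l
    chain zero    _        n = []
    chain (suc l) (m , ms) n = m * top (chain l ms n) n ∷ chain l ms n

    -- m₁^{(j+1)k} m₂^{(j+2)k} ⋯
    weight : ℕ → ∀ l → Quotients l → ℕ
    weight j zero    _        = 1
    weight j (suc l) (m , ms) = m ^ (suc j * k) * weight (suc j) l ms

    top-positive : ∀ {l} {ns : Vec ℕ l} n → VecAll Positive ns → Positive (top ns n)
    top-positive n []        = root-positive n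
    top-positive n (0<x ∷ _) = 0<x

    chain-positive : ∀ l ms n → AllPositive l ms → VecAll Positive (chain l ms n)
    chain-positive zero    _        n _           = []
    chain-positive (suc l) (m , ms) n (0<m , 0<ms) = *-positive 0<m (top-positive n rest) ∷ rest
      where
      rest : VecAll Positive (chain l ms n)
      rest = chain-positive l ms n 0<ms

    Divides : ℕ → ℕ → Set
    Divides a b = b ∣ a

    linked⁺ : ∀ {l x n} {ns : Vec ℕ l} → Positive x → Positive n → VecAll Positive ns →
      top ns n ∣ x → Linked Divides (entries k (ns , n)) → Linked Divides (entries k (x ∷ ns , n))
    linked⁺ {ns = []}    0<x 0<n _         d r = root∣⇒∣^ 0<n 0<x d ∷ r
    linked⁺ {ns = _ ∷ _} 0<x 0<n (0<y ∷ _) d r = ∣⇒^∣^ 0<x 0<y d ∷ r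

    linked⁻ : ∀ {l x n} {ns : Vec ℕ l} → Positive x → Positive n → VecAll Positive ns →
      Linked Divides (entries k (x ∷ ns , n)) → top ns n ∣ x × Linked Divides (entries k (ns , n))
    linked⁻ {ns = []}    0<x 0<n _         (d ∷ r) = ∣^⇒root∣ 0<n 0<x d , r
    linked⁻ {ns = _ ∷ _} 0<x 0<n (0<y ∷ _) (d ∷ r) = ^∣^⇒∣ 0<x 0<y d , r

    chain-linked : ∀ l ms n → AllPositive l ms → Positive n → Linked Divides (entries k (chain l ms n , n))
    chain-linked zero    _        n _            0<n = [-]
    chain-linked (suc l) (m , ms) n (0<m , 0<ms) 0<n = linked⁺ (*-positive 0<m (top-positive n 0<ns)) 0<n 0<ns
      (n∣m*n m) (chain-linked l ms n 0<ms 0<n)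
      where
      0<ns : VecAll Positive (chain l ms n)
      0<ns = chain-positive l ms n 0<ms

    chain-divisorChain : ∀ l ms n → AllPositive l ms → Positive n → DivisorChain k (chain l ms n , n)
    chain-divisorChain l ms n 0<ms 0<n = chain-positive l ms n 0<ms , 0<n , chain-linked l ms n 0<ms 0<n

    chain-surjective : ∀ {l} (ns : Vec ℕ l) n → DivisorChain k (ns , n) → ∃[ ms ] AllPositive l ms × chain l ms n ≡ ns
    chain-surjective []       n _ = tt , tt , refl
    chain-surjective (x ∷ ns) n (0<x ∷ 0<ns , 0<n , r) with linked⁻ 0<x 0<n 0<ns r
    ... | divides m refl , r′ with chain-surjective ns n (0<ns , 0<n , r′)
    ... | ms , 0<ms , refl = (m , ms) , (factor-positiveˡ {m} 0<x , 0<ms) , refl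

    chain-injective : ∀ l ms ms′ n → AllPositive l ms → chain l ms n ≡ chain l ms′ n → ms ≡ ms′
    chain-injective zero    _        _          n _            _  = refl
    chain-injective (suc l) (m , ms) (m′ , ms′) n (0<m , 0<ms) eq with ∷-injective eq
    ... | eq₁ , eq₂ with chain-injective l ms ms′ n 0<ms eq₂
    ... | refl = cong (_, ms) (*-cancelʳ-≡ m m′ _ {{positive⇒nonZero (top-positive n (chain-positive l ms n 0<ms))}} eq₁)

    -- Let `m * t` be the head. Its `j` pending `k`-th powers and its own make exponent `suc j * k`;
    -- the power of `m` is final, and `suc j` copies of `t ^ k` are passed on to the next entry. In
    -- the end all `j + l` copies fall on the root.
    chain-weight : ∀ j l ms n →
      top (chain l ms n) n ^ (j * k) * product (toList (entries k (chain l ms n , n)))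
        ≡ weight j l ms * (root⌈ n ⌉ ^ ((j + l) * k) * n)
    chain-weight j zero _ n = begin
      root⌈ n ⌉ ^ (j * k) * (n * 1)              ≡⟨ cong₂ _*_ (cong (λ t → root⌈ n ⌉ ^ (t * k)) (sym (+-identityʳ j))) (*-identityʳ n) ⟩
      root⌈ n ⌉ ^ ((j + 0) * k) * n              ≡⟨ *-identityˡ _ ⟨
      1 * (root⌈ n ⌉ ^ ((j + 0) * k) * n)        ∎
      where open ≡-Reasoning
    chain-weight j (suc l) (m , ms) n = begin
      (m * t) ^ (j * k) * ((m * t) ^ k * Π)         ≡⟨ *-assoc ((m * t) ^ (j * k)) ((m * t) ^ k) Π ⟨
      (m * t) ^ (j * k) * (m * t) ^ k * Π           ≡⟨ cong (_* Π) (trans (*-comm ((m * t) ^ (j * k)) ((m * t) ^ k)) (sym (^-distribˡ-+-* (m * t) k (j * k)))) ⟩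
      (m * t) ^ (suc j * k) * Π                     ≡⟨ cong (_* Π) (^-distribʳ-* (suc j * k) m t) ⟩
      m ^ (suc j * k) * t ^ (suc j * k) * Π         ≡⟨ *-assoc (m ^ (suc j * k)) (t ^ (suc j * k)) Π ⟩
      m ^ (suc j * k) * (t ^ (suc j * k) * Π)       ≡⟨ cong (m ^ (suc j * k) *_) (chain-weight (suc j) l ms n) ⟩
      m ^ (suc j * k) * (weight (suc j) l ms * (root⌈ n ⌉ ^ ((suc j + l) * k) * n))  ≡⟨ *-assoc (m ^ (suc j * k)) (weight (suc j) l ms) _ ⟨
      m ^ (suc j * k) * weight (suc j) l ms * (root⌈ n ⌉ ^ ((suc j + l) * k) * n)    ≡⟨ cong (λ e → m ^ (suc j * k) * weight (suc j) l ms * (root⌈ n ⌉ ^ (e * k) * n)) (+-suc j l) ⟨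
      m ^ (suc j * k) * weight (suc j) l ms * (root⌈ n ⌉ ^ ((j + suc l) * k) * n)    ∎
      where
      open ≡-Reasoning
      t Π : ℕ
      t = top (chain l ms n) n
      Π = product (toList (entries k (chain l ms n , n)))
      ^-distribʳ-* : ∀ e a b → (a * b) ^ e ≡ a ^ e * b ^ e
      ^-distribʳ-* zero    a b = refl
      ^-distribʳ-* (suc e) a b = trans (cong (a * b *_) (^-distribʳ-* e a b)) ([m*n]*[o*p]≡[m*o]*[n*p] a b (a ^ e) (b ^ e))

module Analysis where
  open import Data.Rational using (_+_; _*_; _-_; -_; _≤_; _<_)
  open Rationals
  open CauchyLemmas
  open LogLemmas
  open ExpLemmas
  open ℚ.+-*-Solver using (solve; _:+_; _:*_; _:-_; :-_; _:=_; con)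

  -- The ring of Gaussian rationals

  module GaussianRationals where

    0ᵍ 1ᵍ : ℚ[i]
    0ᵍ = 0ℚ , 0ℚ
    1ᵍ = 1ℚ , 0ℚ

    ⊝_ : ℚ[i] → ℚ[i]
    ⊝ (a , b) = - a , - b

    real : ℚ → ℚ[i]
    real r = r , 0ℚ

    abstract
      ⊕-assoc : ∀ x y z → (x ⊕ y) ⊕ z ≡ x ⊕ (y ⊕ z)
      ⊕-assoc (a , b) (c , d) (e , f) = cong₂ _,_ (ℚ.+-assoc a c e) (ℚ.+-assoc b d f)

      ⊕-comm : ∀ x y → x ⊕ y ≡ y ⊕ x
      ⊕-comm (a , b) (c , d) = cong₂ _,_ (ℚ.+-comm a c) (ℚ.+-comm b d)

      ⊕-identityˡ : ∀ x → 0ᵍ ⊕ x ≡ x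
      ⊕-identityˡ (a , b) = cong₂ _,_ (ℚ.+-identityˡ a) (ℚ.+-identityˡ b)

      ⊕-identityʳ : ∀ x → x ⊕ 0ᵍ ≡ x
      ⊕-identityʳ (a , b) = cong₂ _,_ (ℚ.+-identityʳ a) (ℚ.+-identityʳ b)

      ⊝-inverseˡ : ∀ x → ⊝ x ⊕ x ≡ 0ᵍ
      ⊝-inverseˡ (a , b) = cong₂ _,_ (ℚ.+-inverseˡ a) (ℚ.+-inverseˡ b)

      ⊝-inverseʳ : ∀ x → x ⊕ ⊝ x ≡ 0ᵍ
      ⊝-inverseʳ (a , b) = cong₂ _,_ (ℚ.+-inverseʳ a) (ℚ.+-inverseʳ b)

      ⊗-assoc : ∀ x y z → (x ⊗ y) ⊗ z ≡ x ⊗ (y ⊗ z)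
      ⊗-assoc (a , b) (c , d) (e , f) = cong₂ _,_
        (solve 6 (λ a b c d e f → (a :* c :- b :* d) :* e :- (a :* d :+ b :* c) :* f := a :* (c :* e :- d :* f) :- b :* (c :* f :+ d :* e)) refl a b c d e f)
        (solve 6 (λ a b c d e f → (a :* c :- b :* d) :* f :+ (a :* d :+ b :* c) :* e := a :* (c :* f :+ d :* e) :+ b :* (c :* e :- d :* f)) refl a b c d e f)

      ⊗-comm : ∀ x y → x ⊗ y ≡ y ⊗ x
      ⊗-comm (a , b) (c , d) = cong₂ _,_
        (solve 4 (λ a b c d → a :* c :- b :* d := c :* a :- d :* b) refl a b c d)
        (solve 4 (λ a b c d → a :* d :+ b :* c := c :* b :+ d :* a) refl a b c d)

      ⊗-identityˡ : ∀ x → 1ᵍ ⊗ x ≡ x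
      ⊗-identityˡ (a , b) = cong₂ _,_
        (solve 2 (λ a b → con 1ℚ :* a :- con 0ℚ :* b := a) refl a b)
        (solve 2 (λ a b → con 1ℚ :* b :+ con 0ℚ :* a := b) refl a b)

      ⊗-identityʳ : ∀ x → x ⊗ 1ᵍ ≡ x
      ⊗-identityʳ x = trans (⊗-comm x 1ᵍ) (⊗-identityˡ x)

      ⊗-distribˡ-⊕ : ∀ x y z → x ⊗ (y ⊕ z) ≡ x ⊗ y ⊕ x ⊗ z
      ⊗-distribˡ-⊕ (a , b) (c , d) (e , f) = cong₂ _,_
        (solve 6 (λ a b c d e f → a :* (c :+ e) :- b :* (d :+ f) := (a :* c :- b :* d) :+ (a :* e :- b :* f)) refl a b c d e f)
        (solve 6 (λ a b c d e f → a :* (d :+ f) :+ b :* (c :+ e) := (a :* d :+ b :* c) :+ (a :* f :+ b :* e)) refl a b c d e f)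

      ⊗-distribʳ-⊕ : ∀ x y z → (y ⊕ z) ⊗ x ≡ y ⊗ x ⊕ z ⊗ x
      ⊗-distribʳ-⊕ x y z = trans (⊗-comm (y ⊕ z) x) (trans (⊗-distribˡ-⊕ x y z) (cong₂ _⊕_ (⊗-comm x y) (⊗-comm x z)))

      ⊙≡⊗ : ∀ r z → r ⊙ z ≡ real r ⊗ z
      ⊙≡⊗ r (a , b) = cong₂ _,_
        (solve 3 (λ r a b → r :* a := r :* a :- con 0ℚ :* b) refl r a b)
        (solve 3 (λ r a b → r :* b := r :* b :+ con 0ℚ :* a) refl r a b)

      real-* : ∀ r s → real (r * s) ≡ real r ⊗ real s
      real-* r s = cong₂ _,_
        (solve 2 (λ r s → r :* s := r :* s :- con 0ℚ :* con 0ℚ) refl r s)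
        (solve 2 (λ r s → con 0ℚ := r :* con 0ℚ :+ con 0ℚ :* s) refl r s)

    isCommutativeRing : IsCommutativeRing _⊕_ _⊗_ ⊝_ 0ᵍ 1ᵍ
    isCommutativeRing = record
      { isRing = record
        { +-isAbelianGroup = record
          { isGroup = record
            { isMonoid = record
              { isSemigroup = record
                { isMagma = record { isEquivalence = isEquivalence ; ∙-cong = cong₂ _⊕_ }
                ; assoc = ⊕-assoc }
              ; identity = ⊕-identityˡ , ⊕-identityʳ }
            ; inverse = ⊝-inverseˡ , ⊝-inverseʳ
            ; ⁻¹-cong = cong ⊝_ }
          ; comm = ⊕-comm }
        ; *-cong = cong₂ _⊗_
        ; *-assoc = ⊗-assoc
        ; *-identity = ⊗-identityˡ , ⊗-identityʳ
        ; distrib = ⊗-distribˡ-⊕ , ⊗-distribʳ-⊕ }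
      ; *-comm = ⊗-comm }

    commutativeRing : CommutativeRing _ _
    commutativeRing = record { isCommutativeRing = isCommutativeRing }

  module 𝔾 = Solver (ACR.fromCommutativeRing GaussianRationals.commutativeRing) (≡-dec ℚ._≟_ ℚ._≟_)

  open GaussianRationals public

  -- The sum over `i + j = m`, as in a Cauchy product. Recursion on shifted rows avoids the
  -- subtraction in `f i (m - i)`.
  diagonal : (ℕ → ℕ → ℚ[i]) → ℕ → ℚ[i]
  diagonal f zero    = f 0 0
  diagonal f (suc m) = f 0 (suc m) ⊕ diagonal (λ i j → f (suc i) j) m

  row : (ℕ → ℚ[i]) → ℕ → ℚ[i]
  row g zero    = 0ᵍ
  row g (suc n) = row g n ⊕ g n

  -- the sum of f i j over i + j < n
  triangleSum : (ℕ → ℕ → ℚ[i]) → ℕ → ℚ[i]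
  triangleSum f zero    = 0ᵍ
  triangleSum f (suc n) = row (f 0) (suc n) ⊕ triangleSum (λ i j → f (suc i) j) n

  module Diagonals where
    open ≡-Reasoning

    abstract
      diagonal-cong : ∀ {f g} m → (∀ i j → f i j ≡ g i j) → diagonal f m ≡ diagonal g m
      diagonal-cong zero    h = h 0 0
      diagonal-cong (suc m) h = cong₂ _⊕_ (h 0 (suc m)) (diagonal-cong m (λ i j → h (suc i) j))

      diagonal-snoc : ∀ f m → diagonal f (suc m) ≡ diagonal (λ i j → f i (suc j)) m ⊕ f (suc m) 0
      diagonal-snoc f zero    = refl
      diagonal-snoc f (suc m) = trans (cong (f 0 (suc (suc m)) ⊕_) (diagonal-snoc (λ i j → f (suc i) j) m)) (sym (⊕-assoc (f 0 (suc (suc m))) (diagonal (λ i j → f (suc i) (suc j)) m) (f (suc (suc m)) 0)))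

      diagonal-⊕ : ∀ f g m → diagonal (λ i j → f i j ⊕ g i j) m ≡ diagonal f m ⊕ diagonal g m
      diagonal-⊕ f g zero    = refl
      diagonal-⊕ f g (suc m) = trans (cong ((f 0 (suc m) ⊕ g 0 (suc m)) ⊕_) (diagonal-⊕ f′ g′ m))
        (𝔾.solve 4 (λ a b c d → (a 𝔾.:+ b) 𝔾.:+ (c 𝔾.:+ d) 𝔾.:= (a 𝔾.:+ c) 𝔾.:+ (b 𝔾.:+ d)) refl (f 0 (suc m)) (g 0 (suc m)) (diagonal f′ m) (diagonal g′ m))
        where
        f′ g′ : ℕ → ℕ → ℚ[i]
        f′ i j = f (suc i) j
        g′ i j = g (suc i) j

      diagonal-⊗ : ∀ c f m → diagonal (λ i j → c ⊗ f i j) m ≡ c ⊗ diagonal f m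
      diagonal-⊗ c f zero    = refl
      diagonal-⊗ c f (suc m) = trans (cong (c ⊗ f 0 (suc m) ⊕_) (diagonal-⊗ c (λ i j → f (suc i) j) m)) (sym (⊗-distribˡ-⊕ c (f 0 (suc m)) (diagonal (λ i j → f (suc i) j) m)))

      -- On a diagonal `i + j` is constant, so a factor depending on it alone can be taken out.
      diagonal-scale : ∀ (h : ℕ → ℚ[i]) f m → diagonal (λ i j → h (i ℕ.+ j) ⊗ f i j) m ≡ h m ⊗ diagonal f m
      diagonal-scale h f zero    = refl
      diagonal-scale h f (suc m) = trans (cong (h (suc m) ⊗ f 0 (suc m) ⊕_) (diagonal-scale (λ i → h (suc i)) (λ i j → f (suc i) j) m))
        (sym (⊗-distribˡ-⊕ (h (suc m)) (f 0 (suc m)) (diagonal (λ i j → f (suc i) j) m)))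

      -- The triangle is defined by rows; here it grows by a diagonal, just as `expSum` grows by a
      -- term.
      triangleSum-suc : ∀ f n → triangleSum f (suc n) ≡ triangleSum f n ⊕ diagonal f n
      triangleSum-suc f zero = 𝔾.solve 1 (λ x → (𝔾.con 0ᵍ 𝔾.:+ x) 𝔾.:+ 𝔾.con 0ᵍ 𝔾.:= 𝔾.con 0ᵍ 𝔾.:+ x) refl (f 0 0)
      triangleSum-suc f (suc n) = trans (cong (row (f 0) (suc (suc n)) ⊕_) (triangleSum-suc (λ i j → f (suc i) j) n))
        (𝔾.solve 4 (λ r x s d → (r 𝔾.:+ x) 𝔾.:+ (s 𝔾.:+ d) 𝔾.:= (r 𝔾.:+ s) 𝔾.:+ (x 𝔾.:+ d)) refl
          (row (f 0) (suc n)) (f 0 (suc n)) (triangleSum (λ i j → f (suc i) j) n) (diagonal (λ i j → f (suc i) j) n))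

      expTerm-suc : ∀ z j → real (ι (suc j)) ⊗ expTerm z (suc j) ≡ expTerm z j ⊗ z
      expTerm-suc z j = begin
        real (ι (suc j)) ⊗ (recip j ⊙ x)        ≡⟨ cong (real (ι (suc j)) ⊗_) (⊙≡⊗ (recip j) x) ⟩
        real (ι (suc j)) ⊗ (real (recip j) ⊗ x) ≡⟨ 𝔾.solve 3 (λ a b x → a 𝔾.:* (b 𝔾.:* x) 𝔾.:= (b 𝔾.:* a) 𝔾.:* x) refl (real (ι (suc j))) (real (recip j)) x ⟩
        (real (recip j) ⊗ real (ι (suc j))) ⊗ x ≡⟨ cong (_⊗ x) (trans (sym (real-* (recip j) (ι (suc j)))) (cong real (recip*ι j))) ⟩
        1ᵍ ⊗ x                                  ≡⟨ ⊗-identityˡ x ⟩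
        x                                       ∎
        where
        x : ℚ[i]
        x = expTerm z j ⊗ z

      -- Both sides satisfy the recursion (m+1)·c_{m+1} = (z+w)·c_m.
      expTerm-⊕ : ∀ z w m → expTerm (z ⊕ w) m ≡ diagonal (λ i j → expTerm z i ⊗ expTerm w j) m
      expTerm-⊕ z w zero    = sym (⊗-identityˡ 1ᵍ)
      expTerm-⊕ z w (suc m) = begin
        recip m ⊙ (expTerm (z ⊕ w) m ⊗ (z ⊕ w))               ≡⟨ cong (λ t → recip m ⊙ (t ⊗ (z ⊕ w))) (expTerm-⊕ z w m) ⟩
        recip m ⊙ (diagonal D m ⊗ (z ⊕ w))                    ≡⟨ cong (recip m ⊙_) recursion ⟨
        recip m ⊙ (real (ι (suc m)) ⊗ diagonal D (suc m))     ≡⟨ ⊙≡⊗ (recip m) _ ⟩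
        real (recip m) ⊗ (real (ι (suc m)) ⊗ diagonal D (suc m)) ≡⟨ ⊗-assoc (real (recip m)) (real (ι (suc m))) _ ⟨
        (real (recip m) ⊗ real (ι (suc m))) ⊗ diagonal D (suc m) ≡⟨ cong (_⊗ diagonal D (suc m)) (trans (sym (real-* (recip m) (ι (suc m)))) (cong real (recip*ι m))) ⟩
        1ᵍ ⊗ diagonal D (suc m)                               ≡⟨ ⊗-identityˡ _ ⟩
        diagonal D (suc m)                                    ∎
        where
        D : ℕ → ℕ → ℚ[i]
        D i j = expTerm z i ⊗ expTerm w j
        h : ℕ → ℚ[i]
        h i = real (ι i)
        zeroˡ : ∀ x → h 0 ⊗ x ≡ 0ᵍ
        zeroˡ = 𝔾.solve 1 (λ x → 𝔾.con 0ᵍ 𝔾.:* x 𝔾.:= 𝔾.con 0ᵍ) refl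
        h-+ : ∀ i j → h (i ℕ.+ j) ≡ h i ⊕ h j
        h-+ i j = cong₂ _,_ (ι-+ i j) refl
        left : diagonal (λ i j → h i ⊗ D i j) (suc m) ≡ z ⊗ diagonal D m
        left = begin
          h 0 ⊗ D 0 (suc m) ⊕ diagonal (λ i j → h (suc i) ⊗ D (suc i) j) m ≡⟨ cong₂ _⊕_ (zeroˡ (D 0 (suc m))) (diagonal-cong m λ i j → begin
              h (suc i) ⊗ (expTerm z (suc i) ⊗ expTerm w j)  ≡⟨ ⊗-assoc (h (suc i)) (expTerm z (suc i)) (expTerm w j) ⟨
              (h (suc i) ⊗ expTerm z (suc i)) ⊗ expTerm w j  ≡⟨ cong (_⊗ expTerm w j) (expTerm-suc z i) ⟩
              (expTerm z i ⊗ z) ⊗ expTerm w j                ≡⟨ 𝔾.solve 3 (λ a z b → (a 𝔾.:* z) 𝔾.:* b 𝔾.:= z 𝔾.:* (a 𝔾.:* b)) refl (expTerm z i) z (expTerm w j) ⟩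
              z ⊗ D i j                                      ∎) ⟩
          0ᵍ ⊕ diagonal (λ i j → z ⊗ D i j) m ≡⟨ ⊕-identityˡ _ ⟩
          diagonal (λ i j → z ⊗ D i j) m      ≡⟨ diagonal-⊗ z D m ⟩
          z ⊗ diagonal D m                    ∎
        right : diagonal (λ i j → h j ⊗ D i j) (suc m) ≡ w ⊗ diagonal D m
        right = begin
          diagonal (λ i j → h j ⊗ D i j) (suc m)                            ≡⟨ diagonal-snoc (λ i j → h j ⊗ D i j) m ⟩
          diagonal (λ i j → h (suc j) ⊗ D i (suc j)) m ⊕ h 0 ⊗ D (suc m) 0  ≡⟨ cong₂ _⊕_ (diagonal-cong m (λ i j → begin
              h (suc j) ⊗ (expTerm z i ⊗ expTerm w (suc j))  ≡⟨ 𝔾.solve 3 (λ h a b → h 𝔾.:* (a 𝔾.:* b) 𝔾.:= a 𝔾.:* (h 𝔾.:* b)) refl (h (suc j)) (expTerm z i) (expTerm w (suc j)) ⟩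
              expTerm z i ⊗ (h (suc j) ⊗ expTerm w (suc j))  ≡⟨ cong (expTerm z i ⊗_) (expTerm-suc w j) ⟩
              expTerm z i ⊗ (expTerm w j ⊗ w)                ≡⟨ 𝔾.solve 3 (λ a b w → a 𝔾.:* (b 𝔾.:* w) 𝔾.:= w 𝔾.:* (a 𝔾.:* b)) refl (expTerm z i) (expTerm w j) w ⟩
              w ⊗ D i j                                      ∎)) (zeroˡ (D (suc m) 0)) ⟩
          diagonal (λ i j → w ⊗ D i j) m ⊕ 0ᵍ ≡⟨ ⊕-identityʳ _ ⟩
          diagonal (λ i j → w ⊗ D i j) m      ≡⟨ diagonal-⊗ w D m ⟩
          w ⊗ diagonal D m                    ∎
        -- The factor `m + 1` equals `i + j` all along the diagonal; the share `i` lowers the power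
        -- of `z`, the share `j` that of `w`.
        recursion : h (suc m) ⊗ diagonal D (suc m) ≡ diagonal D m ⊗ (z ⊕ w)
        recursion = begin
          h (suc m) ⊗ diagonal D (suc m)                       ≡⟨ diagonal-scale h D (suc m) ⟨
          diagonal (λ i j → h (i ℕ.+ j) ⊗ D i j) (suc m)       ≡⟨ diagonal-cong (suc m) (λ i j → trans (cong (_⊗ D i j) (h-+ i j)) (⊗-distribʳ-⊕ (D i j) (h i) (h j))) ⟩
          diagonal (λ i j → h i ⊗ D i j ⊕ h j ⊗ D i j) (suc m) ≡⟨ diagonal-⊕ (λ i j → h i ⊗ D i j) (λ i j → h j ⊗ D i j) (suc m) ⟩
          diagonal (λ i j → h i ⊗ D i j) (suc m) ⊕ diagonal (λ i j → h j ⊗ D i j) (suc m) ≡⟨ cong₂ _⊕_ left right ⟩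
          z ⊗ diagonal D m ⊕ w ⊗ diagonal D m                  ≡⟨ 𝔾.solve 3 (λ z w d → z 𝔾.:* d 𝔾.:+ w 𝔾.:* d 𝔾.:= d 𝔾.:* (z 𝔾.:+ w)) refl z w (diagonal D m) ⟩
          diagonal D m ⊗ (z ⊕ w)                               ∎

      expSum-⊕ : ∀ z w n → expSum (z ⊕ w) n ≡ triangleSum (λ i j → expTerm z i ⊗ expTerm w j) n
      expSum-⊕ z w zero    = refl
      expSum-⊕ z w (suc n) = trans (cong₂ _⊕_ (expSum-⊕ z w n) (expTerm-⊕ z w n)) (sym (triangleSum-suc _ n))
  open Diagonals public

  Eventually : (ℕ → Set) → Set
  Eventually P = ∃[ N ] (∀ n → N ℕ.≤ n → P n)

  ev-map : ∀ {P Q : ℕ → Set} → (∀ n → P n → Q n) → Eventually P → Eventually Q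
  ev-map f (N , h) = N , λ n N≤n → f n (h n N≤n)

  ev-zip : ∀ {P Q R : ℕ → Set} → (∀ n → P n → Q n → R n) → Eventually P → Eventually Q → Eventually R
  ev-zip f (N , h) (N′ , h′) = N ℕ.⊔ N′ , λ n N≤n →
    f n (h n (ℕ.m⊔n≤o⇒m≤o N N′ N≤n)) (h′ n (ℕ.m⊔n≤o⇒n≤o N N′ N≤n))

  ev-≥ : ∀ N → Eventually (N ℕ.≤_)
  ev-≥ N = N , λ _ h → h

  2ℚ : ℚ
  2ℚ = 1ℚ + 1ℚ

  0≤2 : 0ℚ ≤ 2ℚ
  0≤2 = 0≤p+q 0≤1 0≤1

  8ℚ : ℚ
  8ℚ = 2ℚ * (2ℚ * 2ℚ)

  0≤8 : 0ℚ ≤ 8ℚ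
  0≤8 = 0≤p*q 0≤2 (0≤p*q 0≤2 0≤2)

  0≤ι : ∀ n → 0ℚ ≤ ι n
  0≤ι zero    = ℚ.≤-refl
  0≤ι (suc n) = 0≤p+q (0≤ι n) 0≤1

  half : ∀ ε → 0ℚ < ε → ∃[ δ ] 0ℚ < δ × δ + δ ≤ ε
  half ε 0<ε = let δ , 0<δ , h = shrink 2ℚ 0≤2 ε 0<ε in
    δ , 0<δ , ℚ.≤-trans (ℚ.≤-reflexive (solve 1 (λ d → d :+ d := (con 1ℚ :+ con 1ℚ) :* d) refl δ)) (ℚ.<⇒≤ h)

  -- The addition theorem of the exponential, with an explicit error

  module ExpAddition where
    open ℚ.≤-Reasoning

    abstract
      half^*ι≤1 : ∀ n → half^ n * ι n ≤ 1ℚ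
      half^*ι≤1 n = begin
        half^ n * ι n         ≤⟨ *-mono (0≤half^ n) (0≤ι (suc n)) (half^≤recip n) (p≤p+q 0≤1) ⟩
        recip n * ι (suc n)   ≡⟨ recip*ι n ⟩
        1ℚ                    ∎

      half^*triangular≤1 : ∀ n → half^ n * ∑< n ι ≤ 1ℚ
      half^*triangular≤1 zero    = 0≤1
      half^*triangular≤1 (suc n) = begin
        ½ * half^ n * (∑< n ι + ι n)             ≡⟨ solve 3 (λ h t i → con ½ :* h :* (t :+ i) := con ½ :* (h :* t :+ h :* i)) refl (half^ n) (∑< n ι) (ι n) ⟩
        ½ * (half^ n * ∑< n ι + half^ n * ι n)   ≤⟨ *-monoˡ 0≤½ (ℚ.+-mono-≤ (half^*triangular≤1 n) (half^*ι≤1 n)) ⟩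
        ½ * (1ℚ + 1ℚ)                            ≡⟨ refl ⟩
        1ℚ                                       ∎

      triangular : ∀ n → 2ℚ * ∑< (suc n) ι ≡ ι (suc n) * ι n
      triangular zero    = refl
      triangular (suc n) = begin-equality
        2ℚ * (∑< (suc n) ι + ι (suc n))           ≡⟨ ℚ.*-distribˡ-+ 2ℚ (∑< (suc n) ι) (ι (suc n)) ⟩
        2ℚ * ∑< (suc n) ι + 2ℚ * ι (suc n)        ≡⟨ cong (_+ 2ℚ * ι (suc n)) (triangular n) ⟩
        ι (suc n) * ι n + 2ℚ * ι (suc n)          ≡⟨ solve 1 (λ i → (i :+ con 1ℚ) :* i :+ (con 1ℚ :+ con 1ℚ) :* (i :+ con 1ℚ) := ((i :+ con 1ℚ) :+ con 1ℚ) :* (i :+ con 1ℚ)) refl (ι n) ⟩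
        ι (suc (suc n)) * ι (suc n)               ∎

      -- A constant bound for n (n - 1) / 2ⁿ, from the triangular numbers, gives n / 2ⁿ a bound of
      -- order 1 / (n - 1). The error in the addition theorem is of the size n / 2ⁿ.
      ι*half^≤recip : ∀ n → ι (suc (suc n)) * half^ (suc (suc n)) ≤ 2ℚ * recip n
      ι*half^≤recip n = begin
        i * h                             ≡⟨ ℚ.*-identityʳ (i * h) ⟨
        i * h * 1ℚ                        ≡⟨ cong (i * h *_) (recip*ι n) ⟨
        i * h * (recip n * ι (suc n))     ≡⟨ solve 4 (λ i h r j → i :* h :* (r :* j) := (h :* (i :* j)) :* r) refl i h (recip n) (ι (suc n)) ⟩
        h * (i * ι (suc n)) * recip n     ≡⟨ cong (λ t → h * t * recip n) (triangular (suc n)) ⟨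
        h * (2ℚ * t) * recip n            ≡⟨ cong (_* recip n) (solve 2 (λ h t → h :* ((con 1ℚ :+ con 1ℚ) :* t) := (con 1ℚ :+ con 1ℚ) :* (h :* t)) refl h t) ⟩
        2ℚ * (h * t) * recip n            ≤⟨ *-monoʳ (0≤recip n) (*-monoˡ 0≤2 (half^*triangular≤1 (suc (suc n)))) ⟩
        2ℚ * 1ℚ * recip n                 ≡⟨ refl ⟩
        2ℚ * recip n                      ∎
        where
        i h t : ℚ
        i = ι (suc (suc n))
        h = half^ (suc (suc n))
        t = ∑< (suc (suc n)) ι

      ι*half^→0 : ∀ ε → 0ℚ < ε → Eventually (λ n → ι n * half^ n ≤ ε)
      ι*half^→0 ε 0<ε = let δ , 0<δ , 2δ<ε = shrink 2ℚ 0≤2 ε 0<ε ; N , recipN≤δ = archimedean δ 0<δ in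
        suc (suc N) , λ { (suc (suc n)) (s≤s (s≤s N≤n)) → begin
          ι (suc (suc n)) * half^ (suc (suc n))  ≤⟨ ι*half^≤recip n ⟩
          2ℚ * recip n                           ≤⟨ *-monoˡ 0≤2 (ℚ.≤-trans (recip-antimono N≤n) recipN≤δ) ⟩
          2ℚ * δ                                 ≤⟨ ℚ.<⇒≤ 2δ<ε ⟩
          ε                                      ∎ }

    -- Summation from the front, to match the recursion of `triangleSum`; `expSum` adds its terms at
    -- the end.
    frontSum : (ℕ → ℚ[i]) → ℕ → ℚ[i]
    frontSum a zero    = 0ᵍ
    frontSum a (suc n) = a 0 ⊕ frontSum (λ i → a (suc i)) n

    abstract
      frontSum-suc : ∀ a n → frontSum a (suc n) ≡ frontSum a n ⊕ a n
      frontSum-suc a zero    = ⊕-comm (a 0) 0ᵍ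
      frontSum-suc a (suc n) = trans (cong (a 0 ⊕_) (frontSum-suc (λ i → a (suc i)) n)) (sym (⊕-assoc (a 0) (frontSum (λ i → a (suc i)) n) (a (suc n))))

      frontSum-expTerm : ∀ z n → frontSum (expTerm z) n ≡ expSum z n
      frontSum-expTerm z zero    = refl
      frontSum-expTerm z (suc n) = trans (frontSum-suc (expTerm z) n) (cong (_⊕ expTerm z n) (frontSum-expTerm z n))

      row-⊗ : ∀ c w n → row (λ j → c ⊗ expTerm w j) n ≡ c ⊗ expSum w n
      row-⊗ c w zero    = 𝔾.solve 1 (λ c → 𝔾.con 0ᵍ 𝔾.:= c 𝔾.:* 𝔾.con 0ᵍ) refl c
      row-⊗ c w (suc n) = trans (cong (_⊕ c ⊗ expTerm w n) (row-⊗ c w n)) (sym (⊗-distribˡ-⊕ c (expSum w n) (expTerm w n)))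

      exp-tail : ∀ {L C} w → 0ℚ ≤ L → 0ℚ ≤ C → ‖ w ‖ ≤ L → (∀ j → b L j ≤ C * half^ j) → ∀ {n N} → n ℕ.≤ N →
        ‖ expSum w N ⊖ expSum w n ‖ ≤ 2ℚ * C * half^ n
      exp-tail {L} {C} w 0≤L 0≤C hw hC {n} {N} n≤N = begin
        ‖ expSum w N ⊖ expSum w n ‖                       ≡⟨ cong (λ t → ‖ expSum w t ⊖ expSum w n ‖) (ℕ.m+[n∸m]≡n n≤N) ⟨
        ‖ expSum w (n ℕ.+ (N ℕ.∸ n)) ⊖ expSum w n ‖       ≤⟨ sum-tail {L} {C} w 0≤L hw hC n (N ℕ.∸ n) ⟩
        2ℚ * C * half^ n - 2ℚ * C * half^ (n ℕ.+ (N ℕ.∸ n)) ≤⟨ drop-nonNeg (0≤p*q (0≤p*q 0≤2 0≤C) (0≤half^ (n ℕ.+ (N ℕ.∸ n)))) ⟩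
        2ℚ * C * half^ n                                  ∎

      -- Row i of the square exceeds row i of the triangle by aᵢ times the terms n - i, …, N - 1 of exp w.
      square-triangle : ∀ {D} w {N} → 0ℚ ≤ D → (∀ {n} → n ℕ.≤ N → ‖ expSum w N ⊖ expSum w n ‖ ≤ D * half^ n) →
        ∀ a c n → (∀ i → ‖ a i ‖ ≤ c * half^ i) → n ℕ.≤ N →
        ‖ frontSum a n ⊗ expSum w N ⊖ triangleSum (λ i j → a i ⊗ expTerm w j) n ‖ ≤ ι n * (c * (D * half^ n))
      square-triangle {D} w {N} 0≤D tail a c zero ha n≤N = ℚ.≤-reflexive (begin-equality
        ‖ 0ᵍ ⊗ expSum w N ⊖ 0ᵍ ‖   ≡⟨ cong ‖_‖ {0ᵍ ⊗ expSum w N ⊖ 0ᵍ} {0ᵍ} (𝔾.solve 1 (λ e → 𝔾.con 0ᵍ 𝔾.:* e 𝔾.:- 𝔾.con 0ᵍ 𝔾.:= 𝔾.con 0ᵍ) refl (expSum w N)) ⟩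
        ‖ 0ᵍ ‖                     ≡⟨ ℚ.*-zeroˡ (c * (D * half^ 0)) ⟨
        0ℚ * (c * (D * half^ 0))   ∎)
      square-triangle {D} w {N} 0≤D tail a c (suc n) ha n≤N = begin
        ‖ (a 0 ⊕ F) ⊗ E ⊖ (row (λ j → a 0 ⊗ expTerm w j) (suc n) ⊕ T) ‖  ≡⟨ cong (λ t → ‖ (a 0 ⊕ F) ⊗ E ⊖ (t ⊕ T) ‖) (row-⊗ (a 0) w (suc n)) ⟩
        ‖ (a 0 ⊕ F) ⊗ E ⊖ (a 0 ⊗ expSum w (suc n) ⊕ T) ‖                 ≡⟨ cong ‖_‖ (𝔾.solve 5 (λ a f e g t → (a 𝔾.:+ f) 𝔾.:* e 𝔾.:- (a 𝔾.:* g 𝔾.:+ t) 𝔾.:= a 𝔾.:* (e 𝔾.:- g) 𝔾.:+ (f 𝔾.:* e 𝔾.:- t)) refl (a 0) F E (expSum w (suc n)) T) ⟩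
        ‖ a 0 ⊗ (E ⊖ expSum w (suc n)) ⊕ (F ⊗ E ⊖ T) ‖                   ≤⟨ ‖⊕‖ (a 0 ⊗ (E ⊖ expSum w (suc n))) (F ⊗ E ⊖ T) ⟩
        ‖ a 0 ⊗ (E ⊖ expSum w (suc n)) ‖ + ‖ F ⊗ E ⊖ T ‖                 ≤⟨ ℚ.+-mono-≤ first rest ⟩
        c * 1ℚ * (D * (½ * half^ n)) + ι n * (c * ½ * (D * half^ n))     ≡⟨ solve 4 (λ c D h i → c :* con 1ℚ :* (D :* (con ½ :* h)) :+ i :* (c :* con ½ :* (D :* h)) := (i :+ con 1ℚ) :* (c :* (D :* (con ½ :* h)))) refl c D (half^ n) (ι n) ⟩
        ι (suc n) * (c * (D * half^ (suc n)))                            ∎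
        where
        F E T : ℚ[i]
        F = frontSum (λ i → a (suc i)) n
        E = expSum w N
        T = triangleSum (λ i j → a (suc i) ⊗ expTerm w j) n
        first : ‖ a 0 ⊗ (E ⊖ expSum w (suc n)) ‖ ≤ c * 1ℚ * (D * (½ * half^ n))
        first = ℚ.≤-trans (‖⊗‖ (a 0) (E ⊖ expSum w (suc n))) (*-mono (0≤‖‖ (a 0)) (0≤p*q 0≤D (0≤half^ (suc n))) (ha 0) (tail n≤N))
        rest : ‖ F ⊗ E ⊖ T ‖ ≤ ι n * (c * ½ * (D * half^ n))
        rest = square-triangle w 0≤D tail (λ i → a (suc i)) (c * ½) n
          (λ i → ℚ.≤-trans (ha (suc i)) (ℚ.≤-reflexive (sym (ℚ.*-assoc c ½ (half^ i))))) (ℕ.<⇒≤ n≤N)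

      -- The difference consists of the terms of the square with `i + j ≥ n`. Each of the `n` rows
      -- contributes at most 2C² / 2ⁿ, since the terms of both series are bounded by C / 2^i. The
      -- constant depends on `L` alone, because `z` and `w` are going to vary with `n`.
      expSum-⊕-close : ∀ L → 0ℚ ≤ L → ∃[ K ] 0ℚ ≤ K × (∀ z w n → ‖ z ‖ ≤ L → ‖ w ‖ ≤ L →
        ‖ expSum z n ⊗ expSum w n ⊖ expSum (z ⊕ w) n ‖ ≤ K * (ι n * half^ n))
      expSum-⊕-close L 0≤L with geometric L 0≤L
      ... | C , 0≤C , hC = C * (2ℚ * C) , 0≤p*q 0≤C (0≤p*q 0≤2 0≤C) , λ z w n hz hw → begin
        ‖ expSum z n ⊗ expSum w n ⊖ expSum (z ⊕ w) n ‖
          ≡⟨ cong₂ (λ x y → ‖ x ⊗ expSum w n ⊖ y ‖) (sym (frontSum-expTerm z n)) (expSum-⊕ z w n) ⟩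
        ‖ frontSum (expTerm z) n ⊗ expSum w n ⊖ triangleSum (λ i j → expTerm z i ⊗ expTerm w j) n ‖
          ≤⟨ square-triangle w (0≤p*q 0≤2 0≤C) (exp-tail w 0≤L 0≤C hw hC) (expTerm z) C n (λ i → ℚ.≤-trans (term-bound z 0≤L hz i) (hC i)) ℕ.≤-refl ⟩
        ι n * (C * (2ℚ * C * half^ n))
          ≡⟨ solve 3 (λ i C h → i :* (C :* ((con 1ℚ :+ con 1ℚ) :* C :* h)) := C :* ((con 1ℚ :+ con 1ℚ) :* C) :* (i :* h)) refl (ι n) C (half^ n) ⟩
        C * (2ℚ * C) * (ι n * half^ n) ∎

  open ExpAddition using (ι*half^→0; expSum-⊕-close) public

  -- Sequences of approximants up to null sequences

  Seq : Set
  Seq = ℕ → ℚ[i]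

  infixl 8 _!_
  _!_ : ℂ → Seq
  (z ! n) = seq (re z) n , seq (im z) n

  record Bounded (u : Seq) : Set where
    constructor mkBounded
    field
      bound    : ℚ
      0≤bound  : 0ℚ ≤ bound
      ‖‖≤bound : ∀ n → ‖ u n ‖ ≤ bound

  infix 4 _≋_
  -- Defined for bare sequences, so that no Cauchy moduli have to be carried along; a record, so
  -- that `u` and `v` can be inferred from a proof.
  record _≋_ (u v : Seq) : Set where
    constructor mk≋
    field
      close : ∀ ε → 0ℚ < ε → Eventually (λ n → ‖ u n ⊖ v n ‖ ≤ ε)
  open _≋_ public

  -- `exp z !_` is definitionally `expS (z !_)`, so facts about `expS` apply to powers without
  -- conversion.
  expS : Seq → Seq
  expS u n = expSum (u n) n

  module Sequences where
    open ℚ.≤-Reasoning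
    abstract
      ≋-reflexive : ∀ {u v} → (∀ n → u n ≡ v n) → u ≋ v
      ≋-reflexive {u} {v} h = mk≋ λ ε 0<ε → 0 , λ n _ → ℚ.≤-trans (ℚ.≤-reflexive (trans (cong (λ t → ‖ t ⊖ v n ‖) (h n)) (‖z⊖z‖ (v n)))) (ℚ.<⇒≤ 0<ε)

      ≋-sym : ∀ {u v} → u ≋ v → v ≋ u
      ≋-sym {u} {v} h = mk≋ λ ε 0<ε → ev-map (λ n → subst (_≤ ε) (‖⊖‖-sym (u n) (v n))) (close h ε 0<ε)

      ≋-trans : ∀ {u v w} → u ≋ v → v ≋ w → u ≋ w
      ≋-trans {u} {v} {w} h h′ = mk≋ λ ε 0<ε → let δ , 0<δ , δ+δ≤ε = half ε 0<ε in
        ev-zip (λ n p q → ℚ.≤-trans (triangle (u n) (v n) (w n)) (ℚ.≤-trans (ℚ.+-mono-≤ p q) δ+δ≤ε)) (close h δ 0<δ) (close h′ δ 0<δ)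

      ≋-scaled : ∀ u v K → 0ℚ ≤ K → (∀ δ → 0ℚ < δ → Eventually (λ n → ‖ u n ⊖ v n ‖ ≤ K * δ)) → u ≋ v
      ≋-scaled u v K 0≤K h = mk≋ λ ε 0<ε → let δ , 0<δ , Kδ<ε = shrink K 0≤K ε 0<ε in
        ev-map (λ n p → ℚ.≤-trans p (ℚ.<⇒≤ Kδ<ε)) (h δ 0<δ)

      bounded-resp : ∀ {u v} → (∀ n → u n ≡ v n) → Bounded u → Bounded v
      bounded-resp h (mkBounded K 0≤K hK) = mkBounded K 0≤K λ n → subst (λ t → ‖ t ‖ ≤ K) (h n) (hK n)

      bounded-! : ∀ z → Bounded (z !_)
      bounded-! z with bounded {seq (re z)} (cauchy (re z)) | bounded {seq (im z)} (cauchy (im z))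
      ... | A , 0≤A , hA | B , 0≤B , hB = mkBounded (A + B) (0≤p+q 0≤A 0≤B) λ n → ℚ.+-mono-≤ (hA n) (hB n)

      bounded-⊕ : ∀ {u v} → Bounded u → Bounded v → Bounded (λ n → u n ⊕ v n)
      bounded-⊕ {u} {v} (mkBounded A 0≤A hA) (mkBounded B 0≤B hB) = mkBounded (A + B) (0≤p+q 0≤A 0≤B) λ n → ℚ.≤-trans (‖⊕‖ (u n) (v n)) (ℚ.+-mono-≤ (hA n) (hB n))

      bounded-⊗ : ∀ {u v} → Bounded u → Bounded v → Bounded (λ n → u n ⊗ v n)
      bounded-⊗ {u} {v} (mkBounded A 0≤A hA) (mkBounded B 0≤B hB) = mkBounded (A * B) (0≤p*q 0≤A 0≤B) λ n → ℚ.≤-trans (‖⊗‖ (u n) (v n)) (*-mono (0≤‖‖ (u n)) 0≤B (hA n) (hB n))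

      bounded-expS : ∀ {u} → Bounded u → Bounded (expS u)
      bounded-expS {u} (mkBounded L 0≤L hL) with geometric L 0≤L
      ... | C , 0≤C , hC = mkBounded (2ℚ * C * 1ℚ) (0≤p*q (0≤p*q 0≤2 0≤C) 0≤1) λ n → begin
        ‖ expSum (u n) n ‖                       ≡⟨ cong ‖_‖ (𝔾.solve 1 (λ x → x 𝔾.:= x 𝔾.:- 𝔾.con 0ᵍ) refl (expSum (u n) n)) ⟩
        ‖ expSum (u n) n ⊖ expSum (u n) 0 ‖      ≤⟨ ExpAddition.exp-tail (u n) 0≤L 0≤C (hL n) hC {0} {n} z≤n ⟩
        2ℚ * C * half^ 0                         ∎

      ⊕-cong-≋ : ∀ {u u′ v v′} → u ≋ u′ → v ≋ v′ → (λ n → u n ⊕ v n) ≋ (λ n → u′ n ⊕ v′ n)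
      ⊕-cong-≋ {u} {u′} {v} {v′} h h′ = mk≋ λ ε 0<ε → let δ , 0<δ , δ+δ≤ε = half ε 0<ε in
        ev-zip (λ n p q → begin
          ‖ (u n ⊕ v n) ⊖ (u′ n ⊕ v′ n) ‖    ≡⟨ cong ‖_‖ (⊕⊖ (u n) (v n) (u′ n) (v′ n)) ⟩
          ‖ (u n ⊖ u′ n) ⊕ (v n ⊖ v′ n) ‖    ≤⟨ ‖⊕‖ (u n ⊖ u′ n) (v n ⊖ v′ n) ⟩
          ‖ u n ⊖ u′ n ‖ + ‖ v n ⊖ v′ n ‖    ≤⟨ ℚ.+-mono-≤ p q ⟩
          δ + δ                              ≤⟨ δ+δ≤ε ⟩
          ε                                  ∎) (close h δ 0<δ) (close h′ δ 0<δ)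

      ⊗-cong-≋ : ∀ {u u′ v v′} → Bounded u → Bounded v′ → u ≋ u′ → v ≋ v′ → (λ n → u n ⊗ v n) ≋ (λ n → u′ n ⊗ v′ n)
      ⊗-cong-≋ {u} {u′} {v} {v′} (mkBounded A 0≤A hA) (mkBounded B 0≤B hB) h h′ = ≋-scaled (λ n → u n ⊗ v n) (λ n → u′ n ⊗ v′ n) (A + B) (0≤p+q 0≤A 0≤B) λ δ 0<δ →
        ev-zip (λ n p q → begin
          ‖ u n ⊗ v n ⊖ u′ n ⊗ v′ n ‖
            ≡⟨ cong ‖_‖ (𝔾.solve 4 (λ a b c d → a 𝔾.:* b 𝔾.:- c 𝔾.:* d 𝔾.:= a 𝔾.:* (b 𝔾.:- d) 𝔾.:+ (a 𝔾.:- c) 𝔾.:* d) refl (u n) (v n) (u′ n) (v′ n)) ⟩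
          ‖ u n ⊗ (v n ⊖ v′ n) ⊕ (u n ⊖ u′ n) ⊗ v′ n ‖
            ≤⟨ ‖⊕‖ (u n ⊗ (v n ⊖ v′ n)) ((u n ⊖ u′ n) ⊗ v′ n) ⟩
          ‖ u n ⊗ (v n ⊖ v′ n) ‖ + ‖ (u n ⊖ u′ n) ⊗ v′ n ‖
            ≤⟨ ℚ.+-mono-≤ (‖⊗‖ (u n) (v n ⊖ v′ n)) (‖⊗‖ (u n ⊖ u′ n) (v′ n)) ⟩
          ‖ u n ‖ * ‖ v n ⊖ v′ n ‖ + ‖ u n ⊖ u′ n ‖ * ‖ v′ n ‖
            ≤⟨ ℚ.+-mono-≤ (*-mono (0≤‖‖ (u n)) (ℚ.<⇒≤ 0<δ) (hA n) q) (*-mono (0≤‖‖ (u n ⊖ u′ n)) 0≤B p (hB n)) ⟩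
          A * δ + δ * B
            ≡⟨ solve 3 (λ A B d → A :* d :+ d :* B := (A :+ B) :* d) refl A B δ ⟩
          (A + B) * δ ∎) (close h δ 0<δ) (close h′ δ 0<δ)

      -- On a bounded set the partial sums of the exponential have a Lipschitz constant independent
      -- of the point of truncation.
      expS-cong : ∀ {u v} → Bounded u → Bounded v → u ≋ v → expS u ≋ expS v
      expS-cong {u} {v} (mkBounded A 0≤A hA) (mkBounded B 0≤B hB) h with geometric ((A + B) + 1ℚ) (0≤p+q (0≤p+q 0≤A 0≤B) 0≤1)
      ... | C , 0≤C , hC = ≋-scaled (expS u) (expS v) D 0≤D λ δ 0<δ → ev-map (λ n p → begin
          ‖ expSum (u n) n ⊖ expSum (v n) n ‖            ≤⟨ sum-lipschitz {L} {C} (u n) (v n) 0≤L (ℚ.+-monoˡ-≤ 1ℚ (ℚ.≤-trans (hA n) (p≤p+q 0≤B)))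
                                                              (ℚ.≤-trans (hB n) (ℚ.≤-trans (p≤q+p 0≤A) (p≤p+q 0≤1))) hC n ⟩
          ‖ u n ⊖ v n ‖ * (D - D * half^ n)              ≤⟨ *-mono (0≤‖‖ (u n ⊖ v n)) 0≤D p (drop-nonNeg (0≤p*q 0≤D (0≤half^ n))) ⟩
          δ * D                                          ≡⟨ ℚ.*-comm δ D ⟩
          D * δ                                          ∎) (close h δ 0<δ)
        where
        L D : ℚ
        L = (A + B) + 1ℚ
        D = 2ℚ * C
        0≤L : 0ℚ ≤ L
        0≤L = 0≤p+q (0≤p+q 0≤A 0≤B) 0≤1
        0≤D : 0ℚ ≤ D
        0≤D = 0≤p*q 0≤2 0≤C

      expS-⊕ : ∀ {u v} → Bounded u → Bounded v → (λ n → expS u n ⊗ expS v n) ≋ expS (λ n → u n ⊕ v n)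
      expS-⊕ {u} {v} (mkBounded A 0≤A hA) (mkBounded B 0≤B hB) =
        let K , 0≤K , hK = expSum-⊕-close (A + B) (0≤p+q 0≤A 0≤B) in
        ≋-scaled (λ n → expS u n ⊗ expS v n) (expS (λ n → u n ⊕ v n)) K 0≤K λ δ 0<δ → ev-map (λ n p → ℚ.≤-trans
          (hK (u n) (v n) n (ℚ.≤-trans (hA n) (p≤p+q 0≤B)) (ℚ.≤-trans (hB n) (p≤q+p 0≤A))) (*-monoˡ 0≤K p)) (ι*half^→0 δ 0<δ)

  open Sequences public

  -- Logarithms and powers are multiplicative

  module Logarithm where
    open ℚ.≤-Reasoning

    logᶜ : ℕ → ℂ
    logᶜ n = fromℝ (log n)

    abstract
      -- The Riemann sum for the logarithm of `(a + 1) (b + 1)` is cut at `a + 1`. By the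
      -- substitution `t = (a + 1) u`, the rest is the sum for `log (b + 1)` with the finer mesh
      -- `1 / (c a m + 1)`; only the mesh is left to compare.
      logSeq-* : ∀ a b m → logSeq (suc a ℕ.* suc b) m ≡ U a m + U b (c a m)
      logSeq-* a b m = trans (cong (λ n → ∑< n (λ i → recip (m ℕ.+ i))) (length a b m))
        (trans (∑<-split (a ℕ.* suc m) (b ℕ.* suc (c a m)) (λ i → recip (m ℕ.+ i)))
          (cong (U a m +_) (∑<-cong (b ℕ.* suc (c a m)) λ i → cong recip (sym (ℕ.+-assoc m (a ℕ.* suc m) i)))))
        where
        length : ∀ a b m → (b ℕ.+ a ℕ.* suc b) ℕ.* suc m ≡ a ℕ.* suc m ℕ.+ b ℕ.* suc (m ℕ.+ a ℕ.* suc m)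
        length = solve-∀
        ∑<-cong : ∀ n {f g} → (∀ i → f i ≡ g i) → ∑< n f ≡ ∑< n g
        ∑<-cong zero    h = refl
        ∑<-cong (suc n) h = cong₂ _+_ (∑<-cong n h) (h n)

      log-* : ∀ {a b} → Positive a → Positive b → (logᶜ (a ℕ.* b) !_) ≋ (λ m → logᶜ a ! m ⊕ logᶜ b ! m)
      log-* {suc a} {suc b} _ _ = mk≋ λ ε 0<ε → let N , recipN≤ε = archimedean ε 0<ε in
        N , λ m N≤m → begin
          ∣ logSeq (suc a ℕ.* suc b) m - (U a m + U b m) ∣ + 0ℚ  ≡⟨ ℚ.+-identityʳ _ ⟩
          ∣ logSeq (suc a ℕ.* suc b) m - (U a m + U b m) ∣       ≡⟨ cong (λ t → ∣ t - (U a m + U b m) ∣) (logSeq-* a b m) ⟩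
          ∣ (U a m + U b (c a m)) - (U a m + U b m) ∣            ≡⟨ cong ∣_∣ (solve 3 (λ x y z → (x :+ y) :- (x :+ z) := y :- z) refl (U a m) (U b (c a m)) (U b m)) ⟩
          ∣ U b (c a m) - U b m ∣                                ≡⟨ ∣-∣-sym (U b (c a m)) (U b m) ⟩
          ∣ U b m - U b (c a m) ∣                                ≤⟨ U-close b m (a ℕ.* suc m) ⟩
          recip m                                                ≤⟨ recip-antimono N≤m ⟩
          recip N                                                ≤⟨ recipN≤ε ⟩
          ε                                                      ∎

      /1≡ι : ∀ n → ℤ.+ n ℚ./ 1 ≡ ι n
      /1≡ι n = ℚ.toℚᵘ-injective (ℚᵘ.≃-trans (ℚ.toℚᵘ-fromℚᵘ (ℚᵘ.mkℚᵘ (ℤ.+ n) 0)) (ℚᵘ.≃-sym (toℚᵘ-ι n)))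

      bounded-const : ∀ z → Bounded (λ _ → z)
      bounded-const z = mkBounded ‖ z ‖ (0≤‖‖ z) λ _ → ℚ.≤-refl

      log-^ : ∀ {a} → Positive a → ∀ e → (logᶜ (a ℕ.^ e) !_) ≋ (λ m → real (ι e) ⊗ logᶜ a ! m)
      log-^ {a} 0<a zero = ≋-reflexive λ m → 𝔾.solve 1 (λ x → 𝔾.con 0ᵍ 𝔾.:= 𝔾.con 0ᵍ 𝔾.:* x) refl (logᶜ a ! m)
      log-^ {a} 0<a (suc e) = ≋-trans (log-* 0<a (ℕ.m^n>0 a {{ℕ.>-nonZero 0<a}} e))
        (≋-trans (⊕-cong-≋ (≋-reflexive {logᶜ a !_} λ _ → refl) (log-^ 0<a e))
          (≋-reflexive λ m → identity (real (ι e)) (logᶜ a ! m)))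
        where
        identity : ∀ i x → x ⊕ i ⊗ x ≡ (i ⊕ 1ᵍ) ⊗ x
        identity = 𝔾.solve 2 (λ i x → x 𝔾.:+ i 𝔾.:* x 𝔾.:= (i 𝔾.:+ 𝔾.con 1ᵍ) 𝔾.:* x) refl

    exponent : ℂ → ℕ → ℂ
    exponent s n = -ᶜ (s *ᶜ logᶜ n)

    abstract
      neg-⊗-cong : ∀ s {u v} → Bounded v → u ≋ v → (λ m → ⊝ (s ! m ⊗ u m)) ≋ (λ m → ⊝ (s ! m ⊗ v m))
      neg-⊗-cong s {u} {v} bv h = ≋-trans (≋-reflexive λ m → neg (s ! m) (u m))
        (≋-trans (⊗-cong-≋ (bounded-! (-ᶜ s)) bv (≋-reflexive {(-ᶜ s) !_} λ _ → refl) h) (≋-reflexive λ m → sym (neg (s ! m) (v m))))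
        where
        neg : ∀ x y → ⊝ (x ⊗ y) ≡ ⊝ x ⊗ y
        neg = 𝔾.solve 2 (λ x y → 𝔾.:- (x 𝔾.:* y) 𝔾.:= 𝔾.:- x 𝔾.:* y) refl

      power-* : ∀ {a b} s → Positive a → Positive b → ((a ℕ.* b) ^- s !_) ≋ (λ m → a ^- s ! m ⊗ b ^- s ! m)
      power-* {a} {b} s 0<a 0<b = ≋-trans
        (expS-cong (bounded-! (exponent s (a ℕ.* b))) (bounded-⊕ (bounded-! (exponent s a)) (bounded-! (exponent s b)))
          (≋-trans (neg-⊗-cong s (bounded-⊕ (bounded-! (logᶜ a)) (bounded-! (logᶜ b))) (log-* 0<a 0<b))
            (≋-reflexive λ m → distrib (s ! m) (logᶜ a ! m) (logᶜ b ! m))))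
        (≋-sym (expS-⊕ (bounded-! (exponent s a)) (bounded-! (exponent s b))))
        where
        distrib : ∀ s x y → ⊝ (s ⊗ (x ⊕ y)) ≡ ⊝ (s ⊗ x) ⊕ ⊝ (s ⊗ y)
        distrib = 𝔾.solve 3 (λ s x y → 𝔾.:- (s 𝔾.:* (x 𝔾.:+ y)) 𝔾.:= 𝔾.:- (s 𝔾.:* x) 𝔾.:+ 𝔾.:- (s 𝔾.:* y)) refl

      power-^ : ∀ {a} s → Positive a → ∀ e → ((a ℕ.^ e) ^- s !_) ≋ (a ^- (e ·ᶜ s) !_)
      power-^ {a} s 0<a e = expS-cong (bounded-! (exponent s (a ℕ.^ e))) (bounded-! (exponent (e ·ᶜ s) a))
        (≋-trans (neg-⊗-cong s (bounded-⊗ (bounded-const (real (ι e))) (bounded-! (logᶜ a))) (log-^ 0<a e))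
          (≋-reflexive λ m → trans (assoc (s ! m) (real (ι e)) (logᶜ a ! m)) (cong (λ t → ⊝ ((real t ⊗ s ! m) ⊗ logᶜ a ! m)) (sym (/1≡ι e)))))
        where
        assoc : ∀ s i x → ⊝ (s ⊗ (i ⊗ x)) ≡ ⊝ ((i ⊗ s) ⊗ x)
        assoc = 𝔾.solve 3 (λ s i x → 𝔾.:- (s 𝔾.:* (i 𝔾.:* x)) 𝔾.:= 𝔾.:- ((i 𝔾.:* s) 𝔾.:* x)) refl

      expTerm-0 : ∀ j → expTerm 0ᵍ (suc j) ≡ 0ᵍ
      expTerm-0 j = trans (⊙≡⊗ (recip j) (expTerm 0ᵍ j ⊗ 0ᵍ)) (𝔾.solve 2 (λ r x → r 𝔾.:* (x 𝔾.:* 𝔾.con 0ᵍ) 𝔾.:= 𝔾.con 0ᵍ) refl (real (recip j)) (expTerm 0ᵍ j))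

      expSum-0 : ∀ n → expSum 0ᵍ (suc n) ≡ 1ᵍ
      expSum-0 zero    = refl
      expSum-0 (suc n) = trans (cong₂ _⊕_ (expSum-0 n) (expTerm-0 n)) refl

      expS-0 : ∀ {u} → (∀ n → u n ≡ 0ᵍ) → expS u ≋ (λ _ → 1ᵍ)
      expS-0 {u} h = mk≋ λ ε 0<ε → 1 , λ { (suc n) _ → ℚ.≤-trans
        (ℚ.≤-reflexive (cong (λ t → ‖ t ⊖ 1ᵍ ‖) (trans (cong (λ t → expSum t (suc n)) (h (suc n))) (expSum-0 n)))) (ℚ.<⇒≤ 0<ε) }

      power-1 : ∀ s → (1 ^- s !_) ≋ (λ _ → 1ᵍ)
      power-1 s = expS-0 λ n → 𝔾.solve 1 (λ s → 𝔾.:- (s 𝔾.:* 𝔾.con 0ᵍ) 𝔾.:= 𝔾.con 0ᵍ) refl (s ! n)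

  open Logarithm public

  module OrderedField where
    open ℚ.≤-Reasoning
    abstract
      p-q≤r⇒p≤q+r : ∀ {p q r} → p - q ≤ r → p ≤ q + r
      p-q≤r⇒p≤q+r {p} {q} {r} h = begin
        p             ≡⟨ solve 2 (λ p q → p := q :+ (p :- q)) refl p q ⟩
        q + (p - q)   ≤⟨ ℚ.+-monoʳ-≤ q h ⟩
        q + r         ∎

      p≤∣p∣ : ∀ p → p ≤ ∣ p ∣
      p≤∣p∣ p with ℚ.≤-total 0ℚ p
      ... | inj₁ 0≤p = ℚ.≤-reflexive (sym (ℚ.0≤p⇒∣p∣≡p 0≤p))
      ... | inj₂ p≤0 = ℚ.≤-trans p≤0 (ℚ.0≤∣p∣ p)

      0<p*q : ∀ {p q} → 0ℚ < p → 0ℚ < q → 0ℚ < p * q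
      0<p*q {p} {q} 0<p 0<q = ℚ.positive⁻¹ (p * q) {{ℚ.pos*pos⇒pos p {{ℚ.positive 0<p}} q {{ℚ.positive 0<q}}}}

      *-cancelˡ : ∀ {r p q} → 0ℚ < r → r * p ≤ r * q → p ≤ q
      *-cancelˡ {r} 0<r = ℚ.*-cancelˡ-≤-pos r {{ℚ.positive 0<r}}

      inverse : ∀ p → 0ℚ < p → ∃[ r ] 0ℚ < r × r * p ≡ 1ℚ
      inverse p 0<p = ℚ.1/ p , ℚ.positive⁻¹ (ℚ.1/ p) {{ℚ.1/pos⇒pos p}} , ℚ.*-inverseˡ p
        where
        instance
          _ : ℚ.Positive p
          _ = ℚ.positive 0<p
          _ : ℚ.NonZero p
          _ = ℚ.pos⇒nonZero p

      square-cancel-≤ : ∀ {p q} → 0ℚ ≤ q → p * p ≤ q * q → p ≤ q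
      square-cancel-≤ {p} {q} 0≤q h with p ℚ.≤? q
      ... | yes p≤q = p≤q
      ... | no  p≰q = contradiction refl (ℚ.<⇒≢ (ℚ.<-≤-trans (begin-strict
          q * q   ≤⟨ *-monoˡ 0≤q (ℚ.<⇒≤ q<p) ⟩
          q * p   <⟨ ℚ.*-monoˡ-<-pos p {{ℚ.positive (ℚ.≤-<-trans 0≤q q<p)}} q<p ⟩
          p * p   ∎) h))
        where
        q<p : q < p
        q<p = ℚ.≰⇒> p≰q

      0≤square : ∀ p → 0ℚ ≤ p * p
      0≤square p with ℚ.≤-total 0ℚ p
      ... | inj₁ 0≤p = 0≤p*q 0≤p 0≤p
      ... | inj₂ p≤0 = ℚ.≤-trans (0≤p*q 0≤-p 0≤-p) (ℚ.≤-reflexive (solve 1 (λ p → :- p :* :- p := p :* p) refl p))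
        where
        0≤-p : 0ℚ ≤ - p
        0≤-p = ℚ.neg-antimono-≤ p≤0
  open OrderedField public

  normSq : ℚ[i] → ℚ
  normSq (x , y) = x * x + y * y

  conj : ℚ[i] → ℚ[i]
  conj (x , y) = x , - y

  rexp : ℚ → ℕ → ℚ
  rexp x n = proj₁ (expSum (real x) n)

  -- Conjugation, and lower bounds for the real exponential

  module RealExponential where
    open ℚ.≤-Reasoning

    abstract
      ⊗-conj : ∀ z → z ⊗ conj z ≡ real (normSq z)
      ⊗-conj (x , y) = cong₂ _,_ (solve 2 (λ x y → x :* x :- y :* :- y := x :* x :+ y :* y) refl x y)
        (solve 2 (λ x y → x :* :- y :+ y :* x := con 0ℚ) refl x y)

      conj-expTerm : ∀ z j → conj (expTerm z j) ≡ expTerm (conj z) j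
      conj-expTerm z zero    = refl
      conj-expTerm z (suc j) = trans (step (recip j) (expTerm z j) z) (cong (λ t → recip j ⊙ (t ⊗ conj z)) (conj-expTerm z j))
        where
        step : ∀ r t z → conj (r ⊙ (t ⊗ z)) ≡ r ⊙ (conj t ⊗ conj z)
        step r (a , b) (x , y) = cong₂ _,_
          (solve 5 (λ r a b x y → r :* (a :* x :- b :* y) := r :* (a :* x :- :- b :* :- y)) refl r a b x y)
          (solve 5 (λ r a b x y → :- (r :* (a :* y :+ b :* x)) := r :* (a :* :- y :+ :- b :* x)) refl r a b x y)

      conj-expSum : ∀ z n → conj (expSum z n) ≡ expSum (conj z) n
      conj-expSum z zero    = refl
      conj-expSum z (suc n) = trans (cong₂ _,_ refl (ℚ.neg-distrib-+ (proj₂ (expSum z n)) (proj₂ (expTerm z n))))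
        (cong₂ _⊕_ (conj-expSum z n) (conj-expTerm z n))

      im-expTerm : ∀ x j → proj₂ (expTerm (real x) j) ≡ 0ℚ
      im-expTerm x zero    = refl
      im-expTerm x (suc j) = trans (cong (λ t → recip j * (proj₁ (expTerm (real x) j) * 0ℚ + t * x)) (im-expTerm x j))
        (solve 3 (λ r a x → r :* (a :* con 0ℚ :+ con 0ℚ :* x) := con 0ℚ) refl (recip j) (proj₁ (expTerm (real x) j)) x)

      im-expSum : ∀ x n → proj₂ (expSum (real x) n) ≡ 0ℚ
      im-expSum x zero    = refl
      im-expSum x (suc n) = cong₂ _+_ (im-expSum x n) (im-expTerm x n)

      expSum-real : ∀ x n → expSum (real x) n ≡ real (rexp x n)
      expSum-real x n = cong (rexp x n ,_) (im-expSum x n)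

      0≤re-expTerm : ∀ {x} → 0ℚ ≤ x → ∀ j → 0ℚ ≤ proj₁ (expTerm (real x) j)
      0≤re-expTerm 0≤x zero = 0≤1
      0≤re-expTerm {x} 0≤x (suc j) = 0≤p*q (0≤recip j) (ℚ.≤-trans (0≤p*q (0≤re-expTerm 0≤x j) 0≤x)
        (ℚ.≤-reflexive (solve 3 (λ a b x → a :* x := a :* x :- b :* con 0ℚ) refl (proj₁ (expTerm (real x) j)) (proj₂ (expTerm (real x) j)) x)))

      0≤rexp : ∀ {x} → 0ℚ ≤ x → ∀ n → 0ℚ ≤ rexp x n
      0≤rexp 0≤x zero    = ℚ.≤-refl
      0≤rexp 0≤x (suc n) = 0≤p+q (0≤rexp 0≤x n) (0≤re-expTerm 0≤x n)

      -- The first two terms of the series, both present from `n = 2` on; the others are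
      -- nonnegative.
      1+x≤rexp : ∀ {x} → 0ℚ ≤ x → ∀ n → 2 ℕ.≤ n → 1ℚ + x ≤ rexp x n
      1+x≤rexp 0≤x (suc zero) (s≤s ())
      1+x≤rexp {x} 0≤x (suc (suc zero)) _ = ℚ.≤-reflexive
        (solve 1 (λ x → con 1ℚ :+ x := (con 0ℚ :+ con 1ℚ) :+ con 1ℚ :* (con 1ℚ :* x :- con 0ℚ :* con 0ℚ)) refl x)
      1+x≤rexp {x} 0≤x (suc (suc (suc n))) _ = ℚ.≤-trans (1+x≤rexp 0≤x (suc (suc n)) (s≤s (s≤s z≤n))) (p≤p+q (0≤re-expTerm 0≤x (suc (suc n))))

      rexp-+ : ∀ {x y : ℕ → ℚ} → Bounded (λ n → real (x n)) → Bounded (λ n → real (y n)) → ∀ ε → 0ℚ < ε →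
        Eventually (λ n → rexp (x n) n * rexp (y n) n ≤ rexp (x n + y n) n + ε)
      rexp-+ {x} {y} bx by ε 0<ε = ev-map (λ n p → p-q≤r⇒p≤q+r (begin
          rexp (x n) n * rexp (y n) n - rexp (x n + y n) n
            ≤⟨ p≤∣p∣ _ ⟩
          ∣ rexp (x n) n * rexp (y n) n - rexp (x n + y n) n ∣
            ≤⟨ p≤p+q (ℚ.0≤∣p∣ 0ℚ) ⟩
          ‖ real (rexp (x n) n * rexp (y n) n) ⊖ real (rexp (x n + y n) n) ‖
            ≡⟨ cong₂ (λ a b → ‖ a ⊖ b ‖) (trans (real-* (rexp (x n) n) (rexp (y n) n)) (sym (cong₂ _⊗_ (expSum-real (x n) n) (expSum-real (y n) n)))) (sym (expSum-real (x n + y n) n)) ⟩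
          ‖ expSum (real (x n)) n ⊗ expSum (real (y n)) n ⊖ expSum (real (x n + y n)) n ‖
            ≤⟨ p ⟩
          ε ∎)) (close (expS-⊕ bx by) ε 0<ε)

      -- `‖_‖` is the ℓ¹ norm, which needs no square root; the identity (a + b)² + (a - b)² = 2 (a²
      -- + b²) bounds it by the Euclidean norm.
      ‖‖²≤2normSq : ∀ z → ‖ z ‖ * ‖ z ‖ ≤ 2ℚ * normSq z
      ‖‖²≤2normSq (x , y) = begin
        (u + v) * (u + v)                          ≤⟨ p≤p+q (0≤square (u - v)) ⟩
        (u + v) * (u + v) + (u - v) * (u - v)      ≡⟨ solve 2 (λ a b → (a :+ b) :* (a :+ b) :+ (a :- b) :* (a :- b) := (con 1ℚ :+ con 1ℚ) :* (a :* a :+ b :* b)) refl u v ⟩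
        2ℚ * (u * u + v * v)                       ≡⟨ cong₂ (λ s t → 2ℚ * (s + t)) (square x) (square y) ⟩
        2ℚ * (x * x + y * y)                       ∎
        where
        u v : ℚ
        u = ∣ x ∣
        v = ∣ y ∣
        square : ∀ x → ∣ x ∣ * ∣ x ∣ ≡ x * x
        square x = trans (sym (ℚ.∣p*q∣≡∣p∣*∣q∣ x x)) (ℚ.0≤p⇒∣p∣≡p (0≤square x))

      0≤normSq : ∀ z → 0ℚ ≤ normSq z
      0≤normSq (x , y) = 0≤p+q (0≤square x) (0≤square y)
  open RealExponential public

  -- A rational bound for the size of n⁻ˢ

  module PowerBound (s : ℂ) where
    open ℚ.≤-Reasoning

    realExponent : ℕ → ℕ → ℚ
    realExponent n m = seq (re s) m * logSeq n m

    abstract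
      bounded-realExponent : ∀ n → Bounded (λ m → real (realExponent n m))
      bounded-realExponent n = bounded-resp (λ m → sym (real-* (seq (re s) m) (logSeq n m)))
        (bounded-⊗ (bounded-! (fromℝ (re s))) (bounded-! (fromℝ (log n))))

      bounded-conj : ∀ {u} → Bounded u → Bounded (λ m → conj (u m))
      bounded-conj {u} (mkBounded K 0≤K h) = mkBounded K 0≤K λ m → subst (λ t → ∣ proj₁ (u m) ∣ + t ≤ K) (sym (ℚ.∣-p∣≡∣p∣ (proj₂ (u m)))) (h m)

      -- |n⁻ˢ|² = exp (u + ū) for u = - s log n, and u + ū = - 2 Re s log n.
      normSq-^- : ∀ n → (λ m → real (normSq (n ^- s ! m) * (rexp (realExponent n m) m * rexp (realExponent n m) m))) ≋ (λ _ → 1ᵍ)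
      normSq-^- n = ≋-trans (≋-reflexive pointwise)
        (≋-trans (⊗-cong-≋ (bounded-⊗ (bounded-expS bu) (bounded-expS bū)) (bounded-expS (bounded-⊕ bx bx)) (expS-⊕ bu bū) (expS-⊕ bx bx))
        (≋-trans (expS-⊕ (bounded-⊕ bu bū) (bounded-⊕ bx bx))
          (expS-0 λ m → zero-exponent (seq (re s) m) (seq (im s) m) (logSeq n m))))
        where
        u x : Seq
        u m = exponent s n ! m
        x m = real (realExponent n m)
        bu : Bounded u
        bu = bounded-! (exponent s n)
        bū : Bounded (λ m → conj (u m))
        bū = bounded-conj bu
        bx : Bounded x
        bx = bounded-realExponent n
        pointwise : ∀ m → real (normSq (n ^- s ! m) * (rexp (realExponent n m) m * rexp (realExponent n m) m))
          ≡ (expS u m ⊗ expS (λ m → conj (u m)) m) ⊗ (expS x m ⊗ expS x m)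
        pointwise m =
          trans (trans (real-* N (e * e)) (cong (real N ⊗_) (real-* e e)))
            (trans (sym (cong₂ _⊗_ (⊗-conj (expS u m)) (cong₂ _⊗_ (expSum-real (realExponent n m) m) (expSum-real (realExponent n m) m))))
              (cong (λ t → (expS u m ⊗ t) ⊗ (expS x m ⊗ expS x m)) (conj-expSum (u m) m)))
          where
          N e : ℚ
          N = normSq (expS u m)
          e = rexp (realExponent n m) m
        zero-exponent : ∀ σ τ l → (⊝ ((σ , τ) ⊗ (l , 0ℚ)) ⊕ conj (⊝ ((σ , τ) ⊗ (l , 0ℚ)))) ⊕ (real (σ * l) ⊕ real (σ * l)) ≡ 0ᵍ
        zero-exponent σ τ l = cong₂ _,_
          (solve 3 (λ σ τ l → (:- (σ :* l :- τ :* con 0ℚ) :+ :- (σ :* l :- τ :* con 0ℚ)) :+ (σ :* l :+ σ :* l) := con 0ℚ) refl σ τ l)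
          (solve 3 (λ σ τ l → (:- (σ :* con 0ℚ :+ τ :* l) :+ :- (:- (σ :* con 0ℚ :+ τ :* l))) :+ (con 0ℚ :+ con 0ℚ) := con 0ℚ) refl σ τ l)

      normSq-bound : ∀ n → Eventually (λ m → normSq (n ^- s ! m) * (rexp (realExponent n m) m * rexp (realExponent n m) m) ≤ 2ℚ)
      normSq-bound n = ev-map (λ m p → p-q≤r⇒p≤q+r {lhs m} {1ℚ} {1ℚ} (ℚ.≤-trans (p≤∣p∣ (lhs m - 1ℚ)) (ℚ.≤-trans (p≤p+q (ℚ.0≤∣p∣ 0ℚ)) p)))
          (close (normSq-^- n) 1ℚ 0<1)
        where
        lhs : ℕ → ℚ
        lhs m = normSq (n ^- s ! m) * (rexp (realExponent n m) m * rexp (realExponent n m) m)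

    -- The approximant of log (i + 2) - log (i + 1): the part of the Riemann sum over the interval
    -- from `i + 1` to `i + 2`.
    step : ℕ → ℕ → ℚ
    step i m = ∑< (suc m) (λ j → recip (m ℕ.+ (i ℕ.* suc m ℕ.+ j)))

    abstract
      logSeq-suc : ∀ i m → logSeq (suc (suc i)) m ≡ logSeq (suc i) m + step i m
      logSeq-suc i m = trans (cong (λ n → ∑< n (λ j → recip (m ℕ.+ j))) (ℕ.+-comm (suc m) (i ℕ.* suc m))) (∑<-split (i ℕ.* suc m) (suc m) (λ j → recip (m ℕ.+ j)))

      -- Each of the `m + 1` terms is at least 1 / ((m + 1) (i + 2)), the value of the integrand at
      -- the right end times the mesh.
      recip≤step : ∀ i m → recip (suc i) ≤ step i m
      recip≤step i m = begin
        recip (suc i)                           ≡⟨ ι-recip-c m (suc i) ⟨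
        ι (suc m) * recip (c m (suc i))         ≡⟨ ∑<-const (suc m) (recip (c m (suc i))) ⟨
        ∑< (suc m) (λ _ → recip (c m (suc i)))  ≤⟨ ∑<-mono (suc m) (λ j j<m → recip-antimono (ℕ.≤-trans (ℕ.+-monoʳ-≤ m (ℕ.+-monoʳ-≤ (i ℕ.* suc m) (ℕ.≤-pred j<m))) (ℕ.≤-trans (ℕ.n≤1+n _) (ℕ.≤-reflexive (count m i))))) ⟩
        step i m                                ∎
        where
        count : ∀ m i → suc (m ℕ.+ (i ℕ.* suc m ℕ.+ m)) ≡ suc i ℕ.+ m ℕ.* suc (suc i)
        count = solve-∀

      0≤logSeq : ∀ n m → 0ℚ ≤ logSeq n m
      0≤logSeq n m = ∑<-nonNeg ((n ℕ.∸ 1) ℕ.* suc m) (λ i → 0≤recip (m ℕ.+ i))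

    module _ (q : ℚ) (0≤q : 0ℚ ≤ q) (q≤re : Eventually (λ m → q ≤ seq (re s) m)) where

      -- With σ = Re s ≥ q, the quotient of e^{σ log (i + 2)} and e^{σ log (i + 1)} is at least
      -- 1 + σ (log (i + 2) - log (i + 1)) ≥ 1 + q / (i + 2).
      growth : ℕ → ℚ
      growth zero    = 1ℚ
      growth (suc i) = growth i * (1ℚ + q * recip (suc i))

      abstract
        0<factor : ∀ i → 0ℚ < 1ℚ + q * recip (suc i)
        0<factor i = ℚ.<-≤-trans 0<1 (p≤p+q (0≤p*q 0≤q (0≤recip (suc i))))

        0<growth : ∀ i → 0ℚ < growth i
        0<growth zero    = 0<1
        0<growth (suc i) = 0<p*q (0<growth i) (0<factor i)

        -- The addition theorem holds for approximants only up to a small error, hence the arbitrary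
        -- slack `η`.
        growth≤rexp : ∀ i η → 0ℚ < η → Eventually (λ m → growth i ≤ rexp (realExponent (suc i) m) m + η)
        growth≤rexp zero η 0<η = 2 , λ m 2≤m → begin
          1ℚ                                    ≡⟨ solve 1 (λ σ → con 1ℚ := con 1ℚ :+ σ :* con 0ℚ) refl (seq (re s) m) ⟩
          1ℚ + seq (re s) m * 0ℚ                ≤⟨ 1+x≤rexp (ℚ.≤-reflexive (sym (ℚ.*-zeroʳ (seq (re s) m)))) m 2≤m ⟩
          rexp (seq (re s) m * 0ℚ) m            ≤⟨ p≤p+q (ℚ.<⇒≤ 0<η) ⟩
          rexp (seq (re s) m * 0ℚ) m + η        ∎
        growth≤rexp (suc i) η 0<η =
          let η₁ , 0<η₁ , η₁+η₁≤η = half η 0<η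
              -- The error of the induction hypothesis is multiplied by `f`; the addition theorem
              -- adds a second error `η₁`.
              η₂ , 0<η₂ , fη₂<η₁ = shrink f (ℚ.<⇒≤ (0<factor i)) η₁ 0<η₁
          in ev-zip {λ m → q ≤ seq (re s) m × 2 ℕ.≤ m} {λ m → growth i ≤ rexp (x m) m + η₂ × rexp (x m) m * rexp (y m) m ≤ rexp (x m + y m) m + η₁}
               (λ m pr pr′ → estimate η₁ η₂ η₁+η₁≤η fη₂<η₁ m (proj₁ pr) (proj₂ pr) (proj₁ pr′) (proj₂ pr′))
               (ev-zip (λ m → _,_) q≤re (ev-≥ 2)) (ev-zip (λ m → _,_) (growth≤rexp i η₂ 0<η₂) (rexp-+ {x} {y} bx by η₁ 0<η₁))
          where
          f : ℚ
          f = 1ℚ + q * recip (suc i)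
          x y : ℕ → ℚ
          x m = realExponent (suc i) m
          y m = seq (re s) m * step i m
          bx : Bounded (λ m → real (x m))
          bx = bounded-realExponent (suc i)
          x+y : ∀ m → realExponent (suc (suc i)) m ≡ x m + y m
          x+y m = trans (cong (seq (re s) m *_) (logSeq-suc i m)) (ℚ.*-distribˡ-+ (seq (re s) m) (logSeq (suc i) m) (step i m))
          -- `y` is bounded as the difference of the exponents for `i + 2` and `i + 1`.
          by : Bounded (λ m → real (y m))
          by = bounded-resp (λ m → cong₂ _,_
                (trans (cong (λ t → t + ((- 1ℚ) * x m - 0ℚ * 0ℚ)) (x+y m)) (solve 2 (λ x y → (x :+ y) :+ (con (- 1ℚ) :* x :- con 0ℚ :* con 0ℚ) := y) refl (x m) (y m)))
                (solve 1 (λ x → con 0ℚ :+ (con (- 1ℚ) :* con 0ℚ :+ con 0ℚ :* x) := con 0ℚ) refl (x m)))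
              (bounded-⊕ (bounded-realExponent (suc (suc i))) (bounded-⊗ (bounded-const (real (- 1ℚ))) bx))
          estimate : ∀ η₁ η₂ → η₁ + η₁ ≤ η → f * η₂ < η₁ → ∀ m → q ≤ seq (re s) m → 2 ℕ.≤ m → growth i ≤ rexp (x m) m + η₂ →
            rexp (x m) m * rexp (y m) m ≤ rexp (x m + y m) m + η₁ → growth i * f ≤ rexp (realExponent (suc (suc i)) m) m + η
          estimate η₁ η₂ η₁+η₁≤η fη₂<η₁ m q≤σ 2≤m low add = begin
            growth i * f                                   ≤⟨ *-monoʳ (ℚ.<⇒≤ (0<factor i)) low ⟩
            (rexp (x m) m + η₂) * f                        ≡⟨ solve 3 (λ e d f → (e :+ d) :* f := e :* f :+ f :* d) refl (rexp (x m) m) η₂ f ⟩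
            rexp (x m) m * f + f * η₂                      ≤⟨ ℚ.+-mono-≤ (*-monoˡ (0≤rexp 0≤x m) f≤rexp) (ℚ.<⇒≤ fη₂<η₁) ⟩
            rexp (x m) m * rexp (y m) m + η₁               ≤⟨ ℚ.+-monoˡ-≤ η₁ add ⟩
            (rexp (x m + y m) m + η₁) + η₁                 ≡⟨ ℚ.+-assoc (rexp (x m + y m) m) η₁ η₁ ⟩
            rexp (x m + y m) m + (η₁ + η₁)                 ≤⟨ ℚ.+-monoʳ-≤ (rexp (x m + y m) m) η₁+η₁≤η ⟩
            rexp (x m + y m) m + η                         ≡⟨ cong (λ t → rexp t m + η) (x+y m) ⟨
            rexp (realExponent (suc (suc i)) m) m + η      ∎
            where
            0≤σ : 0ℚ ≤ seq (re s) m
            0≤σ = ℚ.≤-trans 0≤q q≤σ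
            0≤x : 0ℚ ≤ x m
            0≤x = 0≤p*q 0≤σ (0≤logSeq (suc i) m)
            0≤step : 0ℚ ≤ step i m
            0≤step = ℚ.≤-trans (0≤recip (suc i)) (recip≤step i m)
            f≤rexp : f ≤ rexp (y m) m
            f≤rexp = ℚ.≤-trans (ℚ.+-monoʳ-≤ 1ℚ (*-mono 0≤q 0≤step q≤σ (recip≤step i m))) (1+x≤rexp (0≤p*q 0≤σ 0≤step) m 2≤m)

        -- With slack `growth i / 2`, the exponential e is at least g / 2. Writing N for `normSq z`,
        -- where N e² ≤ 2, this gives g² ‖z‖² ≤ 2 g² N ≤ 8 N e² ≤ 16.
        growth*‖^-‖≤4 : ∀ i → Eventually (λ m → growth i * ‖ suc i ^- s ! m ‖ ≤ 2ℚ * 2ℚ)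
        growth*‖^-‖≤4 i = ev-zip (λ m → estimate m) (growth≤rexp i (½ * growth i) (0<p*q (ℚ.positive⁻¹ ½) (0<growth i))) (normSq-bound (suc i))
          where
          estimate : ∀ m → growth i ≤ rexp (realExponent (suc i) m) m + ½ * growth i →
            normSq (suc i ^- s ! m) * (rexp (realExponent (suc i) m) m * rexp (realExponent (suc i) m) m) ≤ 2ℚ →
            growth i * ‖ suc i ^- s ! m ‖ ≤ 2ℚ * 2ℚ
          estimate m low up = square-cancel-≤ (0≤p*q 0≤2 0≤2) (begin
            (g * n) * (g * n)                               ≡⟨ solve 2 (λ g n → (g :* n) :* (g :* n) := (g :* g) :* (n :* n)) refl g n ⟩
            (g * g) * (n * n)                               ≤⟨ *-monoˡ (0≤p*q 0≤g 0≤g) (‖‖²≤2normSq z) ⟩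
            (g * g) * (2ℚ * normSq z)                       ≡⟨ solve 2 (λ g N → (g :* g) :* ((con 1ℚ :+ con 1ℚ) :* N) := con 8ℚ :* (N :* ((con ½ :* g) :* (con ½ :* g)))) refl g (normSq z) ⟩
            8ℚ * (normSq z * ((½ * g) * (½ * g)))           ≤⟨ *-monoˡ 0≤8 (*-monoˡ (0≤normSq z) (*-mono 0≤½g (ℚ.≤-trans 0≤½g ½g≤e) ½g≤e ½g≤e)) ⟩
            8ℚ * (normSq z * (e * e))                       ≤⟨ *-monoˡ 0≤8 up ⟩
            8ℚ * 2ℚ                                         ≡⟨ refl ⟩
            (2ℚ * 2ℚ) * (2ℚ * 2ℚ)                           ∎)
            where
            z : ℚ[i]
            z = suc i ^- s ! m
            g n e : ℚ
            g = growth i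
            n = ‖ z ‖
            e = rexp (realExponent (suc i) m) m
            0≤g : 0ℚ ≤ g
            0≤g = ℚ.<⇒≤ (0<growth i)
            0≤½g : 0ℚ ≤ ½ * g
            0≤½g = 0≤p*q 0≤½ 0≤g
            ½g≤e : ½ * g ≤ e
            ½g≤e = begin
              ½ * g             ≡⟨ solve 1 (λ g → con ½ :* g := g :- con ½ :* g) refl g ⟩
              g - ½ * g         ≤⟨ ℚ.+-monoˡ-≤ (- (½ * g)) low ⟩
              e + ½ * g - ½ * g ≡⟨ solve 2 (λ e h → e :+ h :- h := e) refl e (½ * g) ⟩
              e                 ∎

  -- Divergence of the harmonic series, with a rate

  module Harmonic where
    open ℚ.≤-Reasoning
    abstract
      -- Oresme's step: each of the `m + 1` new terms is at least 1 / (2 (m + 1)).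
      H-double : ∀ m → H (suc m) + ½ ≤ H (suc m ℕ.+ suc m)
      H-double m = begin
        H (suc m) + ½                                       ≡⟨ cong (λ t → H (suc m) + t) (ι-recip-c m 1) ⟨
        H (suc m) + ι (suc m) * recip (c m 1)               ≡⟨ cong (λ t → H (suc m) + t) (∑<-const (suc m) (recip (c m 1))) ⟨
        H (suc m) + ∑< (suc m) (λ _ → recip (c m 1))        ≤⟨ ℚ.+-monoʳ-≤ (H (suc m)) (∑<-mono (suc m) (λ i i<m → recip-antimono (ℕ.≤-trans (ℕ.+-monoʳ-≤ (suc m) (ℕ.≤-pred i<m)) (ℕ.≤-reflexive (count m))))) ⟩
        H (suc m) + ∑< (suc m) (λ i → recip (suc m ℕ.+ i))  ≡⟨ ∑<-split (suc m) (suc m) recip ⟨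
        H (suc m ℕ.+ suc m)                                 ∎
        where
        count : ∀ m → suc m ℕ.+ m ≡ 1 ℕ.+ m ℕ.* 2
        count = solve-∀

      H-2^ : ∀ j → ½ * ι j ≤ H (2 ℕ.^ j)
      H-2^ zero    = 0≤p+q ℚ.≤-refl 0≤1
      H-2^ (suc j) = begin
        ½ * (ι j + 1ℚ)             ≡⟨ solve 1 (λ i → con ½ :* (i :+ con 1ℚ) := con ½ :* i :+ con ½) refl (ι j) ⟩
        ½ * ι j + ½                ≤⟨ ℚ.+-monoˡ-≤ ½ (H-2^ j) ⟩
        H (2 ℕ.^ j) + ½            ≤⟨ double (2 ℕ.^ j) (ℕ.m^n>0 2 j) ⟩
        H (2 ℕ.^ j ℕ.+ 2 ℕ.^ j)    ≡⟨ cong (λ t → H (2 ℕ.^ j ℕ.+ t)) (ℕ.+-identityʳ (2 ℕ.^ j)) ⟨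
        H (2 ℕ.^ suc j)            ∎
        where
        double : ∀ n → 0 ℕ.< n → H n + ½ ≤ H (n ℕ.+ n)
        double (suc m) _ = H-double m
  open Harmonic public

  -- The telescoping majorant and its tails

  module Majorant (s : ℂ) (ε : ℚ) (0<ε : 0ℚ < ε) (1+ε≤re : Eventually (λ m → 1ℚ + ε ≤ seq (re s) m)) where
    open PowerBound s
    open ℚ.≤-Reasoning

    q : ℚ
    q = 1ℚ + ε

    0≤ε : 0ℚ ≤ ε
    0≤ε = ℚ.<⇒≤ 0<ε

    0≤q : 0ℚ ≤ q
    0≤q = 0≤p+q 0≤1 0≤ε

    g : ℕ → ℚ
    g = growth q 0≤q 1+ε≤re

    0<g : ∀ i → 0ℚ < g i
    0<g = 0<growth q 0≤q 1+ε≤re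

    -- Indices are shifted: `β i` is β_n of the overview for n = i + 1, and `T i` is (n + 1) β_n.
    β : ℕ → ℚ
    β i = proj₁ (inverse (g i) (0<g i))

    T : ℕ → ℚ
    T i = β i * ι (suc (suc i))

    abstract
      0<β : ∀ i → 0ℚ < β i
      0<β i = proj₁ (proj₂ (inverse (g i) (0<g i)))

      β*g≡1 : ∀ i → β i * g i ≡ 1ℚ
      β*g≡1 i = proj₂ (proj₂ (inverse (g i) (0<g i)))

      0≤T : ∀ i → 0ℚ ≤ T i
      0≤T i = 0≤p*q (ℚ.<⇒≤ (0<β i)) (0≤ι (suc (suc i)))

      β-suc : ∀ i → β i ≡ β (suc i) * (1ℚ + q * recip (suc i))
      β-suc i = begin-equality
        β i                                                     ≡⟨ ℚ.*-identityʳ (β i) ⟨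
        β i * 1ℚ                                                ≡⟨ cong (β i *_) (β*g≡1 (suc i)) ⟨
        β i * (β (suc i) * (g i * (1ℚ + q * recip (suc i))))    ≡⟨ solve 4 (λ b c g f → b :* (c :* (g :* f)) := (b :* g) :* (c :* f)) refl (β i) (β (suc i)) (g i) (1ℚ + q * recip (suc i)) ⟩
        β i * g i * (β (suc i) * (1ℚ + q * recip (suc i)))      ≡⟨ cong (_* (β (suc i) * (1ℚ + q * recip (suc i)))) (β*g≡1 i) ⟩
        1ℚ * (β (suc i) * (1ℚ + q * recip (suc i)))             ≡⟨ ℚ.*-identityˡ _ ⟩
        β (suc i) * (1ℚ + q * recip (suc i))                    ∎

      -- (i + 2) (1 + q / (i + 2)) = (i + 3) + ε, because q = 1 + ε.
      T-suc : ∀ i → T i ≡ T (suc i) + ε * β (suc i)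
      T-suc i = begin-equality
        β i * ι (suc (suc i))                                            ≡⟨ cong (_* ι (suc (suc i))) (β-suc i) ⟩
        β (suc i) * (1ℚ + q * recip (suc i)) * ι (suc (suc i))           ≡⟨ solve 4 (λ b e r j → b :* (con 1ℚ :+ (con 1ℚ :+ e) :* r) :* j := b :* j :+ b :* ((con 1ℚ :+ e) :* (r :* j))) refl (β (suc i)) ε (recip (suc i)) (ι (suc (suc i))) ⟩
        β (suc i) * ι (suc (suc i)) + β (suc i) * (q * (recip (suc i) * ι (suc (suc i))))  ≡⟨ cong (λ t → β (suc i) * ι (suc (suc i)) + β (suc i) * (q * t)) (recip*ι (suc i)) ⟩
        β (suc i) * ι (suc (suc i)) + β (suc i) * (q * 1ℚ)               ≡⟨ solve 3 (λ b e j → b :* j :+ b :* ((con 1ℚ :+ e) :* con 1ℚ) := b :* (j :+ con 1ℚ) :+ e :* b) refl (β (suc i)) ε (ι (suc (suc i))) ⟩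
        β (suc i) * ι (suc (suc (suc i))) + ε * β (suc i)                ∎

      β-sum : ∀ a n → ε * ∑< n (λ j → β (suc a ℕ.+ j)) + T (a ℕ.+ n) ≡ T a
      β-sum a zero    rewrite ℕ.+-identityʳ a = trans (cong (_+ T a) (ℚ.*-zeroʳ ε)) (ℚ.+-identityˡ (T a))
      β-sum a (suc n) rewrite ℕ.+-suc a n = begin-equality
        ε * (∑< n (λ j → β (suc a ℕ.+ j)) + β (suc (a ℕ.+ n))) + T (suc (a ℕ.+ n))   ≡⟨ solve 4 (λ e s b t → e :* (s :+ b) :+ t := e :* s :+ (t :+ e :* b)) refl ε (∑< n (λ j → β (suc a ℕ.+ j))) (β (suc (a ℕ.+ n))) (T (suc (a ℕ.+ n))) ⟩
        ε * ∑< n (λ j → β (suc a ℕ.+ j)) + (T (suc (a ℕ.+ n)) + ε * β (suc (a ℕ.+ n))) ≡⟨ cong (ε * ∑< n (λ j → β (suc a ℕ.+ j)) +_) (T-suc (a ℕ.+ n)) ⟨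
        ε * ∑< n (λ j → β (suc a ℕ.+ j)) + T (a ℕ.+ n)                                  ≡⟨ β-sum a n ⟩
        T a                                                                             ∎

      β-sum≤ : ∀ a n → ε * ∑< n (λ j → β (suc a ℕ.+ j)) ≤ T a
      β-sum≤ a n = ℚ.≤-trans (p≤p+q (0≤T (a ℕ.+ n))) (ℚ.≤-reflexive (β-sum a n))

    ¼ : ℚ
    ¼ = ½ * ½

    abstract
      0≤¼ : 0ℚ ≤ ¼
      0≤¼ = 0≤p*q 0≤½ 0≤½

      -- `β (suc i)` is `T (suc i)` divided by i + 3, and 1 / (i + 3) is at least a quarter of 1 /
      -- (i + 1), the term by which `H` grows from `i` to `suc i`.
      β≥ : ∀ i → T (suc i) * (¼ * recip i) ≤ β (suc i)
      β≥ i = begin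
        T (suc i) * (¼ * recip i)           ≤⟨ *-monoˡ (0≤T (suc i)) quarter ⟩
        T (suc i) * recip (suc (suc i))     ≡⟨ solve 3 (λ b j r → b :* j :* r := b :* (r :* j)) refl (β (suc i)) (ι (suc (suc (suc i)))) (recip (suc (suc i))) ⟩
        β (suc i) * (recip (suc (suc i)) * ι (suc (suc (suc i)))) ≡⟨ cong (β (suc i) *_) (recip*ι (suc (suc i))) ⟩
        β (suc i) * 1ℚ                      ≡⟨ ℚ.*-identityʳ (β (suc i)) ⟩
        β (suc i)                           ∎
        where
        quarter : ¼ * recip i ≤ recip (suc (suc i))
        quarter = begin
          ¼ * recip i           ≡⟨ ℚ.*-assoc ½ ½ (recip i) ⟩
          ½ * (½ * recip i)     ≤⟨ *-monoˡ 0≤½ (half*recip i) ⟩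
          ½ * recip (suc i)     ≤⟨ half*recip (suc i) ⟩
          recip (suc (suc i))   ∎

      0≤H : ∀ n → 0ℚ ≤ H n
      0≤H n = ∑<-nonNeg n 0≤recip

      -- By `T-suc` and `β≥`, `T i` is at least `T (suc i)` times 1 + ε / (4 (i + 1)), and a product
      -- of such factors dominates 1 plus the sum of their increments. So `T` tends to 0 as `H`
      -- diverges.
      T-decay : ∀ i → T i * (1ℚ + ε * (¼ * H i)) ≤ T 0
      T-decay zero    = ℚ.≤-reflexive (solve 2 (λ t e → t :* (con 1ℚ :+ e :* (con ¼ :* con 0ℚ)) := t) refl (T 0) ε)
      T-decay (suc i) = begin
        T (suc i) * (1ℚ + ε * (¼ * (H i + recip i)))          ≡⟨ solve 5 (λ t e h r f → t :* (con 1ℚ :+ e :* (f :* (h :+ r))) := t :* (con 1ℚ :+ e :* (f :* h)) :+ (e :* (t :* (f :* r))) :* con 1ℚ) refl (T (suc i)) ε (H i) (recip i) ¼ ⟩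
        T (suc i) * A + ε * (T (suc i) * (¼ * recip i)) * 1ℚ  ≤⟨ ℚ.+-monoʳ-≤ (T (suc i) * A) (*-mono (0≤p*q 0≤ε (0≤p*q (0≤T (suc i)) (0≤p*q 0≤¼ (0≤recip i)))) 0≤A (*-monoˡ 0≤ε (β≥ i)) 1≤A) ⟩
        T (suc i) * A + ε * β (suc i) * A                     ≡⟨ ℚ.*-distribʳ-+ A (T (suc i)) (ε * β (suc i)) ⟨
        (T (suc i) + ε * β (suc i)) * A                       ≡⟨ cong (_* A) (T-suc i) ⟨
        T i * A                                               ≤⟨ T-decay i ⟩
        T 0                                                   ∎
        where
        A : ℚ
        A = 1ℚ + ε * (¼ * H i)
        1≤A : 1ℚ ≤ A
        1≤A = p≤p+q (0≤p*q 0≤ε (0≤p*q 0≤¼ (0≤H i)))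
        0≤A : 0ℚ ≤ A
        0≤A = ℚ.≤-trans 0≤1 1≤A

      -- H(2^(N + 1)) is at least (N + 1) / 2; together with the quarter in `T-decay` this makes the
      -- constant 8.
      T-2^ : ∀ N → ε * T (2 ℕ.^ suc N) ≤ 8ℚ * T 0 * recip N
      T-2^ N = begin
        ε * t                                       ≡⟨ ℚ.*-identityʳ (ε * t) ⟨
        ε * t * 1ℚ                                  ≡⟨ cong (ε * t *_) (recip*ι N) ⟨
        ε * t * (recip N * ι (suc N))               ≡⟨ solve 4 (λ e t r j → e :* t :* (r :* j) := con 8ℚ :* (t :* (e :* (con ¼ :* (con ½ :* j)))) :* r) refl ε t (recip N) (ι (suc N)) ⟩
        8ℚ * (t * (ε * (¼ * (½ * ι (suc N))))) * recip N    ≤⟨ *-monoʳ (0≤recip N) (*-monoˡ 0≤8 (*-monoˡ (0≤T n) (*-monoˡ 0≤ε (*-monoˡ 0≤¼ (H-2^ (suc N)))))) ⟩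
        8ℚ * (t * (ε * (¼ * H n))) * recip N        ≤⟨ *-monoʳ (0≤recip N) (*-monoˡ 0≤8 (*-monoˡ (0≤T n) (p≤q+p 0≤1))) ⟩
        8ℚ * (t * (1ℚ + ε * (¼ * H n))) * recip N   ≤⟨ *-monoʳ (0≤recip N) (*-monoˡ 0≤8 (T-decay n)) ⟩
        8ℚ * T 0 * recip N                          ∎
        where
        n : ℕ
        n = 2 ℕ.^ suc N
        t : ℚ
        t = T n

      β-tail : ∀ δ → 0ℚ < δ → ∃[ a ] (∀ n → ∑< n (λ j → β (suc a ℕ.+ j)) ≤ δ)
      β-tail δ 0<δ =
        -- One factor `ε` is spent in `β-sum≤`, the other in `T-2^`.
        let δ′ , 0<δ′ , small = shrink (8ℚ * T 0) (0≤p*q 0≤8 (0≤T 0)) (ε * (ε * δ)) (0<p*q 0<ε (0<p*q 0<ε 0<δ))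
            N , recipN≤δ′ = archimedean δ′ 0<δ′ in
        2 ℕ.^ suc N , λ n → *-cancelˡ 0<ε (*-cancelˡ 0<ε (begin
          ε * (ε * ∑< n (λ j → β (suc (2 ℕ.^ suc N) ℕ.+ j)))  ≤⟨ *-monoˡ 0≤ε (β-sum≤ (2 ℕ.^ suc N) n) ⟩
          ε * T (2 ℕ.^ suc N)                                 ≤⟨ T-2^ N ⟩
          8ℚ * T 0 * recip N                                  ≤⟨ *-monoˡ (0≤p*q 0≤8 (0≤T 0)) recipN≤δ′ ⟩
          8ℚ * T 0 * δ′                                       ≤⟨ ℚ.<⇒≤ small ⟩
          ε * (ε * δ)                                         ∎))

    majorant : ℕ → ℚ
    majorant n = β (n ℕ.∸ 1) * (2ℚ * 2ℚ)

    abstract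
      0≤majorant : ∀ n → 0ℚ ≤ majorant n
      0≤majorant n = 0≤p*q (ℚ.<⇒≤ (0<β (n ℕ.∸ 1))) (0≤p*q 0≤2 0≤2)

      ‖^-‖≤majorant : ∀ n → Positive n → Eventually (λ m → ExpLemmas.‖ n ^- s ! m ‖ ≤ majorant n)
      ‖^-‖≤majorant (suc i) _ = ev-map (λ m → estimate m) (growth*‖^-‖≤4 q 0≤q 1+ε≤re i)
        where
        estimate : ∀ m → g i * ExpLemmas.‖ suc i ^- s ! m ‖ ≤ 2ℚ * 2ℚ → ExpLemmas.‖ suc i ^- s ! m ‖ ≤ β i * (2ℚ * 2ℚ)
        estimate m h = begin
          z                   ≡⟨ ℚ.*-identityˡ z ⟨
          1ℚ * z              ≡⟨ cong (_* z) (β*g≡1 i) ⟨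
          β i * g i * z       ≡⟨ ℚ.*-assoc (β i) (g i) z ⟩
          β i * (g i * z)     ≤⟨ *-monoˡ (ℚ.<⇒≤ (0<β i)) h ⟩
          β i * (2ℚ * 2ℚ)     ∎
          where
          z : ℚ
          z = ExpLemmas.‖ suc i ^- s ! m ‖

  -- Finite sums over lists and over pairs

  module Lists {A : Set} where

    split-off : ∀ {xs ys : List A} → Unique xs → xs ⊆ ys → ∃[ zs ] ys ↭ xs ++ zs
    split-off {[]} {ys} _ _ = ys , ↭-refl
    split-off {x ∷ xs} (px ∷ uxs) xs⊆ys with ∈-∃++ (xs⊆ys (here refl))
    ... | as , bs , refl = let zs , p = split-off uxs sub in zs , ↭-trans (shift x as bs) (↭-prep x p)
      where
      sub : xs ⊆ as ++ bs
      sub {y} y∈xs with ∈-resp-↭ (shift x as bs) (xs⊆ys (there y∈xs))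
      ... | here refl = contradiction refl (All.lookup px y∈xs)
      ... | there y∈  = y∈

    unique-++⁻ʳ : ∀ xs {zs : List A} → Unique (xs ++ zs) → Unique zs
    unique-++⁻ʳ []       u       = u
    unique-++⁻ʳ (x ∷ xs) (_ ∷ u) = unique-++⁻ʳ xs u

    unique-++⁻-disjoint : ∀ xs {zs : List A} → Unique (xs ++ zs) → ∀ {z} → z ∈ zs → z ∉ xs
    unique-++⁻-disjoint (x ∷ xs) u z∈zs (here refl) = Unique.Unique[x∷xs]⇒x∉xs u (∈-++⁺ʳ xs z∈zs)
    unique-++⁻-disjoint (x ∷ xs) (_ ∷ u) z∈zs (there z∈xs) = unique-++⁻-disjoint xs u z∈zs z∈xs

    complement : ∀ {xs ys : List A} → Unique xs → Unique ys → xs ⊆ ys →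
      ∃[ zs ] ys ↭ xs ++ zs × Unique zs × zs ⊆ ys × (∀ {z} → z ∈ zs → z ∉ xs)
    complement {xs} uxs uys xs⊆ys =
      let zs , p = split-off uxs xs⊆ys
          u      = Permutationₛ.Unique-resp-↭ (setoid A) (↭⇒↭ₛ p) uys
      in zs , p , unique-++⁻ʳ xs u , (λ z∈zs → ∈-resp-↭ (↭-sym p) (∈-++⁺ʳ xs z∈zs)) , unique-++⁻-disjoint xs u

    lsum : (A → ℚ) → List A → ℚ
    lsum d []       = 0ℚ
    lsum d (x ∷ xs) = d x + lsum d xs

    csum : (A → ℂ) → List A → ℂ
    csum f xs = ∑ᶜ (map f xs)

    abstract
      lsum-nonNeg : ∀ {d : A → ℚ} → (∀ a → 0ℚ ≤ d a) → ∀ xs → 0ℚ ≤ lsum d xs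
      lsum-nonNeg h []       = ℚ.≤-refl
      lsum-nonNeg h (x ∷ xs) = 0≤p+q (h x) (lsum-nonNeg h xs)

      lsum-↭ : ∀ (d : A → ℚ) {xs ys} → xs ↭ ys → lsum d xs ≡ lsum d ys
      lsum-↭ d ↭.refl = refl
      lsum-↭ d (prep x p) = cong (d x +_) (lsum-↭ d p)
      lsum-↭ d (swap {xs} {ys} x y p) = trans (cong (λ t → d x + (d y + t)) (lsum-↭ d p)) (solve 3 (λ x y t → x :+ (y :+ t) := y :+ (x :+ t)) refl (d x) (d y) (lsum d ys))
      lsum-↭ d (↭.trans p q) = trans (lsum-↭ d p) (lsum-↭ d q)

      lsum-++ : ∀ (d : A → ℚ) xs ys → lsum d (xs ++ ys) ≡ lsum d xs + lsum d ys
      lsum-++ d []       ys = sym (ℚ.+-identityˡ (lsum d ys))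
      lsum-++ d (x ∷ xs) ys = trans (cong (d x +_) (lsum-++ d xs ys)) (sym (ℚ.+-assoc (d x) (lsum d xs) (lsum d ys)))

      lsum-⊆ : ∀ {d : A → ℚ} → (∀ a → 0ℚ ≤ d a) → ∀ {xs ys} → Unique xs → xs ⊆ ys → lsum d xs ≤ lsum d ys
      lsum-⊆ {d} h {xs} {ys} uxs xs⊆ys = let zs , p = split-off uxs xs⊆ys in
        ℚ.≤-trans (p≤p+q (lsum-nonNeg h zs)) (ℚ.≤-reflexive (sym (trans (lsum-↭ d p) (lsum-++ d xs zs))))

      lsum-filter : ∀ (d : A → ℚ) {P : A → Set} (P? : Unary.Decidable P) xs →
        lsum d xs ≡ lsum d (filter P? xs) + lsum d (filter (¬? ∘ P?) xs)
      lsum-filter d P? [] = refl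
      lsum-filter d P? (x ∷ xs) with P? x
      ... | yes _ = trans (cong (d x +_) (lsum-filter d P? xs)) (sym (ℚ.+-assoc (d x) (lsum d (filter P? xs)) (lsum d (filter (¬? ∘ P?) xs))))
      ... | no  _ = trans (cong (d x +_) (lsum-filter d P? xs)) (solve 3 (λ x a b → x :+ (a :+ b) := a :+ (x :+ b)) refl (d x) (lsum d (filter P? xs)) (lsum d (filter (¬? ∘ P?) xs)))

      csum-↭ : ∀ (f : A → ℂ) {xs ys} → xs ↭ ys → ∀ m → csum f xs ! m ≡ csum f ys ! m
      csum-↭ f ↭.refl m = refl
      csum-↭ f (prep x p) m = cong (f x ! m ⊕_) (csum-↭ f p m)
      csum-↭ f (swap {xs} {ys} x y p) m = trans (cong (λ t → f x ! m ⊕ (f y ! m ⊕ t)) (csum-↭ f p m))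
        (𝔾.solve 3 (λ x y t → x 𝔾.:+ (y 𝔾.:+ t) 𝔾.:= y 𝔾.:+ (x 𝔾.:+ t)) refl (f x ! m) (f y ! m) (csum f ys ! m))
      csum-↭ f (↭.trans p q) m = trans (csum-↭ f p m) (csum-↭ f q m)

      csum-++ : ∀ (f : A → ℂ) xs ys m → csum f (xs ++ ys) ! m ≡ csum f xs ! m ⊕ csum f ys ! m
      csum-++ f []       ys m = sym (⊕-identityˡ (csum f ys ! m))
      csum-++ f (x ∷ xs) ys m = trans (cong (f x ! m ⊕_) (csum-++ f xs ys m)) (sym (⊕-assoc (f x ! m) (csum f xs ! m) (csum f ys ! m)))

      csum-bound : ∀ {f : A → ℂ} {d} xs → (∀ {a} → a ∈ xs → Eventually (λ m → ‖ f a ! m ‖ ≤ d a)) →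
        Eventually (λ m → ‖ csum f xs ! m ‖ ≤ lsum d xs)
      csum-bound []       h = 0 , λ _ _ → ℚ.≤-refl
      csum-bound {f} (x ∷ xs) h = ev-zip (λ m p q → ℚ.≤-trans (‖⊕‖ (f x ! m) (csum f xs ! m)) (ℚ.+-mono-≤ p q)) (h (here refl)) (csum-bound xs (h ∘ there))

  open Lists public

  module Pairs {A B : Set} where

    _⊠_ : (A → ℚ) → (B → ℚ) → A × B → ℚ
    (d ⊠ e) (a , b) = d a * e b

    _⊠ᶜ_ : (A → ℂ) → (B → ℂ) → A × B → ℂ
    (f ⊠ᶜ g) (a , b) = f a *ᶜ g b

    abstract
      lsum-map-, : ∀ d e (a : A) (ys : List B) → lsum (d ⊠ e) (map (a ,_) ys) ≡ d a * lsum e ys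
      lsum-map-, d e a []       = sym (ℚ.*-zeroʳ (d a))
      lsum-map-, d e a (y ∷ ys) = trans (cong (d a * e y +_) (lsum-map-, d e a ys)) (sym (ℚ.*-distribˡ-+ (d a) (e y) (lsum e ys)))

      lsum-cartesianProduct : ∀ d e (xs : List A) (ys : List B) → lsum (d ⊠ e) (cartesianProduct xs ys) ≡ lsum d xs * lsum e ys
      lsum-cartesianProduct d e []       ys = sym (ℚ.*-zeroˡ (lsum e ys))
      lsum-cartesianProduct d e (x ∷ xs) ys = trans (lsum-++ (d ⊠ e) (map (x ,_) ys) (cartesianProduct xs ys))
        (trans (cong₂ _+_ (lsum-map-, d e x ys) (lsum-cartesianProduct d e xs ys)) (sym (ℚ.*-distribʳ-+ (lsum e ys) (d x) (lsum d xs))))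

      csum-map-, : ∀ f g (a : A) (ys : List B) m → csum (f ⊠ᶜ g) (map (a ,_) ys) ! m ≡ f a ! m ⊗ csum g ys ! m
      csum-map-, f g a []       m = 𝔾.solve 1 (λ x → 𝔾.con 0ᵍ 𝔾.:= x 𝔾.:* 𝔾.con 0ᵍ) refl (f a ! m)
      csum-map-, f g a (y ∷ ys) m = trans (cong (f a ! m ⊗ g y ! m ⊕_) (csum-map-, f g a ys m)) (sym (⊗-distribˡ-⊕ (f a ! m) (g y ! m) (csum g ys ! m)))

      csum-cartesianProduct : ∀ f g (xs : List A) (ys : List B) m → csum (f ⊠ᶜ g) (cartesianProduct xs ys) ! m ≡ csum f xs ! m ⊗ csum g ys ! m
      csum-cartesianProduct f g []       ys m = 𝔾.solve 1 (λ x → 𝔾.con 0ᵍ 𝔾.:= 𝔾.con 0ᵍ 𝔾.:* x) refl (csum g ys ! m)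
      csum-cartesianProduct f g (x ∷ xs) ys m = trans (csum-++ (f ⊠ᶜ g) (map (x ,_) ys) (cartesianProduct xs ys) m)
        (trans (cong₂ _⊕_ (csum-map-, f g x ys m) (csum-cartesianProduct f g xs ys m)) (sym (⊗-distribʳ-⊕ (csum g ys ! m) (f x ! m) (csum f xs ! m))))

  open Pairs public

  -- Absolute and unconditional convergence

  module _ {A : Set} (P : A → Set) where

    Tail : (A → ℚ) → List A → ℚ → Set
    Tail d xs δ = ∀ ys → Unique ys → (∀ {y} → y ∈ ys → P y) → (∀ {y} → y ∈ ys → y ∉ xs) → lsum d ys ≤ δ

    record SmallTail (d : A → ℚ) (δ : ℚ) : Set where
      constructor mkSmallTail
      field
        support : List A
        unique  : Unique support
        inP     : ∀ {a} → a ∈ support → P a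
        tail    : Tail d support δ

    record Dominated (d : A → ℚ) (f : A → ℂ) : Set where
      constructor mkDominated
      field
        nonNeg    : ∀ a → 0ℚ ≤ d a
        dominates : ∀ a → P a → Eventually (λ m → ‖ f a ! m ‖ ≤ d a)

    -- One list serves two purposes in `approx`: its sum is close to `z`, and the majorant is small
    -- outside it. By `superset-close` the sums over all larger lists are then close to `z` as well.
    record AbsSum (f : A → ℂ) (z : ℂ) : Set where
      constructor mkAbsSum
      field
        majorant  : A → ℚ
        dominated : Dominated majorant f
        approx    : ∀ δ → 0ℚ < δ → ∃[ t ] Eventually (λ m → ‖ csum f (SmallTail.support {majorant} {δ} t) ! m ⊖ z ! m ‖ ≤ δ)

    record Converges (f : A → ℂ) (z : ℂ) : Set where
      constructor mkConverges
      field
        limit : ∀ ε → 0ℚ < ε → ∃[ xs ] Unique xs × (∀ {x} → x ∈ xs → P x) ×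
          (∀ ys → Unique ys → (∀ {y} → y ∈ ys → P y) → xs ⊆ ys → Eventually (λ m → ‖ csum f ys ! m ⊖ z ! m ‖ ≤ ε))

  module AbsoluteConvergence {A : Set} {P : A → Set} where
    open ℚ.≤-Reasoning
    open SmallTail
    open Dominated

    abstract
      superset-close : ∀ {d f δ} → Dominated P d f → (t : SmallTail P d δ) → ∀ {ys} → Unique ys → (∀ {y} → y ∈ ys → P y) →
        support t ⊆ ys → Eventually (λ m → ‖ csum f ys ! m ⊖ csum f (support t) ! m ‖ ≤ δ)
      superset-close {d} {f} {δ} dom t {ys} uys ys∈P xs⊆ys =
        let zs , p , uzs , zs⊆ys , disjoint = complement (unique t) uys xs⊆ys in
        ev-map (λ m h → begin
          ‖ csum f ys ! m ⊖ csum f (support t) ! m ‖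
            ≡⟨ cong (λ u → ‖ u ⊖ csum f (support t) ! m ‖) (trans (csum-↭ f p m) (csum-++ f (support t) zs m)) ⟩
          ‖ (csum f (support t) ! m ⊕ csum f zs ! m) ⊖ csum f (support t) ! m ‖
            ≡⟨ cong ‖_‖ (𝔾.solve 2 (λ a b → (a 𝔾.:+ b) 𝔾.:- a 𝔾.:= b) refl (csum f (support t) ! m) (csum f zs ! m)) ⟩
          ‖ csum f zs ! m ‖
            ≤⟨ h ⟩
          lsum d zs
            ≤⟨ tail t zs uzs (ys∈P ∘ zs⊆ys) disjoint ⟩
          δ ∎) (csum-bound zs (λ a∈zs → dominates dom _ (ys∈P (zs⊆ys a∈zs))))

      absSum⇒converges : ∀ {f z} → AbsSum P f z → Converges P f z
      absSum⇒converges {f} {z} (mkAbsSum d dom approx) = mkConverges λ ε 0<ε →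
        let δ , 0<δ , δ+δ≤ε = half ε 0<ε
            t , near        = approx δ 0<δ
        in support t , unique t , inP t , λ ys uys ys∈P xs⊆ys → ev-zip (λ m p q →
          ℚ.≤-trans (triangle (csum f ys ! m) (csum f (support t) ! m) (z ! m)) (ℚ.≤-trans (ℚ.+-mono-≤ p q) δ+δ≤ε))
          (superset-close dom t uys ys∈P xs⊆ys) near

      normSq≤ : ∀ z → normSq z ≤ ‖ z ‖ * ‖ z ‖
      normSq≤ (x , y) = begin
        x * x + y * y                              ≤⟨ ℚ.+-mono-≤ (sq x) (sq y) ⟩
        ∣ x ∣ * ∣ x ∣ + ∣ y ∣ * ∣ y ∣              ≤⟨ p≤p+q (0≤p*q 0≤2 (0≤p*q (ℚ.0≤∣p∣ x) (ℚ.0≤∣p∣ y))) ⟩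
        ∣ x ∣ * ∣ x ∣ + ∣ y ∣ * ∣ y ∣ + 2ℚ * (∣ x ∣ * ∣ y ∣)  ≡⟨ solve 2 (λ a b → a :* a :+ b :* b :+ (con 1ℚ :+ con 1ℚ) :* (a :* b) := (a :+ b) :* (a :+ b)) refl ∣ x ∣ ∣ y ∣ ⟩
        (∣ x ∣ + ∣ y ∣) * (∣ x ∣ + ∣ y ∣)          ∎
        where
        sq : ∀ x → x * x ≤ ∣ x ∣ * ∣ x ∣
        sq x = ℚ.≤-trans (p≤∣p∣ (x * x)) (ℚ.≤-reflexive (ℚ.∣p*q∣≡∣p∣*∣q∣ x x))

      converges⇒hasSum : ∀ {f z} → Converges P f z → HasSum P f z
      converges⇒hasSum {f} {z} (mkConverges limit) ε 0<ε =
        -- With tolerance ε / 2 the square is at most ε² / 4; the distance ε² / 2 is then available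
        -- as the positive gap that `_<ᴿ_` demands.
        let xs , uxs , xs∈P , h = limit (½ * ε) (0<p*q (ℚ.positive⁻¹ ½) 0<ε) in
        xs , uxs , All.tabulate xs∈P , λ ys uys ysP xs⊆ys →
          ½ * (ε * ε) , 0<p*q (ℚ.positive⁻¹ ½) (0<p*q 0<ε 0<ε) ,
          ev-map (λ m p → square m ys p) (h ys uys (All.lookup ysP) xs⊆ys)
        where
        0≤ε : 0ℚ ≤ ε
        0≤ε = ℚ.<⇒≤ 0<ε
        square : ∀ m ys → ‖ csum f ys ! m ⊖ z ! m ‖ ≤ ½ * ε → normSq (csum f ys ! m ⊖ z ! m) + ½ * (ε * ε) ≤ ε * ε
        square m ys p = begin
          normSq (csum f ys ! m ⊖ z ! m) + ½ * (ε * ε)  ≤⟨ ℚ.+-monoˡ-≤ (½ * (ε * ε)) (ℚ.≤-trans (normSq≤ (csum f ys ! m ⊖ z ! m)) (*-mono (0≤‖‖ (csum f ys ! m ⊖ z ! m)) 0≤½ε p p)) ⟩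
          (½ * ε) * (½ * ε) + ½ * (ε * ε)               ≤⟨ p≤p+q (0≤p*q 0≤½ε 0≤½ε) ⟩
          (½ * ε) * (½ * ε) + ½ * (ε * ε) + (½ * ε) * (½ * ε)  ≡⟨ solve 1 (λ e → (con ½ :* e) :* (con ½ :* e) :+ con ½ :* (e :* e) :+ (con ½ :* e) :* (con ½ :* e) := e :* e) refl ε ⟩
          ε * ε                                         ∎
          where
          0≤½ε : 0ℚ ≤ ½ * ε
          0≤½ε = 0≤p*q 0≤½ 0≤ε

  open AbsoluteConvergence public

  -- Change of index along a bijection

  module Transfer {A B : Set} {P : A → Set} {Q : B → Set} (ψ : B → A) where

    unique-map : ∀ {xs} → (∀ {x y} → x ∈ xs → y ∈ xs → ψ x ≡ ψ y → x ≡ y) → Unique xs → Unique (map ψ xs)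
    unique-map {[]}     inj []       = []
    unique-map {x ∷ xs} inj (px ∷ u) =
      All.map⁺ (All.tabulate λ y∈xs eq → All.lookup px y∈xs (inj (here refl) (there y∈xs) eq)) ∷ unique-map (λ x∈ y∈ → inj (there x∈) (there y∈)) u

    lift : (∀ a → P a → ∃[ b ] Q b × ψ b ≡ a) → ∀ ys → (∀ {y} → y ∈ ys → P y) → ∃[ zs ] map ψ zs ≡ ys × (∀ {z} → z ∈ zs → Q z)
    lift surj []       h = [] , refl , λ ()
    lift surj (y ∷ ys) h = let b , qb , eq = surj y (h (here refl)) ; zs , eqs , hz = lift surj ys (h ∘ there) in
      b ∷ zs , cong₂ _∷_ eq eqs , λ { (here refl) → qb ; (there z∈) → hz z∈ }

    csum-map : ∀ {f : A → ℂ} {g : B → ℂ} → (∀ b → Q b → (f (ψ b) !_) ≋ (g b !_)) → ∀ zs → (∀ {z} → z ∈ zs → Q z) → (csum f (map ψ zs) !_) ≋ (csum g zs !_)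
    csum-map h []       _  = ≋-reflexive λ _ → refl
    csum-map h (z ∷ zs) hz = ⊕-cong-≋ (h z (hz (here refl))) (csum-map h zs (hz ∘ there))

    -- A list containing `map ψ xs` is `map ψ zs` for a list `zs` of preimages; injectivity puts
    -- `xs` inside `zs`, and the sums over the two lists agree in the limit, term by term.
    transfer : ∀ {f : A → ℂ} {g : B → ℂ} {w} → (∀ b → Q b → P (ψ b)) → (∀ b b′ → Q b → Q b′ → ψ b ≡ ψ b′ → b ≡ b′) →
      (∀ a → P a → ∃[ b ] Q b × ψ b ≡ a) → (∀ b → Q b → (f (ψ b) !_) ≋ (g b !_)) → Converges Q g w → Converges P f w
    transfer {f} {g} {w} QP inj surj fg (mkConverges limit) = mkConverges λ ε 0<ε →
      let δ , 0<δ , δ+δ≤ε = half ε 0<ε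
          xs , uxs , xs∈Q , h = limit δ 0<δ
      in map ψ xs , unique-map (λ x∈ y∈ → inj _ _ (xs∈Q x∈) (xs∈Q y∈)) uxs ,
         (λ x∈ → let b , b∈ , eq = ∈-map⁻ ψ x∈ in subst P (sym eq) (QP b (xs∈Q b∈))) ,
         λ ys uys ys∈P xs⊆ys →
           let zs , eq , zs∈Q = lift surj ys ys∈P
               xs⊆zs : xs ⊆ zs
               xs⊆zs {x} x∈ = let z , z∈ , eq′ = ∈-map⁻ ψ (subst (ψ x ∈_) (sym eq) (xs⊆ys (∈-map⁺ ψ x∈))) in
                 subst (_∈ zs) (sym (inj x z (xs∈Q x∈) (zs∈Q z∈) eq′)) z∈
           in ev-zip (λ m p q → ℚ.≤-trans (triangle (csum f ys ! m) (csum g zs ! m) (w ! m)) (ℚ.≤-trans (ℚ.+-mono-≤ p q) δ+δ≤ε))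
                (close (subst (λ l → (csum f l !_) ≋ (csum g zs !_)) eq (csum-map fg zs zs∈Q)) δ 0<δ)
                (h zs (Unique.map⁻ (subst Unique (sym eq) uys)) zs∈Q xs⊆zs)

  -- Completeness, and existence of absolutely convergent sums

  module Completeness (S : ℕ → ℂ) (regular : ∀ {k j} → k ℕ.≤ j → Eventually (λ m → ‖ S k ! m ⊖ S j ! m ‖ ≤ recip k + recip k)) where
    open ℚ.≤-Reasoning

    settle : ∀ k → ∃[ M ] (∀ m n → M ℕ.≤ m → M ℕ.≤ n → ‖ S k ! m ⊖ S k ! n ‖ ≤ recip k + recip k)
    settle k = let M , h = common {seq (re (S k))} {seq (im (S k))} (cauchy (re (S k))) (cauchy (im (S k))) (recip k) (0<recip k) in
      M , λ m n M≤m M≤n → let p , q = h m n M≤m M≤n in ℚ.+-mono-≤ p q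

    index : ℕ → ℕ
    index k = proj₁ (settle k)

    -- A diagonal sequence: `S k` is read at an index from which its approximants differ by at most
    -- 2 / (k + 1).
    lim : ℕ → ℚ[i]
    lim k = S k ! index k

    6ℚ : ℚ
    6ℚ = 2ℚ * (2ℚ + 1ℚ)

    0≤6 : 0ℚ ≤ 6ℚ
    0≤6 = 0≤p*q 0≤2 (0≤p+q 0≤2 0≤1)

    abstract
      -- The way goes through an index `p` late enough for `S k`, for `S j` and for their
      -- comparison: three steps of at most 2 / (k + 1) each, hence the constant 6.
      lim-close′ : ∀ {k j n} → k ℕ.≤ j → index k ℕ.≤ n → ‖ S k ! n ⊖ lim j ‖ ≤ 6ℚ * recip k
      lim-close′ {k} {j} {n} k≤j M≤n = begin
        ‖ S k ! n ⊖ lim j ‖                                                      ≤⟨ triangle (S k ! n) (S k ! p) (lim j) ⟩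
        ‖ S k ! n ⊖ S k ! p ‖ + ‖ S k ! p ⊖ lim j ‖                              ≤⟨ ℚ.+-monoʳ-≤ (‖ S k ! n ⊖ S k ! p ‖) (triangle (S k ! p) (S j ! p) (lim j)) ⟩
        ‖ S k ! n ⊖ S k ! p ‖ + (‖ S k ! p ⊖ S j ! p ‖ + ‖ S j ! p ⊖ lim j ‖)    ≤⟨ ℚ.+-mono-≤ (proj₂ (settle k) n p M≤n (ℕ.m≤m⊔n (index k) _))
                                                                                     (ℚ.+-mono-≤ (proj₂ (regular k≤j) p (ℕ.≤-trans (ℕ.m≤m⊔n N _) (ℕ.m≤n⊔m (index k) _)))
                                                                                       (ℚ.≤-trans (proj₂ (settle j) p (index j) (ℕ.≤-trans (ℕ.m≤n⊔m N _) (ℕ.m≤n⊔m (index k) _)) ℕ.≤-refl)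
                                                                                         (ℚ.+-mono-≤ (recip-antimono k≤j) (recip-antimono k≤j)))) ⟩
        (r + r) + ((r + r) + (r + r))                                            ≡⟨ solve 1 (λ r → (r :+ r) :+ ((r :+ r) :+ (r :+ r)) := con 6ℚ :* r) refl r ⟩
        6ℚ * r                                                                   ∎
        where
        r : ℚ
        r = recip k
        N p : ℕ
        N = proj₁ (regular k≤j)
        p = index k ℕ.⊔ (N ℕ.⊔ index j)

      lim-regular : ∀ δ → 0ℚ < δ → ∃[ N ] (∀ m n → N ℕ.≤ m → N ℕ.≤ n → m ℕ.≤ n → ‖ lim m ⊖ lim n ‖ ≤ 6ℚ * δ)
      lim-regular δ 0<δ = let N , recipN≤δ = archimedean δ 0<δ in
        N , λ m n N≤m _ m≤n → ℚ.≤-trans (lim-close′ m≤n ℕ.≤-refl) (*-monoˡ 0≤6 (ℚ.≤-trans (recip-antimono N≤m) recipN≤δ))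

      re-cauchy : Cauchy (λ k → proj₁ (lim k))
      re-cauchy = fromScaled {λ k → proj₁ (lim k)} 6ℚ 0≤6 λ δ 0<δ → let N , h = lim-regular δ 0<δ in
        N , λ m n N≤m N≤n m≤n → ℚ.≤-trans (p≤p+q (ℚ.0≤∣p∣ (proj₂ (lim m) - proj₂ (lim n)))) (h m n N≤m N≤n m≤n)

      im-cauchy : Cauchy (λ k → proj₂ (lim k))
      im-cauchy = fromScaled {λ k → proj₂ (lim k)} 6ℚ 0≤6 λ δ 0<δ → let N , h = lim-regular δ 0<δ in
        N , λ m n N≤m N≤n m≤n → ℚ.≤-trans (p≤q+p (ℚ.0≤∣p∣ (proj₁ (lim m) - proj₁ (lim n)))) (h m n N≤m N≤n m≤n)

    limᶜ : ℂ
    limᶜ = mkℂ (mkℝ (λ k → proj₁ (lim k)) re-cauchy) (mkℝ (λ k → proj₂ (lim k)) im-cauchy)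

    abstract
      lim-close : ∀ k → Eventually (λ m → ‖ S k ! m ⊖ limᶜ ! m ‖ ≤ 6ℚ * recip k)
      lim-close k = k ℕ.⊔ index k , λ n h → lim-close′ (ℕ.m⊔n≤o⇒m≤o k (index k) h) (ℕ.m⊔n≤o⇒n≤o k (index k) h)

  module Existence {A : Set} (_≟_ : DecidableEquality A) {P : A → Set} where
    open SmallTail

    module _ {d : A → ℚ} {f : A → ℂ} (dom : Dominated P d f) (tails : ∀ δ → 0ℚ < δ → SmallTail P d δ) where

      t : ∀ k → SmallTail P d (recip k)
      t k = tails (recip k) (0<recip k)

      S : ℕ → ℂ
      S k = csum f (support (t k))

      abstract
        -- Both sums are compared with the sum over the union of the two supports; decidable
        -- equality serves to remove its repetitions.
        regular : ∀ {k j} → k ℕ.≤ j → Eventually (λ m → ‖ S k ! m ⊖ S j ! m ‖ ≤ recip k + recip k)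
        regular {k} {j} k≤j = ev-zip (λ m p q → ℚ.≤-trans (triangle (S k ! m) (csum f zs ! m) (S j ! m))
              (ℚ.+-mono-≤ (ℚ.≤-trans (ℚ.≤-reflexive (‖⊖‖-sym (S k ! m) (csum f zs ! m))) p) (ℚ.≤-trans q (recip-antimono k≤j))))
            (superset-close dom (t k) uzs zs∈P (λ x∈ → ∈-deduplicate⁺ _≟_ (∈-++⁺ˡ x∈)))
            (superset-close dom (t j) uzs zs∈P (λ x∈ → ∈-deduplicate⁺ _≟_ (∈-++⁺ʳ (support (t k)) x∈)))
          where
          zs : List A
          zs = deduplicate _≟_ (support (t k) ++ support (t j))
          uzs : Unique zs
          uzs = DecUnique.deduplicate-! _≟_ (support (t k) ++ support (t j))
          zs∈P : ∀ {z} → z ∈ zs → P z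
          zs∈P z∈ with ∈-++⁻ (support (t k)) (∈-deduplicate⁻ _≟_ (support (t k) ++ support (t j)) z∈)
          ... | inj₁ z∈k = inP (t k) z∈k
          ... | inj₂ z∈j = inP (t j) z∈j

      open Completeness S regular

      absSum-exists : ∃[ z ] AbsSum P f z
      absSum-exists = limᶜ , mkAbsSum d dom λ δ 0<δ →
        let δ′ , 0<δ′ , h = shrink 6ℚ 0≤6 δ 0<δ
            N , recipN≤δ′ = archimedean δ′ 0<δ′
            6recip≤δ : 6ℚ * recip N ≤ δ
            6recip≤δ = ℚ.≤-trans (*-monoˡ 0≤6 recipN≤δ′) (ℚ.<⇒≤ h)
            recip≤δ : recip N ≤ δ
            recip≤δ = ℚ.≤-trans (ℚ.≤-reflexive (sym (ℚ.*-identityˡ (recip N)))) (ℚ.≤-trans (*-monoʳ (0≤recip N) 1≤6) 6recip≤δ)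
        in mkSmallTail (support (t N)) (unique (t N)) (inP (t N)) (λ ys u p q → ℚ.≤-trans (tail (t N) ys u p q) recip≤δ) ,
           ev-map (λ m p → ℚ.≤-trans p 6recip≤δ) (lim-close N)
        where
        1≤6 : 1ℚ ≤ 6ℚ
        1≤6 = p≤p+q {1ℚ} {2ℚ * 2ℚ + 1ℚ} (0≤p+q (0≤p*q 0≤2 0≤2) 0≤1)

  -- Products of absolutely convergent series

  module Product {A B : Set} (_≟ᴬ_ : DecidableEquality A) (_≟ᴮ_ : DecidableEquality B) {P : A → Set} {Q : B → Set} where
    open SmallTail
    open Dominated
    open ℚ.≤-Reasoning

    PQ : A × B → Set
    PQ (a , b) = P a × Q b

    abstract
      -- A single small tail bounds all finite sums: elements inside the support add at most its
      -- sum, the others at most the tolerance, here 1.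
      total-bound : ∀ {C : Set} (_≟_ : DecidableEquality C) {R : C → Set} {d : C → ℚ} → (∀ c → 0ℚ ≤ d c) → (t : SmallTail R d 1ℚ) →
        ∀ ys → Unique ys → (∀ {y} → y ∈ ys → R y) → lsum d ys ≤ lsum d (support t) + 1ℚ
      total-bound _≟_ {R} {d} 0≤d t ys uys ys∈R = begin
        lsum d ys                                                     ≡⟨ lsum-filter d (_∈? support t) ys ⟩
        lsum d (filter (_∈? support t) ys) + lsum d (filter (¬? ∘ (_∈? support t)) ys)
          ≤⟨ ℚ.+-mono-≤ (lsum-⊆ 0≤d (Unique.filter⁺ (_∈? support t) uys) (λ y∈ → proj₂ (∈-filter⁻ (_∈? support t) {xs = ys} y∈)))
               (tail t _ (Unique.filter⁺ (¬? ∘ (_∈? support t)) uys) (λ y∈ → ys∈R (proj₁ (∈-filter⁻ (¬? ∘ (_∈? support t)) {xs = ys} y∈)))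
                 (λ y∈ → proj₂ (∈-filter⁻ (¬? ∘ (_∈? support t)) {xs = ys} y∈))) ⟩
        lsum d (support t) + 1ℚ ∎
        where open DecMembership _≟_ using (_∈?_)

      -- A finite set of pairs lies in the rectangle spanned by its projections, and the sum over a
      -- rectangle factors.
      rectangle-bound : ∀ {d : A → ℚ} {e : B → ℚ} {K L} → (∀ a → 0ℚ ≤ d a) → (∀ b → 0ℚ ≤ e b) → 0ℚ ≤ L → ∀ ys → Unique ys →
        (∀ us → Unique us → (∀ {u} → u ∈ us → u ∈ map proj₁ ys) → lsum d us ≤ K) →
        (∀ vs → Unique vs → (∀ {v} → v ∈ vs → v ∈ map proj₂ ys) → lsum e vs ≤ L) → lsum (d ⊠ e) ys ≤ K * L
      rectangle-bound {d} {e} {K} {L} 0≤d 0≤e 0≤L ys uys hK hL = begin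
        lsum (d ⊠ e) ys                        ≤⟨ lsum-⊆ (λ (a , b) → 0≤p*q (0≤d a) (0≤e b)) uys (λ y∈ →
                                                    ∈-cartesianProduct⁺ (∈-deduplicate⁺ _≟ᴬ_ (∈-map⁺ proj₁ y∈)) (∈-deduplicate⁺ _≟ᴮ_ (∈-map⁺ proj₂ y∈))) ⟩
        lsum (d ⊠ e) (cartesianProduct us vs)  ≡⟨ lsum-cartesianProduct d e us vs ⟩
        lsum d us * lsum e vs                  ≤⟨ *-mono (lsum-nonNeg 0≤d us) 0≤L
                                                    (hK us (DecUnique.deduplicate-! _≟ᴬ_ (map proj₁ ys)) (∈-deduplicate⁻ _≟ᴬ_ (map proj₁ ys)))
                                                    (hL vs (DecUnique.deduplicate-! _≟ᴮ_ (map proj₂ ys)) (∈-deduplicate⁻ _≟ᴮ_ (map proj₂ ys))) ⟩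
        K * L                                  ∎
        where
        us : List A
        us = deduplicate _≟ᴬ_ (map proj₁ ys)
        vs : List B
        vs = deduplicate _≟ᴮ_ (map proj₂ ys)

    module _ {f : A → ℂ} {g : B → ℂ} {z w : ℂ} (sf : AbsSum P f z) (sg : AbsSum Q g w) where
      open AbsSum sf renaming (majorant to d; dominated to dom; approx to approxᶠ)
      open AbsSum sg renaming (majorant to e; dominated to edom; approx to approxᵍ)

      private
        t₁ : SmallTail P d 1ℚ
        t₁ = proj₁ (approxᶠ 1ℚ 0<1)
        t₂ : SmallTail Q e 1ℚ
        t₂ = proj₁ (approxᵍ 1ℚ 0<1)
        K L W : ℚ
        K = lsum d (support t₁) + 1ℚ
        L = lsum e (support t₂) + 1ℚ
        W = Bounded.bound (bounded-! w)

      abstract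
        0≤K : 0ℚ ≤ K
        0≤K = 0≤p+q (lsum-nonNeg (nonNeg dom) (support t₁)) 0≤1

        0≤L : 0ℚ ≤ L
        0≤L = 0≤p+q (lsum-nonNeg (nonNeg edom) (support t₂)) 0≤1

        0≤W : 0ℚ ≤ W
        0≤W = Bounded.0≤bound (bounded-! w)

        product-dominated : Dominated PQ (d ⊠ e) (f ⊠ᶜ g)
        product-dominated = mkDominated (λ (a , b) → 0≤p*q (nonNeg dom a) (nonNeg edom b)) λ (a , b) (pa , qb) →
          ev-zip (λ m p q → ℚ.≤-trans (‖⊗‖ (f a ! m) (g b ! m)) (*-mono (0≤‖‖ (f a ! m)) (nonNeg edom b) p q)) (dominates dom a pa) (dominates edom b qb)

        -- Pairs outside the rectangle of the supports are sorted by whether the first coordinate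
        -- lies outside its support. If so, it contributes at most `δ` against the total `L`; if
        -- not, the second coordinate lies outside, which gives `K * δ`.
        product-tail : ∀ {δ} → 0ℚ ≤ δ → (t : SmallTail P d δ) (t′ : SmallTail Q e δ) →
          Tail PQ (d ⊠ e) (cartesianProduct (support t) (support t′)) (δ * L + K * δ)
        product-tail {δ} 0≤δ t t′ ys uys ys∈PQ disjoint = begin
          lsum (d ⊠ e) ys                              ≡⟨ lsum-filter (d ⊠ e) out? ys ⟩
          lsum (d ⊠ e) (filter out? ys) + lsum (d ⊠ e) (filter (¬? ∘ out?) ys)
            ≤⟨ ℚ.+-mono-≤
                 (rectangle-bound (nonNeg dom) (nonNeg edom) 0≤L (filter out? ys) (Unique.filter⁺ out? uys)
                   (λ us uus h → tail t us uus (λ u∈ → let y , y∈ , eq = ∈-map⁻ proj₁ (h u∈) in subst P (sym eq) (proj₁ (ys∈PQ (proj₁ (∈-filter⁻ out? {xs = ys} y∈)))))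
                     (λ u∈ → let y , y∈ , eq = ∈-map⁻ proj₁ (h u∈) in subst (_∉ support t) (sym eq) (proj₂ (∈-filter⁻ out? {xs = ys} y∈))))
                   (λ vs uvs h → total-bound _≟ᴮ_ (nonNeg edom) t₂ vs uvs (λ v∈ → let y , y∈ , eq = ∈-map⁻ proj₂ (h v∈) in subst Q (sym eq) (proj₂ (ys∈PQ (proj₁ (∈-filter⁻ out? {xs = ys} y∈)))))))
                 (rectangle-bound (nonNeg dom) (nonNeg edom) 0≤δ (filter (¬? ∘ out?) ys) (Unique.filter⁺ (¬? ∘ out?) uys)
                   (λ us uus h → total-bound _≟ᴬ_ (nonNeg dom) t₁ us uus (λ u∈ → let y , y∈ , eq = ∈-map⁻ proj₁ (h u∈) in subst P (sym eq) (proj₁ (ys∈PQ (proj₁ (∈-filter⁻ (¬? ∘ out?) {xs = ys} y∈))))))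
                   (λ vs uvs h → tail t′ vs uvs (λ v∈ → let y , y∈ , eq = ∈-map⁻ proj₂ (h v∈) in subst Q (sym eq) (proj₂ (ys∈PQ (proj₁ (∈-filter⁻ (¬? ∘ out?) {xs = ys} y∈)))))
                     (λ v∈ v∈t′ → let y , y∈ , eq = ∈-map⁻ proj₂ (h v∈) ; y∈ys , ¬out = ∈-filter⁻ (¬? ∘ out?) {xs = ys} y∈ in
                       ¬out (λ a∈t → disjoint y∈ys (∈-cartesianProduct⁺ a∈t (subst (_∈ support t′) eq v∈t′)))))) ⟩
          δ * L + K * δ                                ∎
          where
          open DecMembership _≟ᴬ_ using (_∈?_)
          out? : (y : A × B) → Dec (proj₁ y ∉ support t)
          out? y = ¬? (proj₁ y ∈? support t)

        product-close : ∀ {δ} → 0ℚ ≤ δ → (t : SmallTail P d δ) (t′ : SmallTail Q e δ) →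
          Eventually (λ m → ‖ csum f (support t) ! m ⊖ z ! m ‖ ≤ δ) → Eventually (λ m → ‖ csum g (support t′) ! m ⊖ w ! m ‖ ≤ δ) →
          Eventually (λ m → ‖ csum (f ⊠ᶜ g) (cartesianProduct (support t) (support t′)) ! m ⊖ (z *ᶜ w) ! m ‖ ≤ K * δ + δ * W)
        product-close {δ} 0≤δ t t′ near near′ = ev-zip (λ m p (q , r) → begin
            ‖ csum (f ⊠ᶜ g) (cartesianProduct (support t) (support t′)) ! m ⊖ (z *ᶜ w) ! m ‖
              ≡⟨ cong (λ u → ‖ u ⊖ z ! m ⊗ w ! m ‖) (csum-cartesianProduct f g (support t) (support t′) m) ⟩
            ‖ X m ⊗ Y m ⊖ z ! m ⊗ w ! m ‖
              ≡⟨ cong ‖_‖ (𝔾.solve 4 (λ a b c d → a 𝔾.:* b 𝔾.:- c 𝔾.:* d 𝔾.:= a 𝔾.:* (b 𝔾.:- d) 𝔾.:+ (a 𝔾.:- c) 𝔾.:* d) refl (X m) (Y m) (z ! m) (w ! m)) ⟩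
            ‖ X m ⊗ (Y m ⊖ w ! m) ⊕ (X m ⊖ z ! m) ⊗ w ! m ‖
              ≤⟨ ‖⊕‖ (X m ⊗ (Y m ⊖ w ! m)) ((X m ⊖ z ! m) ⊗ w ! m) ⟩
            ‖ X m ⊗ (Y m ⊖ w ! m) ‖ + ‖ (X m ⊖ z ! m) ⊗ w ! m ‖
              ≤⟨ ℚ.+-mono-≤ (‖⊗‖ (X m) (Y m ⊖ w ! m)) (‖⊗‖ (X m ⊖ z ! m) (w ! m)) ⟩
            ‖ X m ‖ * ‖ Y m ⊖ w ! m ‖ + ‖ X m ⊖ z ! m ‖ * ‖ w ! m ‖
              ≤⟨ ℚ.+-mono-≤ (*-mono (0≤‖‖ (X m)) 0≤δ (ℚ.≤-trans p (total-bound _≟ᴬ_ (nonNeg dom) t₁ (support t) (unique t) (inP t))) r)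
                   (*-mono (0≤‖‖ (X m ⊖ z ! m)) 0≤W q (Bounded.‖‖≤bound (bounded-! w) m)) ⟩
            K * δ + δ * W ∎)
            (csum-bound (support t) (λ a∈ → dominates dom _ (inP t a∈))) (ev-zip (λ m → _,_) near near′)
          where
          X Y : Seq
          X m = csum f (support t) ! m
          Y m = csum g (support t′) ! m

        product-absSum : AbsSum PQ (f ⊠ᶜ g) (z *ᶜ w)
        product-absSum = mkAbsSum (d ⊠ e) product-dominated λ δ 0<δ →
          let η , 0<η , h = shrink C (0≤p+q (0≤p+q 0≤K 0≤L) 0≤W) δ 0<δ
              0≤η = ℚ.<⇒≤ 0<η
              t , near = approxᶠ η 0<η
              t′ , near′ = approxᵍ η 0<η
          in mkSmallTail (cartesianProduct (support t) (support t′)) (Unique.cartesianProduct⁺ (unique t) (unique t′))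
               (λ ab∈ → let a∈ , b∈ = ∈-cartesianProduct⁻ (support t) (support t′) ab∈ in inP t a∈ , inP t′ b∈)
               (λ ys u p q → ℚ.≤-trans (product-tail 0≤η t t′ ys u p q) (ℚ.≤-trans (tail≤ η 0≤η) (ℚ.<⇒≤ h))) ,
             ev-map (λ m p → ℚ.≤-trans p (ℚ.≤-trans (close≤ η 0≤η) (ℚ.<⇒≤ h))) (product-close 0≤η t t′ near near′)
          where
          C : ℚ
          C = (K + L) + W
          tail≤ : ∀ η → 0ℚ ≤ η → η * L + K * η ≤ C * η
          tail≤ η 0≤η = begin
            η * L + K * η            ≤⟨ p≤p+q (0≤p*q 0≤W 0≤η) ⟩
            η * L + K * η + W * η    ≡⟨ solve 4 (λ h k l w → h :* l :+ k :* h :+ w :* h := ((k :+ l) :+ w) :* h) refl η K L W ⟩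
            C * η                    ∎
          close≤ : ∀ η → 0ℚ ≤ η → K * η + η * W ≤ C * η
          close≤ η 0≤η = begin
            K * η + η * W            ≤⟨ p≤p+q (0≤p*q 0≤L 0≤η) ⟩
            K * η + η * W + L * η    ≡⟨ solve 4 (λ h k l w → k :* h :+ h :* w :+ l :* h := ((k :+ l) :+ w) :* h) refl η K L W ⟩
            C * η                    ∎

open Valuation using (*-positive; ^-positive)
open Combinatorics
open Analysis
open Rationals
open LogLemmas using (ι)
open ℚ.+-*-Solver using (solve; _:+_; _:*_; _:-_; _:=_; con)

-- Sums of n⁻ˢ over decidable sets of positive integers

module DirichletSeries (s : ℂ) (1<re : fromℚ 1ℚ <ᴿ re s) where
  open import Data.Rational using (_+_; _*_; _≤_; _<_)
  open ℚ.≤-Reasoning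
  open Majorant s (proj₁ 1<re) (proj₁ (proj₂ 1<re)) (proj₂ (proj₂ 1<re))

  upper-bound : ∀ (ys : List ℕ) → ∃[ n ] (∀ {y} → y ∈ ys → y ℕ.< n)
  upper-bound []       = 0 , λ ()
  upper-bound (y ∷ ys) = let n , h = upper-bound ys in suc y ℕ.⊔ n , λ
    { (here refl) → ℕ.m≤m⊔n (suc y) n
    ; (there y∈)  → ℕ.≤-trans (h y∈) (ℕ.m≤n⊔m (suc y) n) }

  abstract
    lsum-majorant : ∀ a n → lsum majorant (applyDownFrom (λ j → suc (suc a) ℕ.+ j) n) ≡ ∑< n (λ j → β (suc a ℕ.+ j)) * (2ℚ * 2ℚ)
    lsum-majorant a zero    = sym (ℚ.*-zeroˡ (2ℚ * 2ℚ))
    lsum-majorant a (suc n) = trans (cong (majorant (suc (suc a) ℕ.+ n) +_) (lsum-majorant a n))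
      (solve 3 (λ b s c → b :* c :+ s :* c := (s :+ b) :* c) refl (β (suc a ℕ.+ n)) (∑< n (λ j → β (suc a ℕ.+ j))) (2ℚ * 2ℚ))

  module _ {P : ℕ → Set} (P? : Unary.Decidable P) (P⊆Positive : ∀ {n} → P n → Positive n) where

    abstract
      small-tail : ∀ δ → 0ℚ < δ → SmallTail P majorant δ
      small-tail δ 0<δ =
        let δ′ , 0<δ′ , 4δ′<δ = shrink (2ℚ * 2ℚ) (0≤p*q 0≤2 0≤2) δ 0<δ
            a , tail-a = β-tail δ′ 0<δ′
        -- The majorant at `n` is a multiple of `β (n - 1)`, so the tail of `β` from index `a + 1`
        -- on belongs to the numbers from `a + 2` on.
        in mkSmallTail (filter P? (upTo (suc (suc a)))) (Unique.filter⁺ P? (Unique.upTo⁺ (suc (suc a))))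
             (λ x∈ → proj₂ (∈-filter⁻ P? {xs = upTo (suc (suc a))} x∈))
             (λ ys uys ys∈P disjoint →
               let n , ys<n = upper-bound ys
                   2+a≤ : ∀ {y} → y ∈ ys → suc (suc a) ℕ.≤ y
                   2+a≤ y∈ = ℕ.≮⇒≥ λ y<2+a → disjoint y∈ (∈-filter⁺ P? (∈-upTo⁺ y<2+a) (ys∈P y∈))
               in begin
               lsum majorant ys                                               ≤⟨ lsum-⊆ 0≤majorant uys (λ {y} y∈ → subst (_∈ applyDownFrom (λ j → suc (suc a) ℕ.+ j) n) (ℕ.m+[n∸m]≡n (2+a≤ y∈))
                                                                                   (∈-applyDownFrom⁺ (λ j → suc (suc a) ℕ.+ j) (ℕ.≤-<-trans (ℕ.m∸n≤m y (suc (suc a))) (ys<n y∈)))) ⟩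
               lsum majorant (applyDownFrom (λ j → suc (suc a) ℕ.+ j) n)      ≡⟨ lsum-majorant a n ⟩
               ∑< n (λ j → β (suc a ℕ.+ j)) * (2ℚ * 2ℚ)                       ≤⟨ *-monoʳ (0≤p*q 0≤2 0≤2) (tail-a n) ⟩
               δ′ * (2ℚ * 2ℚ)                                                 ≡⟨ ℚ.*-comm δ′ (2ℚ * 2ℚ) ⟩
               2ℚ * 2ℚ * δ′                                                   ≤⟨ ℚ.<⇒≤ 4δ′<δ ⟩
               δ                                                              ∎)

    dirichlet : ∃[ z ] AbsSum P (λ n → n ^- s) z
    dirichlet = Existence.absSum-exists ℕ._≟_ (mkDominated 0≤majorant λ n pn → ‖^-‖≤majorant n (P⊆Positive pn)) small-tail

module Multiples where
  open import Data.Rational using (_+_; _*_; _≤_; _<_)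
  open ℚ.≤-Reasoning

  1<re-· : ∀ n .{{_ : NonZero n}} s → fromℚ 1ℚ <ᴿ re s → fromℚ 1ℚ <ᴿ re (n ·ᶜ s)
  1<re-· (suc n) s (ε , 0<ε , N , h) = ε , 0<ε , N , λ m N≤m → begin
    1ℚ + ε                                       ≤⟨ h m N≤m ⟩
    seq (re s) m                                 ≤⟨ p≤q+p (0≤p*q (0≤ι n) (ℚ.≤-trans (0≤p+q 0≤1 (ℚ.<⇒≤ 0<ε)) (h m N≤m))) ⟩
    ι n * seq (re s) m + seq (re s) m            ≡⟨ solve 3 (λ i x y → i :* x :+ x := (i :+ con 1ℚ) :* x :- con 0ℚ :* y) refl (ι n) (seq (re s) m) (seq (im s) m) ⟩
    ι (suc n) * seq (re s) m ℚ.- 0ℚ * seq (im s) m ≡⟨ cong (λ t → t * seq (re s) m ℚ.- 0ℚ * seq (im s) m) (/1≡ι (suc n)) ⟨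
    seq (re (suc n ·ᶜ s)) m                      ∎

open Multiples public

_≟ᵠ_ : ∀ {l} → DecidableEquality (Quotients l)
_≟ᵠ_ {zero}  = Unit._≟_
_≟ᵠ_ {suc l} = ≡-dec ℕ._≟_ (_≟ᵠ_ {l})

-- The base of the iterated product: the empty tuple alone is the support, and only the empty list
-- avoids it.
unit-absSum : AbsSum (AllPositive 0) (λ _ → 1ᶜ) 1ᶜ
unit-absSum = mkAbsSum (λ _ → 1ℚ) (mkDominated (λ _ → 0≤1) λ _ _ → 0 , λ _ _ → ℚ.≤-refl) λ δ 0<δ →
  mkSmallTail (tt ∷ []) ([] ∷ []) (λ _ → tt) (λ
    { []      _ _ _        → ℚ.<⇒≤ 0<δ
    ; (y ∷ _) _ _ disjoint → contradiction (here refl) (disjoint (here refl)) }) ,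
  0 , λ _ _ → ℚ.<⇒≤ 0<δ

≡⇒≈ᶜ : ∀ {z w} → (∀ m → z ! m ≡ w ! m) → z ≈ᶜ w
≡⇒≈ᶜ h = (λ ε 0<ε → 0 , λ m _ → zero-distance ε 0<ε (cong proj₁ (h m))) , (λ ε 0<ε → 0 , λ m _ → zero-distance ε 0<ε (cong proj₂ (h m)))
  where
  zero-distance : ∀ {x y} ε → 0ℚ ℚ.< ε → x ≡ y → ∣ x ℚ.- y ∣ ℚ.< ε
  zero-distance {x} ε 0<ε refl = subst (λ d → ∣ d ∣ ℚ.< ε) (sym (ℚ.+-inverseʳ x)) 0<ε

-- Stated for approximants, since reals with equal sequences may differ in their Cauchy proofs. `∏ᶜ`
-- multiplies on the right, the recursion over quotients on the left.
∏ᶜ-front : ∀ l (f : ℕ → ℂ) m → ∏ᶜ (suc l) f ! m ≡ f 0 ! m ⊗ ∏ᶜ l (f ∘ suc) ! m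
∏ᶜ-front zero    f m = ⊗-comm 1ᵍ (f 0 ! m)
∏ᶜ-front (suc l) f m = trans (cong (_⊗ f (suc l) ! m) (∏ᶜ-front l f m)) (⊗-assoc (f 0 ! m) (∏ᶜ l (f ∘ suc) ! m) (f (suc l) ! m))

∏ᶜ-cong : ∀ l {f g : ℕ → ℂ} → (∀ i → f i ≡ g i) → ∏ᶜ l f ≡ ∏ᶜ l g
∏ᶜ-cong zero    h = refl
∏ᶜ-cong (suc l) h = cong₂ _*ᶜ_ (∏ᶜ-cong l h) (h l)

-- Assembly of the identity, with `suc l` as the number of steps

module Identity (k l : ℕ) .{{_ : NonZero k}} (s : ℂ) (1<re : fromℚ 1ℚ <ᴿ re s) where
  open Exponents k (suc l)
  open Chains k (suc l)

  F-exists : ∃[ z ] AbsSum (StepPowerful k (suc l)) (λ n → n ^- s) z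
  F-exists = DirichletSeries.dirichlet s 1<re (stepPowerful? (s≤s z≤n)) proj₁

  ζ-exists : ∀ j → ∃[ z ] AbsSum Positive (λ n → n ^- ((suc j ℕ.* k) ·ᶜ s)) z
  ζ-exists j = DirichletSeries.dirichlet ((suc j ℕ.* k) ·ᶜ s) (1<re-· (suc j ℕ.* k) {{ℕ.m*n≢0 (suc j) k}} s 1<re) (0 ℕ.<?_) id

  F : ℂ
  F = proj₁ F-exists

  Z : ℕ → ℂ
  -- A default value; the product starts at index 2.
  Z zero    = 0ᶜ
  Z (suc j) = proj₁ (ζ-exists j)

  -- The power `weight j n ms ^- s` written as a product of powers of the single quotients.
  term : ∀ j n → Quotients n → ℂ
  term j zero    _        = 1ᶜ
  term j (suc n) (m , ms) = m ^- ((suc j ℕ.* k) ·ᶜ s) *ᶜ term (suc j) n ms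

  ζ-product : ℕ → ℕ → ℂ
  ζ-product j zero    = 1ᶜ
  ζ-product j (suc n) = Z (suc j) *ᶜ ζ-product (suc j) n

  term-absSum : ∀ j n → AbsSum (AllPositive n) (term j n) (ζ-product j n)
  term-absSum j zero    = unit-absSum
  term-absSum j (suc n) = Product.product-absSum ℕ._≟_ _≟ᵠ_ (proj₂ (ζ-exists j)) (term-absSum (suc j) n)

  weight-positive : ∀ j n ms → AllPositive n ms → Positive (weight j n ms)
  weight-positive j zero    _        _            = s≤s z≤n
  weight-positive j (suc n) (m , ms) (0<m , 0<ms) = *-positive (^-positive (suc j ℕ.* k) 0<m) (weight-positive (suc j) n ms 0<ms)

  weight^- : ∀ j n ms → AllPositive n ms → (weight j n ms ^- s !_) ≋ (term j n ms !_)
  weight^- j zero    _        _            = power-1 s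
  weight^- j (suc n) (m , ms) (0<m , 0<ms) = ≋-trans (power-* s (^-positive (suc j ℕ.* k) 0<m) (weight-positive (suc j) n ms 0<ms))
    (⊗-cong-≋ (bounded-! ((m ℕ.^ (suc j ℕ.* k)) ^- s)) (bounded-! (term (suc j) n ms)) (power-^ s 0<m (suc j ℕ.* k)) (weight^- (suc j) n ms 0<ms))

  -- `g` and `M` are paired because `Split` and `Join` act on them together. The zeta factor of `M`,
  -- of index `l + 2`, thus comes before the others and is moved to the end in `S≈`.
  Index : Set
  Index = (ℕ × ℕ) × Quotients l

  InIndex : Index → Set
  InIndex ((g , M) , ms) = (StepPowerful k (suc l) g × Positive M) × AllPositive l ms

  indexTerm : Index → ℂ
  indexTerm ((g , M) , ms) = (g ^- s *ᶜ M ^- ((suc (suc l) ℕ.* k) ·ᶜ s)) *ᶜ term 1 l ms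

  S : ℂ
  S = (F *ᶜ Z (suc (suc l))) *ᶜ ζ-product 1 l

  index-absSum : AbsSum InIndex indexTerm S
  index-absSum = Product.product-absSum (≡-dec ℕ._≟_ ℕ._≟_) _≟ᵠ_
    (Product.product-absSum ℕ._≟_ ℕ._≟_ (proj₂ F-exists) (proj₂ (ζ-exists (suc l)))) (term-absSum 1 l)

  toChain : Index → Tuple (suc l)
  toChain (gM , ms) = chain (suc l) (proj₁ (Split gM) , ms) (proj₂ (Split gM)) , proj₂ (Split gM)

  toChain-divisorChain : ∀ x → InIndex x → DivisorChain k (toChain x)
  toChain-divisorChain (gM , ms) (_ , 0<ms) = let 0<m , 0<n = Split-positive gM in
    chain-divisorChain (suc l) (proj₁ (Split gM) , ms) (proj₂ (Split gM)) (0<m , 0<ms) 0<n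

  toChain-injective : ∀ x y → InIndex x → InIndex y → toChain x ≡ toChain y → x ≡ y
  toChain-injective (gM , ms) (gM′ , ms′) ((sp , 0<M) , 0<ms) ((sp′ , 0<M′) , _) eq = cong₂ _,_ gM≡gM′ (cong proj₂ ms≡ms′)
    where
    n≡n′ : proj₂ (Split gM) ≡ proj₂ (Split gM′)
    n≡n′ = cong proj₂ eq
    -- `chain-injective` compares chains over the same last entry, so `n≡n′` is needed beforehand.
    ms≡ms′ : (proj₁ (Split gM) , ms) ≡ (proj₁ (Split gM′) , ms′)
    ms≡ms′ = chain-injective (suc l) (proj₁ (Split gM) , ms) (proj₁ (Split gM′) , ms′) (proj₂ (Split gM)) (proj₁ (Split-positive gM) , 0<ms)
      (trans (cong proj₁ eq) (cong (chain (suc l) (proj₁ (Split gM′) , ms′)) (sym n≡n′)))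
    gM≡gM′ : gM ≡ gM′
    gM≡gM′ = trans (sym (Join-Split sp 0<M)) (trans (cong Join (cong₂ _,_ (cong proj₁ ms≡ms′) n≡n′)) (Join-Split sp′ 0<M′))

  toChain-surjective : ∀ t → DivisorChain k t → ∃[ x ] InIndex x × toChain x ≡ t
  toChain-surjective (ns , n) dc@(_ , 0<n , _) =
    let (m , ms) , (0<m , 0<ms) , eq = chain-surjective ns n dc
        split-join = Split-Join {m , n} (0<m , 0<n)
    in (Join (m , n) , ms) , ((Join-stepPowerful (0<m , 0<n) , proj₂ (Join-positive (m , n))) , 0<ms) ,
       trans (cong (λ p → chain (suc l) (proj₁ p , ms) (proj₂ p) , proj₂ p) split-join) (cong (_, n) eq)

  product-toChain : ∀ x → InIndex x → let ((g , M) , ms) = x in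
    product (toList (entries k (toChain x))) ≡ (g ℕ.* M ℕ.^ (suc (suc l) ℕ.* k)) ℕ.* weight 1 l ms
  product-toChain x@((g , M) , ms) ((sp , 0<M) , 0<ms) = begin
    Π                                                                  ≡⟨ ℕ.*-identityˡ Π ⟨
    -- At `j = 0` no powers of the head are pending, and its power reduces to 1.
    1 ℕ.* Π                                                            ≡⟨ chain-weight 0 (suc l) (m , ms) n ⟩
    m ℕ.^ (1 ℕ.* k) ℕ.* W ℕ.* (root⌈ n ⌉ ℕ.^ (suc l ℕ.* k) ℕ.* n)      ≡⟨ cong (λ e → m ℕ.^ e ℕ.* W ℕ.* (root⌈ n ⌉ ℕ.^ (suc l ℕ.* k) ℕ.* n)) (ℕ.*-identityˡ k) ⟩
    m ℕ.^ k ℕ.* W ℕ.* (root⌈ n ⌉ ℕ.^ (suc l ℕ.* k) ℕ.* n)              ≡⟨ trans (ℕ.*-assoc (m ℕ.^ k) W R) (trans (cong (m ℕ.^ k ℕ.*_) (ℕ.*-comm W R)) (sym (ℕ.*-assoc (m ℕ.^ k) R W))) ⟩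
    m ℕ.^ k ℕ.* (root⌈ n ⌉ ℕ.^ (suc l ℕ.* k) ℕ.* n) ℕ.* W              ≡⟨ cong (ℕ._* W) (weight-Split sp 0<M) ⟩
    g ℕ.* M ℕ.^ (suc (suc l) ℕ.* k) ℕ.* W                              ∎
    where
    open ≡-Reasoning
    m n W Π R : ℕ
    m = proj₁ (Split (g , M))
    n = proj₂ (Split (g , M))
    W = weight 1 l ms
    Π = product (toList (entries k (toChain x)))
    R = root⌈ n ⌉ ℕ.^ (suc l ℕ.* k) ℕ.* n

  chain-term : ∀ x → InIndex x → (product (toList (entries k (toChain x))) ^- s !_) ≋ (indexTerm x !_)
  chain-term x@((g , M) , ms) inX@((sp , 0<M) , 0<ms) = subst (λ n → (n ^- s !_) ≋ (indexTerm x !_)) (sym (product-toChain x inX))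
    (≋-trans (power-* s 0<gM (weight-positive 1 l ms 0<ms))
      (⊗-cong-≋ (bounded-! ((g ℕ.* M ℕ.^ e) ^- s)) (bounded-! (term 1 l ms))
        (≋-trans (power-* s (proj₁ sp) (^-positive e 0<M))
          (⊗-cong-≋ (bounded-! (g ^- s)) (bounded-! (M ^- (e ·ᶜ s))) (≋-reflexive {g ^- s !_} λ _ → refl) (power-^ s 0<M e)))
        (weight^- 1 l ms 0<ms)))
    where
    e : ℕ
    e = suc (suc l) ℕ.* k
    0<gM : Positive (g ℕ.* M ℕ.^ e)
    0<gM = *-positive (proj₁ sp) (^-positive e 0<M)

  S-isChainSum : IsChainSum k (suc l) s S
  S-isChainSum = converges⇒hasSum (Transfer.transfer toChain toChain-divisorChain toChain-injective toChain-surjective chain-term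
    (absSum⇒converges index-absSum))

  F-isF : IsF k (suc l) s F
  F-isF = converges⇒hasSum (absSum⇒converges (proj₂ F-exists))

  Z-isζ : ∀ j → 2 ℕ.≤ j → Isζ ((j ℕ.* k) ·ᶜ s) (Z j)
  Z-isζ (suc j) _ = converges⇒hasSum (absSum⇒converges (proj₂ (ζ-exists j)))

  ζ-product-∏ᶜ : ∀ j n m → ζ-product j n ! m ≡ ∏ᶜ n (λ i → Z (suc j ℕ.+ i)) ! m
  ζ-product-∏ᶜ j zero    m = refl
  ζ-product-∏ᶜ j (suc n) m = sym (trans (∏ᶜ-front n (λ i → Z (suc j ℕ.+ i)) m) (cong₂ (λ a b → Z a ! m ⊗ b) (ℕ.+-identityʳ (suc j))
    (trans (cong (_! m) (∏ᶜ-cong n (λ i → cong Z (ℕ.+-suc (suc j) i)))) (sym (ζ-product-∏ᶜ (suc j) n m)))))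

  S≈ : S ≈ᶜ F *ᶜ ∏ᶜ (suc l) (λ i → Z (2 ℕ.+ i))
  S≈ = ≡⇒≈ᶜ {S} {F *ᶜ ∏ᶜ (suc l) (λ i → Z (2 ℕ.+ i))} λ m → trans (cong ((F ! m ⊗ Z (suc (suc l)) ! m) ⊗_) (ζ-product-∏ᶜ 1 l m))
    (𝔾.solve 3 (λ f z p → (f 𝔾.:* z) 𝔾.:* p 𝔾.:= f 𝔾.:* (p 𝔾.:* z)) refl (F ! m) (Z (suc (suc l)) ! m) (∏ᶜ l (λ i → Z (2 ℕ.+ i)) ! m))

open import Data.Nat using (ℕ; suc; _+_; _*_; _≤_; NonZero)

theorem10 : ∀ (k l : ℕ) .{{_ : NonZero k}} .{{_ : NonZero l}} (s : ℂ) → fromℚ 1ℚ <ᴿ re s →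
    Σ[ S ∈ ℂ ] Σ[ F ∈ ℂ ] Σ[ Z ∈ (ℕ → ℂ) ]
      IsChainSum k l s S ×
      IsF k l s F ×
      (∀ (j : ℕ) → 2 ≤ j → j ≤ suc l → Isζ ((j * k) ·ᶜ s) (Z j)) ×
      S ≈ᶜ F *ᶜ ∏ᶜ l (λ i → Z (2 + i))
theorem10 k zero s h = ⊥-elim (ℕ.≢-nonZero⁻¹ 0 refl)
theorem10 k (suc l) s h = S , F , Z , S-isChainSum , F-isF , (λ j 2≤j _ → Z-isζ j 2≤j) , S≈
  where open Identity k l s h
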